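{- There is no $(4,3,-2)$-graph, i.e., no graph of maximum degree $4$, diameter $3$ and order $M(4,3)-2=51$.
   Context: All graphs are simple. For integers $\Delta\ge 2$, $D\ge 1$, the Moore bound is $M(\Delta,D)=1+\Delta\left(1+(\Delta-1)+\dots+(\Delta-1)^{D-1}\right)$. For $\epsilon\ge 0$, a $(\Delta,D,-\epsilon)$-graph is a graph of maximum degree $\Delta$, diameter $D$, and order exactly $M(\Delta,D)-\epsilon$. -}

module Defs where

open import Data.Nat using (ℕ; zero; suc; _+_; _*_; _∸_; _^_; _≤_; pred)
open import Data.Bool using (Bool; true; false; if_then_else_)
open import Data.Fin using (Fin)
open import Data.List using (List; map; allFin)
open import Data.Nat.ListAction using (sum)
open import Data.Product using (Σ; _×_; ∃-syntax)
open import Relation.Binary.PropositionalEquality using (_≡_)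
open import Relation.Nullary using (¬_)

geomSum : ℕ → ℕ → ℕ
geomSum q zero    = 0
geomSum q (suc k) = geomSum q k + q ^ k

moore : ℕ → ℕ → ℕ
moore Δ D = 1 + Δ * geomSum (Δ ∸ 1) D

record Graph (n : ℕ) : Set where
  field
    adj   : Fin n → Fin n → Bool
    sym   : ∀ u v → adj u v ≡ adj v u
    loopless : ∀ v → adj v v ≡ false
open Graph public

degree : ∀ {n} → Graph n → Fin n → ℕ
degree {n} G v = sum (map (λ w → if adj G v w then 1 else 0) (allFin n))

data Within {n : ℕ} (G : Graph n) : ℕ → Fin n → Fin n → Set where
  here : ∀ {k u} → Within G k u u
  step : ∀ {k u w v} → adj G u w ≡ true → Within G k w v → Within G (suc k) u v

HasMaxDegree : ∀ {n} → Graph n → ℕ → Set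
HasMaxDegree {n} G Δ = (∀ v → degree G v ≤ Δ) × (∃[ v ] degree G v ≡ Δ)

-- diameter is exactly D (for D ≥ 1): all distances ≤ D, some distance > D-1
HasDiameter : ∀ {n} → Graph n → ℕ → Set
HasDiameter {n} G D =
  (∀ u v → Within G D u v) × (∃[ u ] ∃[ v ] ¬ Within G (pred D) u v)

IsMooreDefectGraph : (Δ D ε : ℕ) → Graph (moore Δ D ∸ ε) → Set
IsMooreDefectGraph Δ D ε G = HasMaxDegree G Δ × HasDiameter G D

{-# OPTIONS --safe #-}
module Submission where

-- A (4,3,-2)-graph is 4-regular, and its adjacency matrix satisfies A³ + A² − 6A − 3I = J + B, where the defect matrix B is
-- nonnegative, symmetric, with row sums 2 and zero diagonal, and commutes with A. Rows of B leave no room for triangles or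
-- quadrangles. The cycles of B partition the 51 vertices into classes, and AB = BA makes this partition equitable: the number
-- q v w of neighbours of v in the class of w depends only on the two classes, so that the matrix q satisfies
-- q³ + q² − 6q − 5I = (size of the column class), and size v · q v w = size w · q w v.
--   The last relation shows that a prime p ≥ 5 dividing one class size divides all of them, hence 51; a class of size 3 is
-- excluded locally, so the odd class sizes are among 9, 17, 27, 51. Modulo 2 the matrix q restricted to the odd classes is
-- symmetric with zero diagonal and zero row sums, and q³ + q² + I = J; this is impossible for 3 or 5 odd classes, and the
-- number of odd classes is odd and at most 5. So there is exactly one odd class κ, and its neighbours lie in κ and in even
-- classes, with even multiplicities. If κ is everything, B is a single odd cycle and A is a circulant matrix, which has
-- quadrangles; otherwise the integral equations for the row of κ and of its neighbouring classes have no solution.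

open import Defs hiding (sym)
open import Data.Bool using (Bool; true; false; if_then_else_; not; _∧_; _∨_; _xor_)
import Data.Bool.Properties as Bool
open import Data.Empty using (⊥; ⊥-elim)
open import Data.Fin using (Fin; zero; suc; toℕ; fromℕ<; combine)
open import Data.Fin.Patterns using (0F; 1F; 2F; 3F; 4F)
import Data.Fin.Properties as F
open import Data.Fin.Subset using (Subset)
open import Data.Fin.Subset.Properties using (anySubset?)
open import Data.List as List using (List; []; _∷_)
import Data.List.Properties as List
open import Data.List.Membership.Propositional using (_∈_)
open import Data.List.Relation.Unary.All as All using (All)
open import Data.List.Relation.Unary.Any as Any using (Any; here; there)
open import Data.Maybe as Maybe using (Maybe; just; nothing; fromMaybe)
open import Data.Nat
open import Data.Nat.Divisibility
open import Data.Nat.DivMod using (m≡m%n+[m/n]*n; m%n<n)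
import Data.Nat.ListAction as ListAction
open import Data.Nat.Primality using (Prime; prime?; euclidsLemma)
open import Data.Nat.Properties
open import Data.Nat.Solver using (module +-*-Solver)
open import Data.Product using (_×_; _,_; proj₁; proj₂; ∃; ∃₂; Σ-syntax)
open import Data.Sum using (_⊎_; inj₁; inj₂)
open import Data.Vec using (Vec; []; _∷_; lookup; tabulate)
open import Data.Vec.Properties using (lookup∘tabulate)
open import Function using (_∘_)
open import Relation.Nullary using (¬_; Dec; yes; no; does)
open import Relation.Nullary.Decidable
  using (¬?; _×-dec_; _⊎-dec_; _→-dec_; decidable-stable; dec-true; dec-false; from-no; from-yes; toWitness)
open import Relation.Binary.PropositionalEquality
import Algebra.Properties.Semiring.Sum +-*-semiring as Sum

-- Sums over Fin n

-- All identities stay in ℕ, with negative terms moved to the other side, and matrices mostly act on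
-- functions through `⊛`. The partition is equitable because of an eigenspace: the functions
-- constant on the cycles of B are exactly the solutions of Bf = 2f, and A maps this space to itself
-- since it commutes with B. A cycle may have length 2, which is an entry 2 of B. Excluding class
-- size 3 is what makes the argument modulo 2 a finite check. Odd classes then have at least 9
-- vertices, and six of them would need 54, so at most 1024 symmetric matrices have to be examined.
-- Equivalence of vertices is decided by a search through all subsets. It is kept `opaque`, as are
-- the sums, so that type checking never runs it on 51 vertices.

≥1⊎≡0 : ∀ k → 1 ≤ k ⊎ k ≡ 0
≥1⊎≡0 zero    = inj₂ refl
≥1⊎≡0 (suc k) = inj₁ (s≤s z≤n)

≥1-*ˡ : ∀ {a b} → 1 ≤ a * b → 1 ≤ a
≥1-*ˡ {suc a} _ = s≤s z≤n

≥1-*ʳ : ∀ {a b} → 1 ≤ a * b → 1 ≤ b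
≥1-*ʳ {a} {b} p = ≥1-*ˡ {b} {a} (subst (1 ≤_) (*-comm a b) p)

opaque
  δ : ∀ {n} → Fin n → Fin n → ℕ
  δ u v = if does (u F.≟ v) then 1 else 0

  δ-refl : ∀ {n} (u : Fin n) → δ u u ≡ 1
  δ-refl u with u F.≟ u
  ... | yes _ = refl
  ... | no ne = ⊥-elim (ne refl)

  δ-≢ : ∀ {n} {u v : Fin n} → u ≢ v → δ u v ≡ 0
  δ-≢ {u = u} {v} ne with u F.≟ v
  ... | yes e = ⊥-elim (ne e)
  ... | no _  = refl

  δ≥1 : ∀ {n} {u v : Fin n} → 1 ≤ δ u v → u ≡ v
  δ≥1 {u = u} {v} p with u F.≟ v
  ... | yes e = e
  ... | no _  with () ← p

  δ≤1 : ∀ {n} (u v : Fin n) → δ u v ≤ 1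
  δ≤1 u v with u F.≟ v
  ... | yes e = s≤s z≤n
  ... | no _  = z≤n

  δ-sym : ∀ {n} (u v : Fin n) → δ u v ≡ δ v u
  δ-sym u v with u F.≟ v
  ... | yes refl = sym (δ-refl u)
  ... | no ne    = sym (δ-≢ (ne ∘ sym))

opaque
  ∑ : ∀ {n} → (Fin n → ℕ) → ℕ
  ∑ = Sum.sum

opaque
  unfolding ∑

  ∑-unfold : ∀ {n} (f : Fin (suc n) → ℕ) → ∑ f ≡ f zero + ∑ (f ∘ suc)
  ∑-unfold f = refl

  ∑-empty : ∀ (f : Fin 0 → ℕ) → ∑ f ≡ 0
  ∑-empty f = refl

  ∑-cong : ∀ {n} {f g : Fin n → ℕ} → (∀ i → f i ≡ g i) → ∑ f ≡ ∑ g
  ∑-cong = Sum.sum-cong-≗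

  ∑-+ : ∀ {n} (f g : Fin n → ℕ) → ∑ (λ i → f i + g i) ≡ ∑ f + ∑ g
  ∑-+ = Sum.∑-distrib-+

  ∑-swap : ∀ {m n} (f : Fin m → Fin n → ℕ) → ∑ (λ i → ∑ (f i)) ≡ ∑ (λ j → ∑ (λ i → f i j))
  ∑-swap = Sum.∑-comm

  ∑-*ˡ : ∀ {n} c (f : Fin n → ℕ) → ∑ (λ i → c * f i) ≡ c * ∑ f
  ∑-*ˡ c f = sym (Sum.*-distribˡ-sum c f)

  ∑-*ʳ : ∀ {n} c (f : Fin n → ℕ) → ∑ (λ i → f i * c) ≡ ∑ f * c
  ∑-*ʳ c f = sym (Sum.*-distribʳ-sum c f)

  ∑-mono : ∀ {n} {f g : Fin n → ℕ} → (∀ i → f i ≤ g i) → ∑ f ≤ ∑ g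
  ∑-mono {zero}  h = z≤n
  ∑-mono {suc n} h = +-mono-≤ (h zero) (∑-mono (h ∘ suc))

  ∑-1 : ∀ n → ∑ {n} (λ _ → 1) ≡ n
  ∑-1 zero    = refl
  ∑-1 (suc n) = cong suc (∑-1 n)

  ∑-0 : ∀ {n} {f : Fin n → ℕ} → (∀ i → f i ≡ 0) → ∑ f ≡ 0
  ∑-0 {zero}  h = refl
  ∑-0 {suc n} h = cong₂ _+_ (h zero) (∑-0 (h ∘ suc))

  ∑-≥ : ∀ {n} (f : Fin n → ℕ) a → f a ≤ ∑ f
  ∑-≥ f zero    = m≤m+n _ _
  ∑-≥ f (suc a) = ≤-trans (∑-≥ (f ∘ suc) a) (m≤n+m _ _)

  ∑≥1 : ∀ {n} (f : Fin n → ℕ) → 1 ≤ ∑ f → ∃ λ i → 1 ≤ f i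
  ∑≥1 {suc n} f p with ≥1⊎≡0 (f zero)
  ... | inj₁ q = zero , q
  ... | inj₂ q = let (i , r) = ∑≥1 (f ∘ suc) (subst (λ k → 1 ≤ k + ∑ (f ∘ suc)) q p) in suc i , r

opaque
  unfolding ∑ δ

  ∑-δˡ : ∀ {n} (v : Fin n) (f : Fin n → ℕ) → ∑ (λ u → δ v u * f u) ≡ f v
  ∑-δˡ {suc n} zero f = trans (cong₂ _+_ (*-identityˡ (f zero)) (∑-0 {n} (λ _ → refl))) (+-identityʳ _)
  ∑-δˡ {suc n} (suc v) f = trans (∑-cong {n} (λ u → cong (_* f (suc u)) (δ-suc v u))) (∑-δˡ v (f ∘ suc))
    where
    δ-suc : ∀ {n} (u v : Fin n) → δ (suc u) (suc v) ≡ δ u v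
    δ-suc u v with u F.≟ v
    ... | yes _ = refl
    ... | no _  = refl

∑-const : ∀ {n} c → ∑ {n} (λ _ → c) ≡ n * c
∑-const {n} c = trans (∑-cong {n} (λ _ → sym (*-identityˡ c))) (trans (∑-*ʳ {n} c (λ _ → 1)) (cong (_* c) (∑-1 n)))

∑-term≡0 : ∀ {n} (f : Fin n → ℕ) → ∑ f ≡ 0 → ∀ i → f i ≡ 0
∑-term≡0 f p i = n≤0⇒n≡0 (subst (f i ≤_) p (∑-≥ f i))

-- The differences are natural numbers with sum 0. This turns equality of totals into equality of
-- terms, here and in all later equality cases.
∑-≡ : ∀ {n} {f g : Fin n → ℕ} → (∀ i → f i ≤ g i) → ∑ f ≡ ∑ g → ∀ i → f i ≡ g i
∑-≡ {n} {f} {g} le eq i = ≤-antisym (le i) (m∸n≡0⇒m≤n (∑-term≡0 (λ j → g j ∸ f j) z i))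
  where
  z : ∑ (λ j → g j ∸ f j) ≡ 0
  z = +-cancelˡ-≡ (∑ f) _ _ (begin
    ∑ f + ∑ (λ j → g j ∸ f j)    ≡⟨ sym (∑-+ f (λ j → g j ∸ f j)) ⟩
    ∑ (λ j → f j + (g j ∸ f j))  ≡⟨ ∑-cong (λ j → m+[n∸m]≡n (le j)) ⟩
    ∑ g                          ≡⟨ sym eq ⟩
    ∑ f                          ≡⟨ sym (+-identityʳ _) ⟩
    ∑ f + 0                      ∎)
    where open ≡-Reasoning

∑-δʳ : ∀ {n} (v : Fin n) (f : Fin n → ℕ) → ∑ (λ u → f u * δ u v) ≡ f v
∑-δʳ v f = trans (∑-cong (λ u → trans (*-comm (f u) _) (cong (_* f u) (δ-sym u v)))) (∑-δˡ v f)

∑-δ : ∀ {n} (v : Fin n) → ∑ (δ v) ≡ 1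
∑-δ {n} v = trans (∑-cong {n} (λ u → sym (*-identityʳ (δ v u)))) (∑-δˡ v (λ _ → 1))

opaque
  without : ∀ {n} → (Fin n → ℕ) → Fin n → Fin n → ℕ
  without f a u = if does (a F.≟ u) then 0 else f u

  without-≢ : ∀ {n} (f : Fin n → ℕ) {a u} → a ≢ u → without f a u ≡ f u
  without-≢ f {a} {u} ne with a F.≟ u
  ... | yes e = ⊥-elim (ne e)
  ... | no _  = refl

  without≥1 : ∀ {n} (f : Fin n → ℕ) {a u} → 1 ≤ without f a u → a ≢ u × 1 ≤ f u
  without≥1 f {a} {u} p with a F.≟ u
  ... | yes e with () ← p
  ... | no ne = ne , p

opaque
  unfolding without δ

  ∑-without : ∀ {n} (f : Fin n → ℕ) a → ∑ f ≡ f a + ∑ (without f a)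
  ∑-without f a = begin
    ∑ f                                     ≡⟨ ∑-cong pt ⟩
    ∑ (λ u → δ a u * f u + without f a u)   ≡⟨ ∑-+ (λ u → δ a u * f u) (without f a) ⟩
    ∑ (λ u → δ a u * f u) + ∑ (without f a) ≡⟨ cong (_+ ∑ (without f a)) (∑-δˡ a f) ⟩
    f a + ∑ (without f a)                   ∎
    where
    open ≡-Reasoning
    pt : ∀ u → f u ≡ δ a u * f u + without f a u
    pt u with a F.≟ u
    ... | yes _ = sym (trans (+-identityʳ _) (+-identityʳ _))
    ... | no _  = refl

∑-≥₂ : ∀ {n} (f : Fin n → ℕ) {a b} → a ≢ b → f a + f b ≤ ∑ f
∑-≥₂ f {a} {b} ne = subst (f a + f b ≤_) (sym (∑-without f a))
  (+-monoʳ-≤ (f a) (subst (_≤ ∑ (without f a)) (without-≢ f ne) (∑-≥ (without f a) b)))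

∑-≥₃ : ∀ {n} (f : Fin n → ℕ) {a b c} → a ≢ b → a ≢ c → b ≢ c → f a + (f b + f c) ≤ ∑ f
∑-≥₃ f {a} {b} {c} ab ac bc = subst (f a + (f b + f c) ≤_) (sym (∑-without f a))
  (+-monoʳ-≤ (f a) (subst₂ (λ x y → x + y ≤ ∑ (without f a)) (without-≢ f ab) (without-≢ f ac) (∑-≥₂ (without f a) bc)))

infixl 7 _⊗_
_⊗_ : ∀ {n} → (Fin n → Fin n → ℕ) → (Fin n → Fin n → ℕ) → Fin n → Fin n → ℕ
(X ⊗ Y) v w = ∑ (λ u → X v u * Y u w)

infixr 7 _⊛_
_⊛_ : ∀ {n} → (Fin n → Fin n → ℕ) → (Fin n → ℕ) → Fin n → ℕ
(X ⊛ f) v = ∑ (λ u → X v u * f u)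

⊛-assoc : ∀ {n} (X Y : Fin n → Fin n → ℕ) f v → ((X ⊗ Y) ⊛ f) v ≡ (X ⊛ Y ⊛ f) v
⊛-assoc X Y f v = begin
  ∑ (λ w → ∑ (λ u → X v u * Y u w) * f w)  ≡⟨ ∑-cong (λ w → sym (∑-*ʳ (f w) (λ u → X v u * Y u w))) ⟩
  ∑ (λ w → ∑ (λ u → X v u * Y u w * f w))  ≡⟨ ∑-swap (λ w u → X v u * Y u w * f w) ⟩
  ∑ (λ u → ∑ (λ w → X v u * Y u w * f w))  ≡⟨ ∑-cong (λ u → trans (∑-cong (λ w → *-assoc (X v u) (Y u w) (f w))) (∑-*ˡ (X v u) (λ w → Y u w * f w))) ⟩
  ∑ (λ u → X v u * ∑ (λ w → Y u w * f w))  ∎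
  where open ≡-Reasoning

⊛-+ : ∀ {n} (X : Fin n → Fin n → ℕ) (f g : Fin n → ℕ) v → (X ⊛ (λ u → f u + g u)) v ≡ (X ⊛ f) v + (X ⊛ g) v
⊛-+ X f g v = trans (∑-cong (λ u → *-distribˡ-+ (X v u) (f u) (g u))) (∑-+ (λ u → X v u * f u) (λ u → X v u * g u))

⊛-* : ∀ {n} (X : Fin n → Fin n → ℕ) c (f : Fin n → ℕ) v → (X ⊛ (λ u → c * f u)) v ≡ c * (X ⊛ f) v
⊛-* X c f v = trans (∑-cong (λ u → trans (sym (*-assoc (X v u) c (f u))) (trans (cong (_* f u) (*-comm (X v u) c)) (*-assoc c (X v u) (f u))))) (∑-*ˡ c (λ u → X v u * f u))

⊛-cong : ∀ {n} (X : Fin n → Fin n → ℕ) {f g : Fin n → ℕ} → (∀ u → f u ≡ g u) → ∀ v → (X ⊛ f) v ≡ (X ⊛ g) v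
⊛-cong X h v = ∑-cong (λ u → cong (X v u *_) (h u))

⊛-mono : ∀ {n} (X : Fin n → Fin n → ℕ) {f g : Fin n → ℕ} v → (∀ u → 1 ≤ X v u → f u ≤ g u) → (X ⊛ f) v ≤ (X ⊛ g) v
⊛-mono X {f} {g} v h = ∑-mono pt
  where
  pt : ∀ u → X v u * f u ≤ X v u * g u
  pt u with ≥1⊎≡0 (X v u)
  ... | inj₁ p = *-monoʳ-≤ (X v u) (h u p)
  ... | inj₂ p rewrite p = z≤n

⊛-cong-supp : ∀ {n} (X : Fin n → Fin n → ℕ) {f g : Fin n → ℕ} v → (∀ u → 1 ≤ X v u → f u ≡ g u) → (X ⊛ f) v ≡ (X ⊛ g) v
⊛-cong-supp X v h = ≤-antisym (⊛-mono X v (λ u p → ≤-reflexive (h u p))) (⊛-mono X v (λ u p → ≤-reflexive (sym (h u p))))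

⊛-≥ : ∀ {n} (X : Fin n → Fin n → ℕ) (f : Fin n → ℕ) v u → X v u * f u ≤ (X ⊛ f) v
⊛-≥ X f v u = ∑-≥ (λ u → X v u * f u) u

⊛≥1 : ∀ {n} (X : Fin n → Fin n → ℕ) (f : Fin n → ℕ) v → 1 ≤ (X ⊛ f) v → ∃ λ u → 1 ≤ X v u × 1 ≤ f u
⊛≥1 X f v p = let (u , q) = ∑≥1 (λ u → X v u * f u) p in u , ≥1-*ˡ q , ≥1-*ʳ {X v u} q

-- Regularity

adjacency : ∀ {n} → Graph n → Fin n → Fin n → ℕ
adjacency G v w = if adj G v w then 1 else 0

degree-∑ : ∀ {n} (G : Graph n) v → degree G v ≡ ∑ (adjacency G v)
degree-∑ {n} G v = trans (cong ListAction.sum (List.map-tabulate (λ w → w) (adjacency G v))) (sum-tabulate (adjacency G v))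
  where
  sum-tabulate : ∀ {m} (f : Fin m → ℕ) → ListAction.sum (List.tabulate f) ≡ ∑ f
  sum-tabulate {zero}  f = sym (∑-empty f)
  sum-tabulate {suc m} f = trans (cong (f zero +_) (sum-tabulate (f ∘ suc))) (sym (∑-unfold f))

module Regularity {n : ℕ} (G : Graph n) (degree≤4 : ∀ v → degree G v ≤ 4)
  (within : ∀ u v → Within G 3 u v) where

  A : Fin n → Fin n → ℕ
  A = adjacency G

  A≤1 : ∀ v w → A v w ≤ 1
  A≤1 v w with adj G v w
  ... | true  = s≤s z≤n
  ... | false = z≤n

  A-sym : ∀ v w → A v w ≡ A w v
  A-sym v w = cong (if_then 1 else 0) (Graph.sym G v w)

  A-diag : ∀ v → A v v ≡ 0
  A-diag v = cong (if_then 1 else 0) (loopless G v)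

  adj⇒A : ∀ {v w} → adj G v w ≡ true → 1 ≤ A v w
  adj⇒A e rewrite e = s≤s z≤n

  near : ∀ v w → v ≡ w ⊎ 1 ≤ A v w ⊎ 1 ≤ (A ⊗ A) v w ⊎ 1 ≤ (A ⊗ (A ⊗ A)) v w
  near v w with within v w
  ... | here = inj₁ refl
  ... | step a here = inj₂ (inj₁ (adj⇒A a))
  ... | step {w = x} a (step b here) = inj₂ (inj₂ (inj₁ (≤-trans (*-mono-≤ (adj⇒A a) (adj⇒A b)) (⊛-≥ A _ v x))))
  ... | step {w = x} a (step {w = y} b (step c here)) = inj₂ (inj₂ (inj₂
    (≤-trans (*-mono-≤ (adj⇒A a) (≤-trans (*-mono-≤ (adj⇒A b) (adj⇒A c)) (⊛-≥ A _ x y))) (⊛-≥ A _ v x))))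

  -- The non-backtracking continuations of a walk that arrives at x from v.
  onward : Fin n → Fin n → Fin n → ℕ
  onward v x = without (A x) v

  ∑-onward : ∀ v x → 1 ≤ A v x → ∑ (onward v x) ≤ 3
  ∑-onward v x p = ≤-pred (≤-trans (+-monoˡ-≤ _ (subst (1 ≤_) (A-sym v x) p))
    (≤-trans (≤-reflexive (sym (∑-without (A x) v))) (subst (_≤ 4) (degree-∑ G x) (degree≤4 x))))

  paths₂ paths₃ : Fin n → Fin n → ℕ
  paths₂ v w = (A ⊛ (λ x → onward v x w)) v
  paths₃ v w = (A ⊛ (λ x → (onward v ⊛ (λ y → onward x y w)) x)) v

  here⇒ : ∀ {v w} → v ≡ w → 1 ≤ (δ v w + A v w) + (paths₂ v w + paths₃ v w)
  here⇒ {v} refl rewrite δ-refl v = s≤s z≤n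

  adj⇒ : ∀ {v w} → 1 ≤ A v w → 1 ≤ (δ v w + A v w) + (paths₂ v w + paths₃ v w)
  adj⇒ {v} {w} a = ≤-trans a (≤-trans (m≤n+m _ (δ v w)) (m≤m+n _ _))

  path₂⇒ : ∀ {v x w} → 1 ≤ A v x → 1 ≤ A x w → v ≢ w → 1 ≤ paths₂ v w
  path₂⇒ {v} {x} {w} a b v≢w = ≤-trans (*-mono-≤ a (subst (1 ≤_) (sym (without-≢ (A x) v≢w)) b))
    (⊛-≥ A (λ x → onward v x w) v x)

  path₃⇒ : ∀ {v x y w} → 1 ≤ A v x → 1 ≤ A x y → 1 ≤ A y w → v ≢ y → x ≢ w → 1 ≤ paths₃ v w
  path₃⇒ {v} {x} {y} {w} a b c v≢y x≢w = ≤-trans (*-mono-≤ a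
    (≤-trans (*-mono-≤ (subst (1 ≤_) (sym (without-≢ (A x) v≢y)) b) (subst (1 ≤_) (sym (without-≢ (A y) x≢w)) c))
      (⊛-≥ (onward v) (λ y → onward x y w) x y)))
    (⊛-≥ A (λ x → (onward v ⊛ (λ y → onward x y w)) x) v x)

  covered : ∀ v w → 1 ≤ (δ v w + A v w) + (paths₂ v w + paths₃ v w)
  covered v w with within v w
  ... | here = here⇒ refl
  ... | step a here = adj⇒ (adj⇒A a)
  ... | step {w = x} a (step b here) = by (v F.≟ w)
    where
    by : Dec (v ≡ w) → 1 ≤ (δ v w + A v w) + (paths₂ v w + paths₃ v w)
    by (yes v≡w) = here⇒ v≡w
    by (no v≢w)  = ≤-trans (path₂⇒ (adj⇒A a) (adj⇒A b) v≢w) (≤-trans (m≤m+n _ _) (m≤n+m _ (δ v w + A v w)))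
  ... | step {w = x} a (step {w = y} b (step c here)) = by (v F.≟ y) (x F.≟ w)
    where
    by : Dec (v ≡ y) → Dec (x ≡ w) → 1 ≤ (δ v w + A v w) + (paths₂ v w + paths₃ v w)
    -- A step back cancels, and the edge that remains joins v to w.
    by (yes refl) _          = adj⇒ (adj⇒A c)
    by (no _)     (yes refl) = adj⇒ (adj⇒A a)
    by (no v≢y)   (no x≢w)   = ≤-trans (path₃⇒ (adj⇒A a) (adj⇒A b) (adj⇒A c) v≢y x≢w)
      (≤-trans (m≤n+m _ (paths₂ v w)) (m≤n+m _ (δ v w + A v w)))

  ∑-⊛ : ∀ (X : Fin n → Fin n → ℕ) (f : Fin n → Fin n → ℕ) v → ∑ (λ w → (X ⊛ (λ x → f x w)) v) ≡ (X ⊛ (λ x → ∑ (f x))) v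
  ∑-⊛ X f v = trans (∑-swap (λ w x → X v x * f x w)) (∑-cong (λ x → ∑-*ˡ (X v x) (f x)))

  -- The Moore count from a root of degree d, with at most three continuations later on: 1 + d + 3d
  -- + 9d. A vertex of degree 3 or less would see at most 40 vertices.
  order≤ : ∀ v → n ≤ 1 + 13 * ∑ (A v)
  order≤ v = begin
    n                                                        ≡⟨ sym (∑-1 n) ⟩
    ∑ (λ w → 1)                                              ≤⟨ ∑-mono (covered v) ⟩
    ∑ (λ w → (δ v w + A v w) + (paths₂ v w + paths₃ v w))    ≡⟨ ∑-+ (λ w → δ v w + A v w) _ ⟩
    ∑ (λ w → δ v w + A v w) + ∑ (λ w → paths₂ v w + paths₃ v w)
                                                             ≡⟨ cong₂ _+_ (∑-+ (δ v) (A v)) (∑-+ (paths₂ v) (paths₃ v)) ⟩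
    (∑ (δ v) + d) + (∑ (paths₂ v) + ∑ (paths₃ v))            ≤⟨ +-mono-≤ (≤-reflexive (cong (_+ d) (∑-δ v))) (+-mono-≤ two three) ⟩
    (1 + d) + (d * 3 + d * 9)                                ≡⟨ solve 1 (λ d → (con 1 :+ d) :+ (d :* con 3 :+ d :* con 9) := con 1 :+ con 13 :* d) refl d ⟩
    1 + 13 * d                                               ∎
    where
    open ≤-Reasoning
    open +-*-Solver
    d : ℕ
    d = ∑ (A v)
    two : ∑ (paths₂ v) ≤ d * 3
    two = begin
      ∑ (paths₂ v)                       ≡⟨ ∑-⊛ A (onward v) v ⟩
      (A ⊛ (λ x → ∑ (onward v x))) v     ≤⟨ ⊛-mono A v (λ x p → ∑-onward v x p) ⟩
      (A ⊛ (λ x → 3)) v                  ≡⟨ ∑-*ʳ 3 (A v) ⟩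
      d * 3                              ∎
    inner : ∀ x → 1 ≤ A v x → ∑ (λ w → (onward v ⊛ (λ y → onward x y w)) x) ≤ 9
    inner x p = begin
      ∑ (λ w → (onward v ⊛ (λ y → onward x y w)) x)  ≡⟨ ∑-⊛ (onward v) (onward x) x ⟩
      (onward v ⊛ (λ y → ∑ (onward x y))) x          ≤⟨ ⊛-mono (onward v) x (λ y q → ∑-onward x y (proj₂ (without≥1 (A x) q))) ⟩
      (onward v ⊛ (λ y → 3)) x                       ≡⟨ ∑-*ʳ 3 (onward v x) ⟩
      ∑ (onward v x) * 3                             ≤⟨ *-monoˡ-≤ 3 (∑-onward v x p) ⟩
      9                                              ∎
    three : ∑ (paths₃ v) ≤ d * 9
    three = begin
      ∑ (paths₃ v)                                                        ≡⟨ ∑-⊛ A (λ x w → (onward v ⊛ (λ y → onward x y w)) x) v ⟩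
      (A ⊛ (λ x → ∑ (λ w → (onward v ⊛ (λ y → onward x y w)) x))) v       ≤⟨ ⊛-mono A v inner ⟩
      (A ⊛ (λ x → 9)) v                                                   ≡⟨ ∑-*ʳ 9 (A v) ⟩
      d * 9                                                               ∎

  regular : 41 ≤ n → ∀ v → ∑ (A v) ≡ 4
  regular n≥41 v with m≤n⇒m<n∨m≡n (subst (_≤ 4) (degree-∑ G v) (degree≤4 v))
  ... | inj₂ e = e
  ... | inj₁ (s≤s d≤3) = ⊥-elim (<⇒≱ n≥41 (≤-trans (order≤ v) (s≤s (*-monoʳ-≤ 13 d≤3))))

-- Elementary facts about sums, squares and three indices

two-terms : ∀ {n} (f : Fin n → ℕ) → (∀ i → f i ≤ 1) → 2 ≤ ∑ f → ∃₂ λ i j → i ≢ j × 1 ≤ f i × 1 ≤ f j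
two-terms f f≤1 p = a , b , proj₁ r , fa , proj₂ r
  where
  one : ∃ λ i → 1 ≤ f i
  one = ∑≥1 f (≤-trans (s≤s z≤n) p)
  a = proj₁ one
  fa = proj₂ one
  rest : 1 ≤ ∑ (without f a)
  rest = +-cancelˡ-≤ (f a) _ _ (≤-trans (+-monoˡ-≤ 1 (f≤1 a)) (subst (2 ≤_) (∑-without f a) p))
  other : ∃ λ i → 1 ≤ without f a i
  other = ∑≥1 _ rest
  b = proj₁ other
  r : a ≢ b × 1 ≤ f b
  r = without≥1 f (proj₂ other)

-- A (4,3,-2)-graph with adjacency matrix A; near is the diameter condition.
record QuarticDefect2 (n : ℕ) : Set where
  field
    A       : Fin n → Fin n → ℕ
    A≤1     : ∀ v w → A v w ≤ 1
    A-sym   : ∀ v w → A v w ≡ A w v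
    A-diag  : ∀ v → A v v ≡ 0
    regular : ∀ v → ∑ (A v) ≡ 4
    near    : ∀ v w → v ≡ w ⊎ 1 ≤ A v w ⊎ 1 ≤ (A ⊗ A) v w ⊎ 1 ≤ (A ⊗ (A ⊗ A)) v w
    order   : n ≡ 51

-- This is the expansion of (b - a)² with b = a + k; the gap k carries the equality case.
square-gap : ∀ a k → a * a + (a + k) * (a + k) ≡ 2 * (a * (a + k)) + k * k
square-gap = solve 2 (λ a k → a :* a :+ (a :+ k) :* (a :+ k) := con 2 :* (a :* (a :+ k)) :+ k :* k) refl
  where open +-*-Solver

ordered-2ab≤ : ∀ {a b} → a ≤ b → 2 * (a * b) ≤ a * a + b * b
ordered-2ab≤ {a} {b} le = subst (λ b → 2 * (a * b) ≤ a * a + b * b) (m+[n∸m]≡n le)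
  (≤-trans (m≤m+n _ _) (≤-reflexive (sym (square-gap a (b ∸ a)))))

ordered-equal : ∀ {a b} → a ≤ b → 2 * (a * b) ≡ a * a + b * b → a ≡ b
ordered-equal {a} {b} le eq = trans (sym (+-identityʳ a)) (trans (cong (a +_) (sym k≡0)) (m+[n∸m]≡n le))
  where
  k = b ∸ a
  k*k≡0 : k * k ≡ 0
  k*k≡0 = +-cancelˡ-≡ (2 * (a * (a + k))) _ _ (trans (sym (square-gap a k))
    (trans (subst (λ b → a * a + b * b ≡ 2 * (a * b)) (sym (m+[n∸m]≡n le)) (sym eq)) (sym (+-identityʳ _))))
  k≡0 : k ≡ 0
  k≡0 with m*n≡0⇒m≡0∨n≡0 k k*k≡0
  ... | inj₁ e = e
  ... | inj₂ e = e

2ab≤a²+b² : ∀ a b → 2 * (a * b) ≤ a * a + b * b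
2ab≤a²+b² a b with ≤-total a b
... | inj₁ le = ordered-2ab≤ le
... | inj₂ le = subst₂ _≤_ (cong (2 *_) (*-comm b a)) (+-comm (b * b) (a * a)) (ordered-2ab≤ le)

equal-squares : ∀ a b → 2 * (a * b) ≡ a * a + b * b → a ≡ b
equal-squares a b eq with ≤-total a b
... | inj₁ le = ordered-equal le eq
... | inj₂ le = sym (ordered-equal le (trans (cong (2 *_) (*-comm b a)) (trans eq (+-comm (a * a) (b * b)))))

∣-∑ : ∀ {n d} (f : Fin n → ℕ) → (∀ i → d ∣ f i) → d ∣ ∑ f
∣-∑ {zero}  f h = subst (_ ∣_) (sym (∑-empty f)) (_ ∣0)
∣-∑ {suc n} f h = subst (_ ∣_) (sym (∑-unfold f)) (∣m∣n⇒∣m+n (h zero) (∣-∑ (f ∘ suc) (h ∘ suc)))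

-- Predicates that agree pointwise select the same index, so a representative chosen this way
-- depends on the class only.
first : ∀ {n} → (Fin n → Bool) → Maybe (Fin n)
first {zero}  p = nothing
first {suc n} p = if p zero then just zero else Maybe.map suc (first (p ∘ suc))

first-cong : ∀ {n} {p q : Fin n → Bool} → (∀ i → p i ≡ q i) → first p ≡ first q
first-cong {zero}  h = refl
first-cong {suc n} {p} {q} h rewrite h zero | first-cong (h ∘ suc) = refl

first-just : ∀ {n} (p : Fin n → Bool) i → p i ≡ true → Σ[ j ∈ Fin n ] (first p ≡ just j × p j ≡ true)
first-just {suc n} p i e with p zero in z
... | true  = zero , refl , z
first-just {suc n} p zero e | false with () ← trans (sym z) e
first-just {suc n} p (suc i) e | false with first-just (p ∘ suc) i e
... | j , f , t rewrite f = suc j , refl , t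

∑-without₃ : ∀ {n} (f : Fin n → ℕ) {a b c} → a ≢ b → a ≢ c → b ≢ c →
  ∑ f ≡ f a + (f b + (f c + ∑ (without (without (without f a) b) c)))
∑-without₃ f {a} {b} {c} ab ac bc = trans (∑-without f a) (cong (f a +_) (trans (∑-without f₁ b) (cong₂ _+_ (without-≢ f ab)
  (trans (∑-without f₂ c) (cong (_+ ∑ (without f₂ c)) (trans (without-≢ f₁ bc) (without-≢ f ac)))))))
  where
  f₁ = without f a
  f₂ = without f₁ b

∑-three : ∀ {n} (f : Fin n → ℕ) {a b c} → a ≢ b → a ≢ c → b ≢ c →
  (∀ w → 1 ≤ f w → w ≡ a ⊎ w ≡ b ⊎ w ≡ c) → ∑ f ≡ f a + (f b + f c)
∑-three f {a} {b} {c} ab ac bc supp = trans (∑-without₃ f ab ac bc)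
  (cong (λ k → f a + (f b + k)) (trans (cong (f c +_) (∑-0 none)) (+-identityʳ _)))
  where
  none : ∀ w → without (without (without f a) b) c w ≡ 0
  none w with ≥1⊎≡0 (without (without (without f a) b) c w)
  ... | inj₂ z = z
  ... | inj₁ p with without≥1 (without (without f a) b) p
  ...   | c≢w , p₂ with without≥1 (without f a) p₂
  ...     | b≢w , p₁ with without≥1 f p₁
  ...       | a≢w , p₀ with supp w p₀
  ...         | inj₁ e = ⊥-elim (a≢w (sym e))
  ...         | inj₂ (inj₁ e) = ⊥-elim (b≢w (sym e))
  ...         | inj₂ (inj₂ e) = ⊥-elim (c≢w (sym e))

pairwise-sums-2 : ∀ x y z → x + y ≡ 2 → x + z ≡ 2 → y + z ≡ 2 → x ≡ 1 × y ≡ 1 × z ≡ 1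
pairwise-sums-2 0 .2 .2 refl refl ()
pairwise-sums-2 1 .1 .1 refl refl refl = refl , refl , refl
pairwise-sums-2 2 .0 .0 refl refl ()

fourth : ∀ (i j k l : Fin 3) → l ≢ i → l ≢ j → k ≢ i → k ≢ j → i ≢ j → l ≡ k
fourth = toWitness {a? = fourth?} _
  where
  fourth? : Dec (∀ (i j k l : Fin 3) → l ≢ i → l ≢ j → k ≢ i → k ≢ j → i ≢ j → l ≡ k)
  fourth? = F.all? λ i → F.all? λ j → F.all? λ k → F.all? λ l →
    ¬? (l F.≟ i) →-dec (¬? (l F.≟ j) →-dec (¬? (k F.≟ i) →-dec (¬? (k F.≟ j) →-dec (¬? (i F.≟ j) →-dec (l F.≟ k)))))

third : ∀ {i j : Fin 3} → i ≢ j → Σ[ k ∈ Fin 3 ] (k ≢ i × k ≢ j)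
third {0F} {0F} ne = ⊥-elim (ne refl)
third {0F} {1F} _ = 2F , (λ ()) , (λ ())
third {0F} {2F} _ = 1F , (λ ()) , (λ ())
third {1F} {0F} _ = 2F , (λ ()) , (λ ())
third {1F} {1F} ne = ⊥-elim (ne refl)
third {1F} {2F} _ = 0F , (λ ()) , (λ ())
third {2F} {0F} _ = 1F , (λ ()) , (λ ())
third {2F} {1F} _ = 0F , (λ ()) , (λ ())
third {2F} {2F} ne = ⊥-elim (ne refl)

-- Parity

odd : ℕ → Bool
odd zero    = false
odd (suc n) = not (odd n)

odd-+ : ∀ a b → odd (a + b) ≡ odd a xor odd b
odd-+ zero    b = refl
odd-+ (suc a) b = trans (cong not (odd-+ a b)) (not-xor (odd a) (odd b))
  where
  not-xor : ∀ x y → not (x xor y) ≡ not x xor y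
  not-xor true  y = Bool.not-involutive y
  not-xor false y = refl

odd-* : ∀ a b → odd (a * b) ≡ odd a ∧ odd b
odd-* zero    b = refl
odd-* (suc a) b = trans (odd-+ b (a * b)) (trans (cong (odd b xor_) (odd-* a b)) (lemma (odd a) (odd b)))
  where
  lemma : ∀ x y → y xor (x ∧ y) ≡ not x ∧ y
  lemma true  true  = refl
  lemma true  false = refl
  lemma false true  = refl
  lemma false false = refl

2∣⇒even : ∀ {k} → 2 ∣ k → odd k ≡ false
2∣⇒even (divides c refl) = trans (odd-* c 2) (Bool.∧-zeroʳ (odd c))

even⇒2∣ : ∀ k → odd k ≡ false → 2 ∣ k
even⇒2∣ zero          _ = 2 ∣0
even⇒2∣ (suc (suc k)) e = ∣m∣n⇒∣m+n ∣-refl (even⇒2∣ k (trans (sym (Bool.not-involutive (odd k))) e))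

even-factor : ∀ a b → odd a ≡ true → odd (a * b) ≡ false → odd b ≡ false
even-factor a b oa e = trans (sym (cong (_∧ odd b) oa)) (trans (sym (odd-* a b)) e)

true≢false : true ≢ false
true≢false ()

xor-same : ∀ x → x xor x ≡ false
xor-same true  = refl
xor-same false = refl

⨁ : ∀ {m} → (Fin m → Bool) → Bool
⨁ {zero}  f = false
⨁ {suc m} f = f zero xor ⨁ (f ∘ suc)

⨁-cong : ∀ {m} {f g : Fin m → Bool} → (∀ i → f i ≡ g i) → ⨁ f ≡ ⨁ g
⨁-cong {zero}  h = refl
⨁-cong {suc m} h = cong₂ _xor_ (h zero) (⨁-cong (h ∘ suc))

odd-∑ : ∀ {m} (f : Fin m → ℕ) → odd (∑ f) ≡ ⨁ (λ i → odd (f i))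
odd-∑ {zero}  f = cong odd (∑-empty f)
odd-∑ {suc m} f = trans (cong odd (∑-unfold f)) (trans (odd-+ (f zero) _) (cong (odd (f zero) xor_) (odd-∑ (f ∘ suc))))

-- The first row and the first column contribute equally and cancel modulo 2; the rest is the same
-- situation with one index fewer.
handshake : ∀ {n} (f : Fin n → Fin n → ℕ) → (∀ i j → f i j ≡ f j i) → (∀ i → f i i ≡ 0) → odd (∑ (λ i → ∑ (f i))) ≡ false
handshake {zero}  f s d = cong odd (∑-empty (λ i → ∑ (f i)))
handshake {suc n} f s d = begin
  odd (∑ (λ i → ∑ (f i)))
    ≡⟨ cong odd (trans (∑-unfold (λ i → ∑ (f i))) (cong₂ _+_ (trans (∑-unfold (f zero)) (cong (_+ row) (d zero)))
         (trans (∑-cong (λ i → ∑-unfold (f (suc i)))) (trans (∑-+ (λ i → f (suc i) zero) (λ i → ∑ (λ j → f (suc i) (suc j))))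
           (cong (_+ rest) (∑-cong (λ i → s (suc i) zero))))))) ⟩
  odd (row + (row + rest))
    ≡⟨ trans (odd-+ row (row + rest)) (cong (odd row xor_) (odd-+ row rest)) ⟩
  odd row xor (odd row xor odd rest)
    ≡⟨ cong (λ b → odd row xor (odd row xor b)) (handshake (λ i j → f (suc i) (suc j)) (λ i j → s (suc i) (suc j)) (λ i → d (suc i))) ⟩
  odd row xor (odd row xor false)
    ≡⟨ trans (cong (odd row xor_) (Bool.xor-identityʳ (odd row))) (xor-same (odd row)) ⟩
  false ∎
  where
  open ≡-Reasoning
  row rest : ℕ
  row = ∑ (λ j → f zero (suc j))
  rest = ∑ (λ i → ∑ (λ j → f (suc i) (suc j)))

-- square M and cubic M are M² and M² + M³ over 𝔽₂.
square : ∀ {m} → (Fin m → Fin m → Bool) → Fin m → Fin m → Bool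
square M i j = ⨁ (λ k → M i k ∧ M k j)

cubic : ∀ {m} → (Fin m → Fin m → Bool) → Fin m → Fin m → Bool
cubic M i j = square M i j xor ⨁ (λ k → M i k ∧ square M k j)

module _ {m} {M N : Fin m → Fin m → Bool} (M≡N : ∀ i j → M i j ≡ N i j) where
  square-cong : ∀ i j → square M i j ≡ square N i j
  square-cong i j = ⨁-cong (λ k → cong₂ _∧_ (M≡N i k) (M≡N k j))

  cubic-cong : ∀ i j → cubic M i j ≡ cubic N i j
  cubic-cong i j = cong₂ _xor_ (square-cong i j) (⨁-cong (λ k → cong₂ _∧_ (M≡N i k) (square-cong k j)))

-- Exhaustive search through symmetric matrices over 𝔽₂

allᵇ : ∀ {k} → (Vec Bool k → Bool) → Bool
allᵇ {zero}  f = f []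
allᵇ {suc k} f = allᵇ (f ∘ (true ∷_)) ∧ allᵇ (f ∘ (false ∷_))

allᵇ-sound : ∀ {k} (f : Vec Bool k → Bool) → allᵇ f ≡ true → ∀ v → f v ≡ true
allᵇ-sound f e [] = e
allᵇ-sound f e (true ∷ v)  = allᵇ-sound (f ∘ (true ∷_)) (proj₁ (∧-true e)) v
  where
  ∧-true : ∀ {x y} → x ∧ y ≡ true → x ≡ true × y ≡ true
  ∧-true {true} {true} _ = refl , refl
allᵇ-sound f e (false ∷ v) = allᵇ-sound (f ∘ (false ∷_)) (∧-true₂ (allᵇ (f ∘ (true ∷_))) e) v
  where
  ∧-true₂ : ∀ x {y} → x ∧ y ≡ true → y ≡ true
  ∧-true₂ true e = e

symmetric₃ : Vec Bool 3 → Vec (Vec Bool 3) 3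
symmetric₃ (a ∷ b ∷ c ∷ []) =
  (false ∷ a ∷ b ∷ []) ∷
  (a ∷ false ∷ c ∷ []) ∷
  (b ∷ c ∷ false ∷ []) ∷ []

symmetric₅ : Vec Bool 10 → Vec (Vec Bool 5) 5
symmetric₅ (a ∷ b ∷ c ∷ d ∷ e ∷ f ∷ g ∷ h ∷ i ∷ j ∷ []) =
  (false ∷ a ∷ b ∷ c ∷ d ∷ []) ∷
  (a ∷ false ∷ e ∷ f ∷ g ∷ []) ∷
  (b ∷ e ∷ false ∷ h ∷ i ∷ []) ∷
  (c ∷ f ∷ h ∷ false ∷ j ∷ []) ∷
  (d ∷ g ∷ i ∷ j ∷ false ∷ []) ∷ []

entries : ∀ {m k} → Vec (Vec Bool k) m → Fin m → Fin k → Bool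
entries M i j = lookup (lookup M i) j

-- Violations of M𝟙 = 0 and M² + M³ = J + I.
fails₃ : (Fin 3 → Fin 3 → Bool) → Bool
fails₃ M = ⨁ (M 0F) ∨ ⨁ (M 1F) ∨ not (cubic M 0F 1F)

fails₅ : (Fin 5 → Fin 5 → Bool) → Bool
fails₅ M = ⨁ (M 0F) ∨ ⨁ (M 1F) ∨ ⨁ (M 2F) ∨ ⨁ (M 3F) ∨ not (cubic M 0F 1F) ∨ not (cubic M 0F 2F) ∨ not (cubic M 0F 3F) ∨ not (cubic M 0F 4F)
   ∨ not (cubic M 1F 2F) ∨ not (cubic M 1F 3F) ∨ not (cubic M 1F 4F) ∨ not (cubic M 2F 3F) ∨ not (cubic M 2F 4F) ∨ not (cubic M 3F 4F)

-- Zero row sums force a = b = c, so M is 0 or J + I, and M² + M³ = 0 in both cases.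
fails₃-always : ∀ v → fails₃ (entries (symmetric₃ v)) ≡ true
fails₃-always = allᵇ-sound (fails₃ ∘ entries ∘ symmetric₃) refl

-- The ten entries above the diagonal leave 1024 matrices, all of which are evaluated by `refl`.
fails₅-always : ∀ v → fails₅ (entries (symmetric₅ v)) ≡ true
fails₅-always = allᵇ-sound (fails₅ ∘ entries ∘ symmetric₅) refl

module _ {m} (M : Fin m → Fin m → Bool) (M-sym : ∀ i j → M i j ≡ M j i) (M-diag : ∀ i → M i i ≡ false)
  (M-row : ∀ i → ⨁ (M i) ≡ false) (M-cubic : ∀ i j → i ≢ j → cubic M i j ≡ true) where

  order≢3 : m ≢ 3
  order≢3 refl = true≢false (trans (sym (fails₃-always v)) holds)
    where
    v : Vec Bool 3
    v = M 0F 1F ∷ M 0F 2F ∷ M 1F 2F ∷ []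
    N : Fin 3 → Fin 3 → Bool
    N = entries (symmetric₃ v)
    same : ∀ i j → N i j ≡ M i j
    same 0F 0F = sym (M-diag _)
    same 0F 1F = refl
    same 0F 2F = refl
    same 1F 0F = M-sym _ _
    same 1F 1F = sym (M-diag _)
    same 1F 2F = refl
    same 2F 0F = M-sym _ _
    same 2F 1F = M-sym _ _
    same 2F 2F = sym (M-diag _)
    row : ∀ i → ⨁ (N i) ≡ false
    row i = trans (⨁-cong (same i)) (M-row i)
    entry : ∀ i j → i ≢ j → not (cubic N i j) ≡ false
    entry i j ne = cong not (trans (cubic-cong same i j) (M-cubic i j ne))
    holds : fails₃ N ≡ false
    holds = cong₂ _∨_ (row 0F) (cong₂ _∨_ (row 1F) (entry 0F 1F (λ ())))

  order≢5 : m ≢ 5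
  order≢5 refl = true≢false (trans (sym (fails₅-always v)) holds)
    where
    v : Vec Bool 10
    v = M 0F 1F ∷ M 0F 2F ∷ M 0F 3F ∷ M 0F 4F ∷ M 1F 2F ∷ M 1F 3F ∷ M 1F 4F ∷ M 2F 3F ∷ M 2F 4F ∷ M 3F 4F ∷ []
    N : Fin 5 → Fin 5 → Bool
    N = entries (symmetric₅ v)
    same : ∀ i j → N i j ≡ M i j
    same 0F 0F = sym (M-diag _)
    same 0F 1F = refl
    same 0F 2F = refl
    same 0F 3F = refl
    same 0F 4F = refl
    same 1F 0F = M-sym _ _
    same 1F 1F = sym (M-diag _)
    same 1F 2F = refl
    same 1F 3F = refl
    same 1F 4F = refl
    same 2F 0F = M-sym _ _
    same 2F 1F = M-sym _ _
    same 2F 2F = sym (M-diag _)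
    same 2F 3F = refl
    same 2F 4F = refl
    same 3F 0F = M-sym _ _
    same 3F 1F = M-sym _ _
    same 3F 2F = M-sym _ _
    same 3F 3F = sym (M-diag _)
    same 3F 4F = refl
    same 4F 0F = M-sym _ _
    same 4F 1F = M-sym _ _
    same 4F 2F = M-sym _ _
    same 4F 3F = M-sym _ _
    same 4F 4F = sym (M-diag _)
    row : ∀ i → ⨁ (N i) ≡ false
    row i = trans (⨁-cong (same i)) (M-row i)
    entry : ∀ i j → i ≢ j → not (cubic N i j) ≡ false
    entry i j ne = cong not (trans (cubic-cong same i j) (M-cubic i j ne))
    infixr 5 _or_
    _or_ : ∀ {x y} → x ≡ false → y ≡ false → x ∨ y ≡ false
    p or q = cong₂ _∨_ p q
    holds : fails₅ N ≡ false
    holds = row 0F or row 1F or row 2F or row 3F or entry 0F 1F (λ ()) or entry 0F 2F (λ ()) or entry 0F 3F (λ ()) or entry 0F 4F (λ ())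
      or entry 1F 2F (λ ()) or entry 1F 3F (λ ()) or entry 1F 4F (λ ()) or entry 2F 3F (λ ()) or entry 2F 4F (λ ()) or entry 3F 4F (λ ())

-- Candidates for the odd class sizes

large-primes : List ℕ
large-primes = 5 ∷ 7 ∷ 11 ∷ 13 ∷ 19 ∷ 23 ∷ 29 ∷ 31 ∷ 37 ∷ 41 ∷ 43 ∷ 47 ∷ []

large-primes-ok : All (λ p → Prime p × 5 ≤ p × ¬ (p ∣ 51)) large-primes
large-primes-ok = from-yes (All.all? (λ p → prime? p ×-dec (5 ≤? p ×-dec ¬? (p ∣? 51))) large-primes)

-- The list omits 17, which divides 51. Without the listed primes only the factors 3 and 17 remain.
odd-sizes : ∀ (i : Fin 52) → odd (toℕ i) ≡ true →
  Any (_∣ toℕ i) large-primes ⊎ toℕ i ≡ 1 ⊎ toℕ i ≡ 3 ⊎ toℕ i ≡ 9 ⊎ toℕ i ≡ 17 ⊎ toℕ i ≡ 27 ⊎ toℕ i ≡ 51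
odd-sizes = toWitness {a? = dec} _
  where
  dec : Dec (∀ (i : Fin 52) → odd (toℕ i) ≡ true →
    Any (_∣ toℕ i) large-primes ⊎ toℕ i ≡ 1 ⊎ toℕ i ≡ 3 ⊎ toℕ i ≡ 9 ⊎ toℕ i ≡ 17 ⊎ toℕ i ≡ 27 ⊎ toℕ i ≡ 51)
  dec = F.all? (λ i → (odd (toℕ i) Bool.≟ true) →-dec (Any.any? (_∣? toℕ i) large-primes ⊎-dec
    (toℕ i ≟ 1 ⊎-dec (toℕ i ≟ 3 ⊎-dec (toℕ i ≟ 9 ⊎-dec (toℕ i ≟ 17 ⊎-dec (toℕ i ≟ 27 ⊎-dec toℕ i ≟ 51)))))))

double : ℕ → ℕ
double zero    = zero
double (suc k) = suc (suc (double k))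

double-+ : ∀ k → double k ≡ k + k
double-+ zero    = refl
double-+ (suc k) = cong suc (trans (cong suc (double-+ k)) (sym (+-suc k k)))

double-distrib : ∀ a b → double (a + b) ≡ double a + double b
double-distrib zero    b = refl
double-distrib (suc a) b = cong (2 +_) (double-distrib a b)

data Halved : ℕ → Set where
  evenly : ∀ k → Halved (double k)
  oddly : ∀ k → Halved (suc (double k))

halve : ∀ k → Halved k
halve zero = evenly 0
halve (suc k) with halve k
... | evenly j = oddly j
... | oddly j = evenly (suc j)

δ≤ : ∀ {n} (f : Fin n → ℕ) {u} → 1 ≤ f u → ∀ x → δ u x ≤ f x
δ≤ f {u} p x with ≥1⊎≡0 (δ u x)
... | inj₂ z = subst (_≤ f x) (sym z) z≤n
... | inj₁ d = ≤-trans (δ≤1 u x) (subst (λ y → 1 ≤ f y) (δ≥1 d) p)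

δ-≡ : ∀ {n} {a b : Fin n} → (∀ x → δ a x ≡ δ b x) → a ≡ b
δ-≡ {a = a} {b} h = sym (δ≥1 (subst (1 ≤_) (trans (sym (δ-refl a)) (h a)) ≤-refl))

-- Both sides are multisets of two vertices. Applied to rows of B, this compares the two ends of a
-- vertex on a cycle, whose order the row does not show.
δ-pair : ∀ {n} {a b c d : Fin n} → (∀ x → δ a x + δ b x ≡ δ c x + δ d x) → (a ≡ c × b ≡ d) ⊎ (a ≡ d × b ≡ c)
δ-pair {n} {a} {b} {c} {d} h = by (a F.≟ c)
  where
  by : Dec (a ≡ c) → (a ≡ c × b ≡ d) ⊎ (a ≡ d × b ≡ c)
  by (yes refl) = inj₁ (refl , δ-≡ (λ x → +-cancelˡ-≡ (δ a x) _ _ (h x)))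
  by (no a≢c) = inj₂ (a≡d , δ-≡ (λ x → +-cancelˡ-≡ (δ a x) _ _ (trans (h x) (trans (+-comm (δ c x) (δ d x)) (cong (λ u → δ u x + δ c x) (sym a≡d))))))
    where
    a≡d : a ≡ d
    a≡d = sym (δ≥1 (subst (λ k → 1 ≤ k + δ d a) (δ-≢ (a≢c ∘ sym)) (subst (1 ≤_) (h a) (≤-trans (≤-reflexive (sym (δ-refl a))) (m≤m+n _ _)))))

∑₁ : ∀ (f : Fin 1 → ℕ) → ∑ f ≡ f 0F
∑₁ f = trans (∑-unfold f) (trans (cong (f 0F +_) (∑-empty (f ∘ suc))) (+-identityʳ _))

∑₂ : ∀ (f : Fin 2 → ℕ) → ∑ f ≡ f 0F + f 1F
∑₂ f = trans (∑-unfold f) (cong (f 0F +_) (∑₁ (f ∘ suc)))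

∑₃ : ∀ (f : Fin 3 → ℕ) → ∑ f ≡ f 0F + (f 1F + f 2F)
∑₃ f = trans (∑-unfold f) (cong (f 0F +_) (∑₂ (f ∘ suc)))

-- Integral solutions of the class equations

class-sizes : List ℕ
class-sizes = 9 ∷ 17 ∷ 27 ∷ 51 ∷ []

-- One further class X: g = q κ κ, c = q κ x, k = q x κ, a = q x x.
PairGoal : ℕ → ℕ → ℕ → ℕ → ℕ → Set
PairGoal g c l k a = 1 ≤ k → k + a ≤ 4 → (g * g + c * k) + (g * (g * g + c * k) + c * (k * g + a * k)) ≡ l + (6 * g + 5) →
  g ≡ 2 × l ≡ 9 × k ≡ 1 × a ≡ 2

-- Only the column of κ is used here. The row (0, 4) has no solution, and (2, 2) leaves the single
-- one 26 = 9 + 12 + 5, which the column of X excludes later.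
pair-arithmetic : ∀ {g c} → (g ≡ 0 × c ≡ 4) ⊎ (g ≡ 2 × c ≡ 2) → All (λ l → ∀ {k} → k < 5 → ∀ {a} → a < 5 → PairGoal g c l k a) class-sizes
pair-arithmetic = λ { (inj₁ (refl , refl)) → toWitness {a? = dec 0 4} _ ; (inj₂ (refl , refl)) → toWitness {a? = dec 2 2} _ }
  where
  dec : ∀ g c → Dec (All (λ l → ∀ {k} → k < 5 → ∀ {a} → a < 5 → PairGoal g c l k a) class-sizes)
  dec g c = All.all? (λ l → allUpTo? (λ k → allUpTo? (λ a → (1 ≤? k) →-dec ((k + a ≤? 4) →-dec ((_ ≟ _) →-dec
    (g ≟ 2 ×-dec (l ≟ 9 ×-dec (k ≟ 1 ×-dec a ≟ 2)))))) 5) 5) class-sizes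

-- Two further classes X and Y, with rows (k , a , b) and (k′ , c , d) of q with respect to κ, X, Y.
-- The left-hand sides of the class equations for the pairs (κ, κ) and (κ, X), the latter without the neighbours outside κ, X, Y:
lhs₀ lhs₁ : ℕ → ℕ → ℕ → ℕ → ℕ → ℕ → ℕ
lhs₀ k a b k′ c d = (2 * k + 2 * k′) + (2 * (a * k + b * k′) + 2 * (c * k + d * k′))
lhs₁ k a b k′ c d = (2 * a + 2 * c) + (2 * (k * 2 + (a * a + b * c)) + 2 * (k′ * 2 + (c * a + d * c)))

-- In the last case the one neighbour w of X outside κ, X, Y would have q w x = 4, which does not divide size x = 18.
Misfit : ℕ → ℕ → ℕ → ℕ → ℕ → ℕ → ℕ → Set
Misfit l k a b k′ c d = 2 * l + 12 * k < lhs₁ k a b k′ c d * k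
  ⊎ (k + a + b ≡ 4 × lhs₁ k a b k′ c d * k ≢ 2 * l + 12 * k)
  ⊎ (l ≡ 9 × k ≡ 1 × a + b ≡ 2 × k′ + c + d ≡ 4 × lhs₁ k a b k′ c d ≡ 22)

TripleGoal : ℕ → ℕ → ℕ → ℕ → ℕ → ℕ → ℕ → Set
TripleGoal l k k′ a b c d = k + a + b ≤ 4 → k′ + c + d ≤ 4 → b * k′ ≡ c * k → lhs₀ k a b k′ c d ≡ l + 5 →
  Misfit l k a b k′ c d ⊎ Misfit l k′ d c k b a

-- The search is small because k and k′ can only be 1 or 3, and a row of sum at most 4 with such an
-- entry has its other entries below 4.
triple-arithmetic : All (λ l → All (λ k → All (λ k′ → ∀ {a} → a < 4 → ∀ {b} → b < 4 → ∀ {c} → c < 4 → ∀ {d} → d < 4 →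
  TripleGoal l k k′ a b c d) (1 ∷ 3 ∷ [])) (1 ∷ 3 ∷ [])) class-sizes
triple-arithmetic = toWitness {a? = dec} _
  where
  misfit? : ∀ l k a b k′ c d → Dec (Misfit l k a b k′ c d)
  misfit? l k a b k′ c d = _ <? _ ⊎-dec ((_ ≟ _ ×-dec ¬? (_ ≟ _)) ⊎-dec (l ≟ 9 ×-dec (k ≟ 1 ×-dec (_ ≟ _ ×-dec (_ ≟ _ ×-dec _ ≟ _)))))
  dec : Dec (All (λ l → All (λ k → All (λ k′ → ∀ {a} → a < 4 → ∀ {b} → b < 4 → ∀ {c} → c < 4 → ∀ {d} → d < 4 →
    TripleGoal l k k′ a b c d) (1 ∷ 3 ∷ [])) (1 ∷ 3 ∷ [])) class-sizes)
  dec = All.all? (λ l → All.all? (λ k → All.all? (λ k′ → allUpTo? (λ a → allUpTo? (λ b → allUpTo? (λ c → allUpTo? (λ d →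
    (k + a + b ≤? 4) →-dec ((k′ + c + d ≤? 4) →-dec ((_ ≟ _) →-dec ((_ ≟ _) →-dec (misfit? l k a b k′ c d ⊎-dec misfit? l k′ d c k b a)))))
    4) 4) 4) 4) (1 ∷ 3 ∷ [])) (1 ∷ 3 ∷ [])) class-sizes

even-≤4 : ∀ {k} → odd k ≡ false → k ≤ 4 → k ≡ 0 ⊎ k ≡ 2 ⊎ k ≡ 4
even-≤4 {0} _ _ = inj₁ refl
even-≤4 {2} _ _ = inj₂ (inj₁ refl)
even-≤4 {4} _ _ = inj₂ (inj₂ refl)
even-≤4 {suc (suc (suc (suc (suc _))))} _ (s≤s (s≤s (s≤s (s≤s ()))))

-- As l is odd, 4 does not divide 2l; the even s already uses up the factor 2, so k is odd.
odd-or-three : ∀ {s k l} → s * k ≡ 2 * l → odd l ≡ true → odd s ≡ false → 1 ≤ k → k ≤ 4 → k ∈ 1 ∷ 3 ∷ []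
odd-or-three {k = 1} _ _ _ _ _ = here refl
odd-or-three {k = 3} _ _ _ _ _ = there (here refl)
odd-or-three {s} {2} {l} e ol os _ _ = ⊥-elim (true≢false (trans (sym ol) (trans (cong odd (sym (*-cancelˡ-≡ s l 2 (trans (*-comm 2 s) e)))) os)))
odd-or-three {s} {4} {l} e ol os _ _ = ⊥-elim (true≢false (trans (sym ol) (trans (cong odd (sym half)) (odd-* 2 s))))
  where
  half : 2 * s ≡ l
  half = *-cancelˡ-≡ (2 * s) l 2 (trans (sym (*-assoc 2 2 s)) (trans (*-comm 4 s) e))
odd-or-three {k = suc (suc (suc (suc (suc _))))} _ _ _ _ (s≤s (s≤s (s≤s (s≤s ()))))

-- The defect matrix and the absence of short cycles

module DefectTwo {n : ℕ} (𝒢 : QuarticDefect2 n) where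
  open QuarticDefect2 𝒢

  infix 4 _~_
  _~_ : Fin n → Fin n → Set
  v ~ w = 1 ≤ A v w

  ~-sym : ∀ {v w} → v ~ w → w ~ v
  ~-sym {v} {w} = subst (1 ≤_) (A-sym v w)

  ~⇒≡1 : ∀ {v w} → v ~ w → A v w ≡ 1
  ~⇒≡1 p = ≤-antisym (A≤1 _ _) p

  ~-irrefl : ∀ {v w} → v ~ w → v ≢ w
  ~-irrefl {v} p refl with () ← subst (1 ≤_) (A-diag v) p

  ≁⇒≡0 : ∀ {v w} → ¬ (v ~ w) → A v w ≡ 0
  ≁⇒≡0 {v} {w} p with ≥1⊎≡0 (A v w)
  ... | inj₁ q = ⊥-elim (p q)
  ... | inj₂ q = q

  A² A³ : Fin n → Fin n → ℕ
  A² = A ⊗ A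
  A³ = A ⊗ A²

  A²-sym : ∀ v w → A² v w ≡ A² w v
  A²-sym v w = ∑-cong (λ u → trans (cong₂ _*_ (A-sym v u) (A-sym u w)) (*-comm (A u v) (A w u)))

  A³-sym : ∀ v w → A³ v w ≡ A³ w v
  A³-sym v w = begin
    (A ⊛ (A ⊛ λ u → A u w)) v          ≡⟨ sym (⊛-assoc A A (λ u → A u w) v) ⟩
    (A² ⊛ (λ u → A u w)) v             ≡⟨ ∑-cong (λ u → trans (cong₂ _*_ (A²-sym v u) (A-sym u w)) (*-comm (A² u v) (A w u))) ⟩
    A³ w v                             ∎
    where open ≡-Reasoning

  A²≥1 : ∀ {v x w} → v ~ x → x ~ w → 1 ≤ A² v w
  A²≥1 {v} {x} {w} p q = ≤-trans (*-mono-≤ p q) (⊛-≥ A (λ u → A u w) v x)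

  A²≥2 : ∀ {v x y w} → x ≢ y → v ~ x → x ~ w → v ~ y → y ~ w → 2 ≤ A² v w
  A²≥2 {v} {x} {y} {w} ne p q p' q' = ≤-trans (+-mono-≤ (*-mono-≤ p q) (*-mono-≤ p' q')) (∑-≥₂ (λ u → A v u * A u w) ne)

  A³≥1 : ∀ {v x y w} → v ~ x → x ~ y → y ~ w → 1 ≤ A³ v w
  A³≥1 {v} {x} {y} {w} p q r = ≤-trans (*-mono-≤ p (A²≥1 q r)) (⊛-≥ A (λ u → A² u w) v x)

  A³≥2 : ∀ {v x y x' y' w} → x ≢ x' → v ~ x → x ~ y → y ~ w → v ~ x' → x' ~ y' → y' ~ w → 2 ≤ A³ v w
  A³≥2 {v} {x} {y} {x'} {y'} {w} ne p q r p' q' r' =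
    ≤-trans (+-mono-≤ (*-mono-≤ p (A²≥1 q r)) (*-mono-≤ p' (A²≥1 q' r'))) (∑-≥₂ (λ u → A v u * A² u w) ne)

  A²-diag : ∀ v → A² v v ≡ 4
  A²-diag v = trans (∑-cong idem) (regular v)
    where
    idem : ∀ u → A v u * A u v ≡ A v u
    idem u rewrite A-sym u v with A v u | A≤1 v u
    ... | 0 | _ = refl
    ... | 1 | _ = refl
    ... | suc (suc _) | s≤s ()

  A⊛-const : ∀ c v → (A ⊛ (λ _ → c)) v ≡ 4 * c
  A⊛-const c v = trans (∑-*ʳ c (A v)) (cong (_* c) (regular v))

  ∑-A⊛ : ∀ (f : Fin n → ℕ) → ∑ (A ⊛ f) ≡ 4 * ∑ f
  ∑-A⊛ f = begin
    ∑ (λ v → ∑ (λ u → A v u * f u))  ≡⟨ ∑-swap (λ v u → A v u * f u) ⟩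
    ∑ (λ u → ∑ (λ v → A v u * f u))  ≡⟨ ∑-cong (λ u → trans (∑-*ʳ (f u) (λ v → A v u)) (cong (_* f u) (trans (∑-cong (λ v → A-sym v u)) (regular u)))) ⟩
    ∑ (λ u → 4 * f u)                ≡⟨ ∑-*ˡ 4 f ⟩
    4 * ∑ f                          ∎
    where open ≡-Reasoning

  -- The closed form A³ v w = 7 at an edge counts the walks that backtrack.
  backtracking : ∀ v w → v ~ w → (A ⊛ (λ x → 1 + 3 * δ x w)) v ≡ 7
  backtracking v w p = begin
    (A ⊛ (λ x → 1 + 3 * δ x w)) v                      ≡⟨ ⊛-+ A (λ _ → 1) (λ x → 3 * δ x w) v ⟩
    (A ⊛ (λ _ → 1)) v + (A ⊛ (λ x → 3 * δ x w)) v      ≡⟨ cong₂ _+_ (A⊛-const 1 v) (⊛-* A 3 (λ x → δ x w) v) ⟩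
    4 + 3 * (A ⊛ (λ x → δ x w)) v                      ≡⟨ cong (λ k → 4 + 3 * k) (trans (∑-δʳ w (A v)) (~⇒≡1 p)) ⟩
    7                                                  ∎
    where open ≡-Reasoning

  -- Any neighbour x of v has the walk x, v, w; for x = w, all four excursions from w count.
  via-v : ∀ {v w} → v ~ w → ∀ x → v ~ x → 1 + 3 * δ x w ≤ A² x w
  via-v {v} {w} p x q with x F.≟ w
  ... | yes refl = ≤-reflexive (trans (cong (λ k → 1 + 3 * k) (δ-refl x)) (sym (A²-diag x)))
  ... | no ne    = subst (λ k → 1 + 3 * k ≤ A² x w) (sym (δ-≢ ne)) (A²≥1 (~-sym q) p)

  A³≥7 : ∀ {v w} → v ~ w → 7 ≤ A³ v w
  A³≥7 {v} {w} p = ≤-trans (≤-reflexive (sym (backtracking v w p))) (⊛-mono A v (via-v p))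

  -- The walks of length 2 or 3 that are always there: four returns on the diagonal, seven
  -- backtracking walks along an edge, and one walk elsewhere because of the diameter.
  base : Fin n → Fin n → ℕ
  base v w = 1 + (6 * A v w + 3 * δ v w)

  base≤ : ∀ v w → base v w ≤ A² v w + A³ v w
  base≤ v w with v F.≟ w
  ... | yes refl rewrite A-diag v | δ-refl v | A²-diag v = s≤s (s≤s (s≤s (s≤s z≤n)))
  ... | no ne rewrite δ-≢ ne with ≥1⊎≡0 (A v w)
  ...   | inj₁ p rewrite ~⇒≡1 p = ≤-trans (A³≥7 p) (m≤n+m _ (A² v w))
  ...   | inj₂ z rewrite z with near v w
  ...     | inj₁ e = ⊥-elim (ne e)
  ...     | inj₂ (inj₁ p) with () ← subst (1 ≤_) z p
  ...     | inj₂ (inj₂ (inj₁ p)) = ≤-trans p (m≤m+n _ _)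
  ...     | inj₂ (inj₂ (inj₂ p)) = ≤-trans p (m≤n+m _ (A² v w))

  opaque
    -- The defect matrix: A³ + A² − 6A − 3I = J + B.
    B : Fin n → Fin n → ℕ
    B v w = (A² v w + A³ v w) ∸ base v w

    B-eq : ∀ v w → A² v w + A³ v w ≡ base v w + B v w
    B-eq v w = sym (m+[n∸m]≡n (base≤ v w))

    B-sym : ∀ v w → B v w ≡ B w v
    B-sym v w = cong₂ _∸_ (cong₂ _+_ (A²-sym v w) (A³-sym v w))
      (cong (1 +_) (cong₂ (λ x y → 6 * x + 3 * y) (A-sym v w) (δ-sym v w)))

  main-eq : ∀ f v → (A ⊛ A ⊛ f) v + (A ⊛ A ⊛ A ⊛ f) v ≡ ∑ f + (6 * (A ⊛ f) v + 3 * f v) + (B ⊛ f) v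
  main-eq f v = begin
    (A ⊛ A ⊛ f) v + (A ⊛ A ⊛ A ⊛ f) v
      ≡⟨ cong₂ _+_ (sym (⊛-assoc A A f v)) (trans (⊛-cong A (λ u → sym (⊛-assoc A A f u)) v) (sym (⊛-assoc A A² f v))) ⟩
    (A² ⊛ f) v + (A³ ⊛ f) v
      ≡⟨ sym (∑-+ (λ w → A² v w * f w) (λ w → A³ v w * f w)) ⟩
    ∑ (λ w → A² v w * f w + A³ v w * f w)
      ≡⟨ ∑-cong pt ⟩
    ∑ (λ w → f w + (6 * (A v w * f w) + 3 * (δ v w * f w)) + B v w * f w)
      ≡⟨ ∑-+ (λ w → f w + (6 * (A v w * f w) + 3 * (δ v w * f w))) (λ w → B v w * f w) ⟩
    ∑ (λ w → f w + (6 * (A v w * f w) + 3 * (δ v w * f w))) + (B ⊛ f) v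
      ≡⟨ cong (_+ (B ⊛ f) v) (trans (∑-+ f (λ w → 6 * (A v w * f w) + 3 * (δ v w * f w)))
           (cong (∑ f +_) (trans (∑-+ (λ w → 6 * (A v w * f w)) (λ w → 3 * (δ v w * f w)))
              (cong₂ _+_ (∑-*ˡ 6 (λ w → A v w * f w)) (trans (∑-*ˡ 3 (λ w → δ v w * f w)) (cong (3 *_) (∑-δˡ v f))))))) ⟩
    ∑ f + (6 * (A ⊛ f) v + 3 * f v) + (B ⊛ f) v ∎
    where
    open ≡-Reasoning
    open +-*-Solver
    pt : ∀ w → A² v w * f w + A³ v w * f w ≡ f w + (6 * (A v w * f w) + 3 * (δ v w * f w)) + B v w * f w
    pt w = trans (sym (*-distribʳ-+ (f w) (A² v w) (A³ v w))) (trans (cong (_* f w) (B-eq v w))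
      (solve 4 (λ a d b f → (con 1 :+ (con 6 :* a :+ con 3 :* d) :+ b) :* f :=
         f :+ (con 6 :* (a :* f) :+ con 3 :* (d :* f)) :+ b :* f) refl (A v w) (δ v w) (B v w) (f w)))

  -- From v there are 16 + 64 = 80 walks of length 2 or 3, while a row of `base` has sum 51 + 24 + 3
  -- = 78.
  ∑-B : ∀ v → ∑ (B v) ≡ 2
  ∑-B v = +-cancelˡ-≡ 78 _ _ (begin
    78 + ∑ (B v)                               ≡⟨ cong (λ k → k + (6 * 4 + 3) + ∑ (B v)) (sym order) ⟩
    n + (6 * 4 + 3) + ∑ (B v)                  ≡⟨ cong₂ (λ x y → x + (6 * y + 3) + ∑ (B v)) (sym (∑-1 n)) (sym (A⊛-const 1 v)) ⟩
    ∑ {n} (λ _ → 1) + (6 * (A ⊛ (λ _ → 1)) v + 3) + ∑ (B v)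
                                               ≡⟨ cong (λ x → ∑ {n} (λ _ → 1) + (6 * (A ⊛ (λ _ → 1)) v + 3) + x) (∑-cong (λ w → sym (*-identityʳ (B v w)))) ⟩
    ∑ {n} (λ _ → 1) + (6 * (A ⊛ (λ _ → 1)) v + 3) + (B ⊛ (λ _ → 1)) v
                                               ≡⟨ sym (main-eq (λ _ → 1) v) ⟩
    (A ⊛ A ⊛ (λ _ → 1)) v + (A ⊛ A ⊛ A ⊛ (λ _ → 1)) v
                                               ≡⟨ cong₂ _+_ (s2 v) (trans (⊛-cong A s2 v) (A⊛-const 16 v)) ⟩
    16 + 64                                    ∎)
    where
    open ≡-Reasoning
    s2 : ∀ v → (A ⊛ A ⊛ (λ _ → 1)) v ≡ 16
    s2 v = trans (⊛-cong A (A⊛-const 1) v) (A⊛-const 4 v)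

  -- B is a polynomial in A minus J, and J commutes with A by regularity. To avoid subtraction, the
  -- remaining terms of `main-eq` are added to both sides; that equation is used for f under A and
  -- for `A ⊛ f`.
  B-comm : ∀ f v → (A ⊛ B ⊛ f) v ≡ (B ⊛ A ⊛ f) v
  B-comm f v = +-cancelˡ-≡ (∑ (A ⊛ f) + (6 * (A ⊛ A ⊛ f) v + 3 * (A ⊛ f) v)) _ _ (begin
    ∑ (A ⊛ f) + (6 * (A ⊛ A ⊛ f) v + 3 * (A ⊛ f) v) + (A ⊛ B ⊛ f) v
      ≡⟨ cong (λ k → k + (6 * (A ⊛ A ⊛ f) v + 3 * (A ⊛ f) v) + (A ⊛ B ⊛ f) v) (trans (∑-A⊛ f) (sym (A⊛-const (∑ f) v))) ⟩
    (A ⊛ (λ _ → ∑ f)) v + (6 * (A ⊛ A ⊛ f) v + 3 * (A ⊛ f) v) + (A ⊛ B ⊛ f) v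
      ≡⟨ cong (λ k → (A ⊛ (λ _ → ∑ f)) v + k + (A ⊛ B ⊛ f) v) (trans (cong₂ _+_ (sym (⊛-* A 6 (A ⊛ f) v)) (sym (⊛-* A 3 f v))) (sym (⊛-+ A (λ u → 6 * (A ⊛ f) u) (λ u → 3 * f u) v))) ⟩
    (A ⊛ (λ _ → ∑ f)) v + (A ⊛ (λ u → 6 * (A ⊛ f) u + 3 * f u)) v + (A ⊛ B ⊛ f) v
      ≡⟨ trans (cong (_+ (A ⊛ B ⊛ f) v) (sym (⊛-+ A (λ _ → ∑ f) (λ u → 6 * (A ⊛ f) u + 3 * f u) v)))
               (sym (⊛-+ A (λ u → ∑ f + (6 * (A ⊛ f) u + 3 * f u)) (B ⊛ f) v)) ⟩
    (A ⊛ (λ u → ∑ f + (6 * (A ⊛ f) u + 3 * f u) + (B ⊛ f) u)) v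
      ≡⟨ ⊛-cong A (λ u → sym (main-eq f u)) v ⟩
    (A ⊛ (λ u → (A ⊛ A ⊛ f) u + (A ⊛ A ⊛ A ⊛ f) u)) v
      ≡⟨ ⊛-+ A (A ⊛ A ⊛ f) (A ⊛ A ⊛ A ⊛ f) v ⟩
    (A ⊛ A ⊛ A ⊛ f) v + (A ⊛ A ⊛ A ⊛ A ⊛ f) v
      ≡⟨ main-eq (A ⊛ f) v ⟩
    ∑ (A ⊛ f) + (6 * (A ⊛ A ⊛ f) v + 3 * (A ⊛ f) v) + (B ⊛ A ⊛ f) v ∎)
    where open ≡-Reasoning

  AB≡BA : ∀ v w → (A ⊗ B) v w ≡ (B ⊗ A) v w
  AB≡BA v w = begin
    (A ⊛ (λ u → B u w)) v            ≡⟨ ⊛-cong A (λ u → sym (∑-δʳ w (B u))) v ⟩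
    (A ⊛ B ⊛ (λ u → δ u w)) v        ≡⟨ B-comm (λ u → δ u w) v ⟩
    (B ⊛ A ⊛ (λ u → δ u w)) v        ≡⟨ ⊛-cong B (λ u → ∑-δʳ w (A u)) v ⟩
    (B ⊛ (λ u → A u w)) v            ∎
    where open ≡-Reasoning

  B-diag-eq : ∀ v → B v v ≡ A³ v v
  B-diag-eq v = sym (+-cancelˡ-≡ 4 _ _ (subst₂ (λ x y → x + A³ v v ≡ 1 + (6 * y + 3) + B v v) (A²-diag v) (A-diag v)
    (subst (λ d → A² v v + A³ v v ≡ 1 + (6 * A v v + 3 * d) + B v v) (δ-refl v) (B-eq v v))))

  B-edge-eq : ∀ {v w} → v ~ w → A² v w + A³ v w ≡ 7 + B v w
  B-edge-eq {v} {w} p = subst₂ (λ a d → A² v w + A³ v w ≡ 1 + (6 * a + 3 * d) + B v w) (~⇒≡1 p) (δ-≢ (~-irrefl p)) (B-eq v w)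

  B-far-eq : ∀ {v w} → v ≢ w → ¬ (v ~ w) → A² v w + A³ v w ≡ 1 + B v w
  B-far-eq {v} {w} ne na = subst₂ (λ a d → A² v w + A³ v w ≡ 1 + (6 * a + 3 * d) + B v w) (≁⇒≡0 na) (δ-≢ ne) (B-eq v w)

  -- The two orientations of a triangle give B v v ≥ 2, and its walk of length 2 parallel to the
  -- edge v a gives B v a ≥ 1, beyond the row sum 2.
  no-triangle : ∀ {v a b} → v ~ a → a ~ b → v ~ b → ⊥
  no-triangle {v} {a} {b} va ab vb = <⇒≱ {2} {3} ≤-refl (begin
    3                ≤⟨ +-mono-≤ Bvv Bva ⟩
    B v v + B v a    ≤⟨ ∑-≥₂ (B v) (~-irrefl va) ⟩
    ∑ (B v)          ≡⟨ ∑-B v ⟩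
    2                ∎)
    where
    open ≤-Reasoning
    Bvv : 2 ≤ B v v
    Bvv = subst (2 ≤_) (sym (B-diag-eq v)) (A³≥2 (~-irrefl ab) va ab (~-sym vb) vb (~-sym ab) (~-sym va))
    Bva : 1 ≤ B v a
    Bva = +-cancelˡ-≤ 7 _ _ (subst (8 ≤_) (B-edge-eq va) (+-mono-≤ (A²≥1 vb (~-sym ab)) (A³≥7 va)))

  -- All three other vertices of a quadrangle get an entry in row v: each neighbour by an eighth
  -- walk of length 3, around the quadrangle, and the opposite vertex by two walks of length 2.
  no-quad : ∀ {v a c b} → v ≢ c → a ≢ b → v ~ a → a ~ c → v ~ b → b ~ c → ⊥
  no-quad {v} {a} {c} {b} v≢c a≢b va ac vb bc = <⇒≱ {2} {3} ≤-refl (begin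
    3                          ≤⟨ +-mono-≤ (side a≢b va ac vb bc) (+-mono-≤ (side (a≢b ∘ sym) vb bc va ac) Bvc) ⟩
    B v a + (B v b + B v c)    ≤⟨ ∑-≥₃ (B v) a≢b (~-irrefl ac) (~-irrefl bc) ⟩
    ∑ (B v)                    ≡⟨ ∑-B v ⟩
    2                          ∎)
    where
    open ≤-Reasoning
    Bvc : 1 ≤ B v c
    Bvc = +-cancelˡ-≤ 1 _ _ (subst (2 ≤_) (B-far-eq v≢c (no-triangle va ac)) (≤-trans (A²≥2 a≢b va ac vb bc) (m≤m+n _ _)))
    side : ∀ {a b} → a ≢ b → v ~ a → a ~ c → v ~ b → b ~ c → 1 ≤ B v a
    side {a} {b} a≢b va ac vb bc = +-cancelˡ-≤ 7 _ _ (subst (8 ≤_) (B-edge-eq va) (≤-trans eight (m≤n+m _ (A² v a))))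
      where
      pt : ∀ x → v ~ x → 1 + 3 * δ x a + δ x b ≤ A² x a
      pt x q with x F.≟ b
      ... | no ne    = subst (λ k → 1 + 3 * δ x a + k ≤ A² x a) (sym (δ-≢ ne)) (≤-trans (≤-reflexive (+-identityʳ _)) (via-v va x q))
      ... | yes refl = subst₂ (λ j k → 1 + 3 * j + k ≤ A² x a) (sym (δ-≢ (a≢b ∘ sym))) (sym (δ-refl x))
                         (A²≥2 v≢c (~-sym q) va bc (~-sym ac))
      eight : 8 ≤ A³ v a
      eight = ≤-trans (≤-reflexive (sym (trans (⊛-+ A (λ x → 1 + 3 * δ x a) (λ x → δ x b) v)
        (cong₂ _+_ (backtracking v a va) (trans (∑-δʳ b (A v)) (~⇒≡1 vb)))))) (⊛-mono A v pt)

  A²≤1 : ∀ {v w} → v ≢ w → A² v w ≤ 1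
  A²≤1 {v} {w} ne with A² v w ≤? 1
  ... | yes p = p
  ... | no np = let (a , b , a≢b , p , q) = two-terms (λ u → A v u * A u w) (λ u → *-mono-≤ (A≤1 v u) (A≤1 u w)) (≰⇒> np)
                in ⊥-elim (no-quad ne a≢b (≥1-*ˡ p) (≥1-*ʳ {A v a} p) (≥1-*ˡ q) (≥1-*ʳ {A v b} q))

  A²≡0-edge : ∀ {v w} → v ~ w → A² v w ≡ 0
  A²≡0-edge {v} {w} p with ≥1⊎≡0 (A² v w)
  ... | inj₂ z = z
  ... | inj₁ q = let (x , a , b) = ⊛≥1 A (λ u → A u w) v q in ⊥-elim (no-triangle a b p)

  -- Without triangles and quadrangles only the seven backtracking walks are left.
  B-edge : ∀ {v w} → v ~ w → B v w ≡ 0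
  B-edge {v} {w} p = n≤0⇒n≡0 (+-cancelˡ-≤ 7 _ _ (begin
    7 + B v w                          ≡⟨ sym (B-edge-eq p) ⟩
    A² v w + A³ v w                    ≡⟨ cong (_+ A³ v w) (A²≡0-edge p) ⟩
    A³ v w                             ≤⟨ ⊛-mono A v pt ⟩
    (A ⊛ (λ x → 1 + 3 * δ x w)) v      ≡⟨ backtracking v w p ⟩
    7                                  ∎))
    where
    open ≤-Reasoning
    pt : ∀ x → v ~ x → A² x w ≤ 1 + 3 * δ x w
    pt x q with x F.≟ w
    ... | yes refl = ≤-reflexive (trans (A²-diag x) (cong (λ k → 1 + 3 * k) (sym (δ-refl x))))
    ... | no ne    = ≤-trans (A²≤1 ne) (m≤m+n 1 _)

  B-diag : ∀ v → B v v ≡ 0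
  B-diag v with ≥1⊎≡0 (B v v)
  ... | inj₂ z = z
  ... | inj₁ q = let (x , a , b) = ⊛≥1 A (λ u → A² u v) v (subst (1 ≤_) (B-diag-eq v) q)
                     (y , c , d) = ⊛≥1 A (λ u → A u v) x b
                 in ⊥-elim (no-triangle a c (~-sym d))

  B≥1⇒≢ : ∀ {v w} → 1 ≤ B v w → v ≢ w
  B≥1⇒≢ {v} p refl with () ← subst (1 ≤_) (B-diag v) p

  B≥1⇒≁ : ∀ {v w} → 1 ≤ B v w → ¬ (v ~ w)
  B≥1⇒≁ p q with () ← subst (1 ≤_) (B-edge q) p

  B≥1-sym : ∀ {v w} → 1 ≤ B v w → 1 ≤ B w v
  B≥1-sym {v} {w} = subst (1 ≤_) (B-sym v w)

  connected : ∀ {P : Fin n → Set} → (∀ {u w} → u ~ w → P u → P w) → ∀ {v} → P v → ∀ w → P w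
  connected {P} spread {v} pv w with near v w
  ... | inj₁ refl = pv
  ... | inj₂ (inj₁ p) = spread p pv
  ... | inj₂ (inj₂ (inj₁ p)) = let (x , a , b) = ⊛≥1 A (λ u → A u w) v p in spread b (spread a pv)
  ... | inj₂ (inj₂ (inj₂ p)) = let (x , a , q) = ⊛≥1 A (λ u → A² u w) v p
                                   (y , b , c) = ⊛≥1 A (λ u → A u w) x q in spread c (spread b (spread a pv))

  -- The equitable partition

  Closed : Subset n → Set
  Closed S = ∀ u w → 1 ≤ B u w → lookup S u ≡ lookup S w

  closed? : ∀ S → Dec (Closed S)
  closed? S = F.all? (λ u → F.all? (λ w → (1 ≤? B u w) →-dec (lookup S u Bool.≟ lookup S w)))

  -- v ≈ w: v and w lie on the same cycle of the multigraph with adjacency matrix B.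
  infix 4 _≈_
  opaque
    _≈_ : Fin n → Fin n → Set
    v ≈ w = ∀ S → Closed S → lookup S v ≡ lookup S w

    ≈-refl : ∀ {v} → v ≈ v
    ≈-refl S c = refl

    ≈-sym : ∀ {v w} → v ≈ w → w ≈ v
    ≈-sym p S c = sym (p S c)

    ≈-trans : ∀ {u v w} → u ≈ v → v ≈ w → u ≈ w
    ≈-trans p q S c = trans (p S c) (q S c)

    B⇒≈ : ∀ {v w} → 1 ≤ B v w → v ≈ w
    B⇒≈ p S c = c _ _ p

    _≈?_ : ∀ v w → Dec (v ≈ w)
    v ≈? w with anySubset? (λ S → closed? S ×-dec ¬? (lookup S v Bool.≟ lookup S w))
    ... | yes (S , c , ne) = no (λ p → ne (p S c))
    ... | no none = yes (λ S c → decidable-stable (lookup S v Bool.≟ lookup S w) (λ ne → none (S , c , ne)))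

    -- Decidability turns P into a Boolean subset. It is closed, because B is symmetric and P thus
    -- spreads both ways, and equivalent vertices cannot be separated by a closed subset.
    ≈-induct : ∀ {P : Fin n → Set} → (∀ u → Dec (P u)) → (∀ {u w} → 1 ≤ B u w → P u → P w) → ∀ {v w} → v ≈ w → P v → P w
    ≈-induct {P} P? spread {v} {w} v≈w pv = from w (trans (sym (look w)) (trans (sym (v≈w S closed)) (trans (look v) (dec-true (P? v) pv))))
      where
      S : Subset n
      S = tabulate (λ u → does (P? u))
      look : ∀ u → lookup S u ≡ does (P? u)
      look = lookup∘tabulate (λ u → does (P? u))
      from : ∀ u → does (P? u) ≡ true → P u
      from u e with P? u
      ... | yes p = p
      agree : ∀ u w → 1 ≤ B u w → does (P? u) ≡ does (P? w)
      agree u w b with P? u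
      ... | yes p = sym (dec-true (P? w) (spread b p))
      ... | no np = sym (dec-false (P? w) (np ∘ spread (B≥1-sym b)))
      closed : Closed S
      closed u w b = trans (look u) (trans (agree u w b) (sym (look w)))

  Inv : (Fin n → ℕ) → Set
  Inv h = ∀ {u w} → u ≈ w → h u ≡ h w

  B-const⇒Inv : ∀ {h : Fin n → ℕ} → (∀ {u w} → 1 ≤ B u w → h u ≡ h w) → Inv h
  B-const⇒Inv {h} c {u} u≈w = ≈-induct (λ x → h u ≟ h x) (λ b e → trans e (c b)) u≈w refl

  B⊛-Inv : ∀ {h} → Inv h → ∀ v → (B ⊛ h) v ≡ 2 * h v
  B⊛-Inv {h} inv v = trans (⊛-cong-supp B v (λ u b → inv (≈-sym (B⇒≈ b)))) (trans (∑-*ʳ (h v) (B v)) (cong (_* h v) (∑-B v)))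

  -- Equality in 2ab ≤ a² + b², summed with weights B.
  harmonic⇒Inv : ∀ {f : Fin n → ℕ} → (∀ v → (B ⊛ f) v ≡ 2 * f v) → Inv f
  harmonic⇒Inv {f} harm = B-const⇒Inv (λ {u} {w} b → equal-squares (f u) (f w) (*-cancel b (pointwise u w)))
    where
    open ≡-Reasoning
    open +-*-Solver
    lower upper : Fin n → Fin n → ℕ
    lower v u = B v u * (2 * (f v * f u))
    upper v u = B v u * (f v * f v + f u * f u)
    *-cancel : ∀ {b x y} → 1 ≤ b → b * x ≡ b * y → x ≡ y
    *-cancel {suc b} {x} {y} _ = *-cancelˡ-≡ x y (suc b)
    total : ℕ
    total = ∑ (λ v → f v * f v)
    lower-sum : ∑ (λ v → ∑ (lower v)) ≡ 4 * total
    lower-sum = trans (∑-cong row) (∑-*ˡ 4 (λ v → f v * f v))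
      where
      row : ∀ v → ∑ (lower v) ≡ 4 * (f v * f v)
      row v = begin
        ∑ (λ u → B v u * (2 * (f v * f u)))   ≡⟨ ∑-cong (λ u → solve 3 (λ b x y → b :* (con 2 :* (x :* y)) := con 2 :* x :* (b :* y)) refl (B v u) (f v) (f u)) ⟩
        ∑ (λ u → 2 * f v * (B v u * f u))     ≡⟨ ∑-*ˡ (2 * f v) (λ u → B v u * f u) ⟩
        2 * f v * (B ⊛ f) v                   ≡⟨ cong (2 * f v *_) (harm v) ⟩
        2 * f v * (2 * f v)                   ≡⟨ solve 1 (λ x → con 2 :* x :* (con 2 :* x) := con 4 :* (x :* x)) refl (f v) ⟩
        4 * (f v * f v)                       ∎
    upper-sum : ∑ (λ v → ∑ (upper v)) ≡ 4 * total
    upper-sum = begin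
      ∑ (λ v → ∑ (λ u → B v u * (f v * f v + f u * f u)))
        ≡⟨ ∑-cong (λ v → trans (∑-cong (λ u → *-distribˡ-+ (B v u) (f v * f v) (f u * f u))) (∑-+ (λ u → B v u * (f v * f v)) (λ u → B v u * (f u * f u)))) ⟩
      ∑ (λ v → ∑ (λ u → B v u * (f v * f v)) + ∑ (λ u → B v u * (f u * f u)))
        ≡⟨ ∑-+ (λ v → ∑ (λ u → B v u * (f v * f v))) (λ v → ∑ (λ u → B v u * (f u * f u))) ⟩
      ∑ (λ v → ∑ (λ u → B v u * (f v * f v))) + ∑ (λ v → ∑ (λ u → B v u * (f u * f u)))
        ≡⟨ cong₂ _+_ left (trans (∑-swap (λ v u → B v u * (f u * f u))) (trans (∑-cong (λ u → ∑-cong (λ v → cong (_* (f u * f u)) (B-sym v u)))) left)) ⟩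
      2 * total + 2 * total
        ≡⟨ solve 1 (λ t → con 2 :* t :+ con 2 :* t := con 4 :* t) refl total ⟩
      4 * total ∎
      where
      left : ∑ (λ v → ∑ (λ u → B v u * (f v * f v))) ≡ 2 * total
      left = trans (∑-cong (λ v → trans (∑-*ʳ (f v * f v) (B v)) (cong (_* (f v * f v)) (∑-B v)))) (∑-*ˡ 2 (λ v → f v * f v))
    le : ∀ v u → lower v u ≤ upper v u
    le v u = *-monoʳ-≤ (B v u) (2ab≤a²+b² (f v) (f u))
    pointwise : ∀ v u → lower v u ≡ upper v u
    pointwise v = ∑-≡ (le v) (∑-≡ (λ v → ∑-mono (le v)) (trans lower-sum (sym upper-sum)) v)

  -- B(Ah) = A(Bh) = 2Ah, so Ah is again harmonic for B. Applied to the indicator of a class, this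
  -- is equitability.
  Inv-A : ∀ {h} → Inv h → Inv (A ⊛ h)
  Inv-A {h} inv = harmonic⇒Inv (λ v → trans (sym (B-comm h v)) (trans (⊛-cong A (B⊛-Inv inv) v) (⊛-* A 2 h v)))

  opaque
    χ : Fin n → Fin n → ℕ
    χ v w = if does (v ≈? w) then 1 else 0

    χ≡1 : ∀ {v w} → v ≈ w → χ v w ≡ 1
    χ≡1 {v} {w} p = cong (if_then 1 else 0) (dec-true (v ≈? w) p)

    χ≡0 : ∀ {v w} → ¬ v ≈ w → χ v w ≡ 0
    χ≡0 {v} {w} p = cong (if_then 1 else 0) (dec-false (v ≈? w) p)

    χ≥1⇒≈ : ∀ {v w} → 1 ≤ χ v w → v ≈ w
    χ≥1⇒≈ {v} {w} p with v ≈? w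
    ... | yes q = q
    ... | no _  with () ← p

  χ≤1 : ∀ v w → χ v w ≤ 1
  χ≤1 v w with ≥1⊎≡0 (χ v w)
  ... | inj₁ p = ≤-reflexive (χ≡1 (χ≥1⇒≈ p))
  ... | inj₂ z = subst (_≤ 1) (sym z) z≤n

  χ-≡ : ∀ {v w v' w'} → (v ≈ w → v' ≈ w') → (v' ≈ w' → v ≈ w) → χ v w ≡ χ v' w'
  χ-≡ {v} {w} {v'} {w'} f g with v ≈? w
  ... | yes p = trans (χ≡1 p) (sym (χ≡1 (f p)))
  ... | no np = trans (χ≡0 np) (sym (χ≡0 (np ∘ g)))

  χ-Inv : ∀ y → Inv (λ w → χ w y)
  χ-Inv y p = χ-≡ (≈-trans (≈-sym p)) (≈-trans p)

  χ-congʳ : ∀ v {y z} → y ≈ z → χ v y ≡ χ v z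
  χ-congʳ v p = χ-≡ (λ q → ≈-trans q p) (λ q → ≈-trans q (≈-sym p))

  opaque
    size : Fin n → ℕ
    size y = ∑ (λ w → χ w y)

    q : Fin n → Fin n → ℕ
    q v y = (A ⊛ (λ w → χ w y)) v

  opaque
    unfolding size
    size-def : ∀ y → size y ≡ ∑ (λ w → χ w y)
    size-def y = refl

    q-def : ∀ v y → q v y ≡ (A ⊛ (λ w → χ w y)) v
    q-def v y = refl

  q-Inv : ∀ y → Inv (λ v → q v y)
  q-Inv y {u} {w} p = trans (q-def u y) (trans (Inv-A (χ-Inv y) p) (sym (q-def w y)))

  q-congʳ : ∀ v {y z} → y ≈ z → q v y ≡ q v z
  q-congʳ v {y} {z} p = trans (q-def v y) (trans (⊛-cong A (λ w → χ-congʳ w p) v) (sym (q-def v z)))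

  q≤4 : ∀ v y → q v y ≤ 4
  q≤4 v y = begin
    q v y                      ≡⟨ q-def v y ⟩
    (A ⊛ (λ w → χ w y)) v      ≤⟨ ⊛-mono A v (λ w _ → χ≤1 w y) ⟩
    (A ⊛ (λ _ → 1)) v          ≡⟨ A⊛-const 1 v ⟩
    4                          ∎
    where open ≤-Reasoning

  ~⇒q≥1 : ∀ {v w y} → v ~ w → w ≈ y → 1 ≤ q v y
  ~⇒q≥1 {v} {w} {y} a p = subst (1 ≤_) (sym (q-def v y)) (≤-trans (*-mono-≤ a (≤-reflexive (sym (χ≡1 p)))) (⊛-≥ A (λ w → χ w y) v w))

  q≥1⇒~ : ∀ {v y} → 1 ≤ q v y → ∃ λ w → v ~ w × w ≈ y
  q≥1⇒~ {v} {y} p = let (w , a , b) = ⊛≥1 A (λ w → χ w y) v (subst (1 ≤_) (q-def v y) p) in w , a , χ≥1⇒≈ b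

  -- `main-eq` for the indicator of a class, on which B acts as multiplication by 2; this raises the
  -- coefficient 3 to 5.
  class-eq : ∀ v y → (A ⊛ (λ w → q w y)) v + (A ⊛ A ⊛ (λ w → q w y)) v ≡ size y + (6 * q v y + 5 * χ v y)
  class-eq v y = begin
    (A ⊛ (λ w → q w y)) v + (A ⊛ A ⊛ (λ w → q w y)) v
      ≡⟨ cong₂ _+_ (⊛-cong A (λ w → q-def w y) v) (⊛-cong A (⊛-cong A (λ w → q-def w y)) v) ⟩
    (A ⊛ A ⊛ (λ w → χ w y)) v + (A ⊛ A ⊛ A ⊛ (λ w → χ w y)) v
      ≡⟨ main-eq (λ w → χ w y) v ⟩
    ∑ (λ w → χ w y) + (6 * (A ⊛ (λ w → χ w y)) v + 3 * χ v y) + (B ⊛ (λ w → χ w y)) v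
      ≡⟨ cong₂ _+_ (cong₂ (λ s k → s + (6 * k + 3 * χ v y)) (sym (size-def y)) (sym (q-def v y))) (B⊛-Inv (χ-Inv y) v) ⟩
    size y + (6 * q v y + 3 * χ v y) + 2 * χ v y
      ≡⟨ solve 3 (λ s k c → s :+ (con 6 :* k :+ con 3 :* c) :+ con 2 :* c := s :+ (con 6 :* k :+ con 5 :* c)) refl (size y) (q v y) (χ v y) ⟩
    size y + (6 * q v y + 5 * χ v y) ∎
    where
    open ≡-Reasoning
    open +-*-Solver

  -- Both sides count the edges between the classes of x and y, with weight h.
  double-count : ∀ {h} → Inv h → ∀ x → size x * (A ⊛ h) x ≡ ∑ (λ w → q w x * h w)
  double-count {h} inv x = begin
    size x * (A ⊛ h) x                          ≡⟨ cong (_* (A ⊛ h) x) (size-def x) ⟩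
    ∑ (λ v → χ v x) * (A ⊛ h) x                 ≡⟨ sym (∑-*ʳ ((A ⊛ h) x) (λ v → χ v x)) ⟩
    ∑ (λ v → χ v x * (A ⊛ h) x)                 ≡⟨ ∑-cong same ⟩
    ∑ (λ v → χ v x * (A ⊛ h) v)                 ≡⟨ ∑-cong (λ v → trans (sym (∑-*ˡ (χ v x) (λ w → A v w * h w))) (∑-cong (λ w → sym (*-assoc (χ v x) (A v w) (h w))))) ⟩
    ∑ (λ v → ∑ (λ w → χ v x * A v w * h w))     ≡⟨ ∑-swap (λ v w → χ v x * A v w * h w) ⟩
    ∑ (λ w → ∑ (λ v → χ v x * A v w * h w))     ≡⟨ ∑-cong (λ w → trans (∑-*ʳ (h w) (λ v → χ v x * A v w)) (cong (_* h w)
                                                    (trans (∑-cong (λ v → trans (*-comm (χ v x) (A v w)) (cong (_* χ v x) (A-sym v w)))) (sym (q-def w x))))) ⟩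
    ∑ (λ w → q w x * h w)                       ∎
    where
    open ≡-Reasoning
    same : ∀ v → χ v x * (A ⊛ h) x ≡ χ v x * (A ⊛ h) v
    same v with ≥1⊎≡0 (χ v x)
    ... | inj₁ p = cong (χ v x *_) (sym (Inv-A inv (χ≥1⇒≈ p)))
    ... | inj₂ z rewrite z = refl

  size-q : ∀ x y → size x * q x y ≡ size y * q y x
  size-q x y = begin
    size x * q x y                          ≡⟨ cong (size x *_) (q-def x y) ⟩
    size x * (A ⊛ (λ w → χ w y)) x          ≡⟨ double-count (χ-Inv y) x ⟩
    ∑ (λ w → q w x * χ w y)                 ≡⟨ ∑-cong same ⟩
    ∑ (λ w → q y x * χ w y)                 ≡⟨ ∑-*ˡ (q y x) (λ w → χ w y) ⟩
    q y x * ∑ (λ w → χ w y)                 ≡⟨ *-comm (q y x) _ ⟩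
    ∑ (λ w → χ w y) * q y x                 ≡⟨ cong (_* q y x) (sym (size-def y)) ⟩
    size y * q y x                          ∎
    where
    open ≡-Reasoning
    same : ∀ w → q w x * χ w y ≡ q y x * χ w y
    same w with ≥1⊎≡0 (χ w y)
    ... | inj₁ p = cong (_* χ w y) (q-Inv x (χ≥1⇒≈ p))
    ... | inj₂ z rewrite z = trans (*-zeroʳ (q w x)) (sym (*-zeroʳ (q y x)))

  -- Representatives, sums over classes and families of classes

  opaque
    rep : Fin n → Fin n
    rep v = fromMaybe v (first (λ w → does (v ≈? w)))

    rep-≈ : ∀ v → v ≈ rep v
    rep-≈ v with first-just (λ w → does (v ≈? w)) v (dec-true (v ≈? v) ≈-refl)
    ... | j , f , t rewrite f with v ≈? j
    ...   | yes p = p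

    rep-cong : ∀ {v w} → v ≈ w → rep v ≡ rep w
    rep-cong {v} {w} p with first-just (λ u → does (v ≈? u)) v (dec-true (v ≈? v) ≈-refl)
                          | first-cong {p = λ u → does (v ≈? u)} {q = λ u → does (w ≈? u)} same
      where
      same : ∀ u → does (v ≈? u) ≡ does (w ≈? u)
      same u with v ≈? u
      ... | yes r = sym (dec-true (w ≈? u) (≈-trans (≈-sym p) r))
      ... | no nr = sym (dec-false (w ≈? u) (nr ∘ ≈-trans p))
    ... | j , f , _ | e rewrite sym e | f = refl

  -- Every vertex is filed under the representative of its class. What is filed under w is its whole
  -- class if w represents itself, and nothing otherwise.
  class-sum-∣ : ∀ {h d} → Inv h → (∀ x → d ∣ size x * h x) → d ∣ ∑ h
  class-sum-∣ {h} {d} inv div = subst (d ∣_) (sym regroup) (∣-∑ _ part)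
    where
    open ≡-Reasoning
    regroup : ∑ h ≡ ∑ (λ w → ∑ (λ v → δ (rep v) w * h v))
    regroup = begin
      ∑ h                                    ≡⟨ ∑-cong (λ v → sym (trans (cong (_* h v) (∑-δ (rep v))) (*-identityˡ (h v)))) ⟩
      ∑ (λ v → ∑ (δ (rep v)) * h v)          ≡⟨ ∑-cong (λ v → sym (∑-*ʳ (h v) (δ (rep v)))) ⟩
      ∑ (λ v → ∑ (λ w → δ (rep v) w * h v))  ≡⟨ ∑-swap (λ v w → δ (rep v) w * h v) ⟩
      ∑ (λ w → ∑ (λ v → δ (rep v) w * h v))  ∎
    part : ∀ w → d ∣ ∑ (λ v → δ (rep v) w * h v)
    part w with rep w F.≟ w
    ... | yes e = subst (d ∣_) (sym (begin
        ∑ (λ v → δ (rep v) w * h v)   ≡⟨ ∑-cong same ⟩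
        ∑ (λ v → χ v w * h w)         ≡⟨ ∑-*ʳ (h w) (λ v → χ v w) ⟩
        ∑ (λ v → χ v w) * h w         ≡⟨ cong (_* h w) (sym (size-def w)) ⟩
        size w * h w                  ∎)) (div w)
      where
      same : ∀ v → δ (rep v) w * h v ≡ χ v w * h w
      same v with v ≈? w
      ... | yes p = cong₂ _*_ (trans (cong (λ u → δ u w) (trans (rep-cong p) e)) (trans (δ-refl w) (sym (χ≡1 p)))) (inv p)
      ... | no np = trans (cong (_* h v) (δ-≢ (λ r → np (subst (v ≈_) r (rep-≈ v))))) (cong (_* h w) (sym (χ≡0 np)))
    ... | no ne = subst (d ∣_) (sym (∑-0 zeroes)) (d ∣0)
      where
      zeroes : ∀ v → δ (rep v) w * h v ≡ 0
      zeroes v = cong (_* h v) (δ-≢ (λ r → ne (trans (rep-cong (≈-sym (subst (v ≈_) r (rep-≈ v)))) r)))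

  -- Along an edge the factor `q w u` lies between 1 and 4, so p has to divide the next class size;
  -- connectivity carries this to all classes.
  prime∣size : ∀ {p} → Prime p → 5 ≤ p → ∀ {v} → p ∣ size v → p ∣ 51
  prime∣size {p} pr 5≤p {v} pv = subst (p ∣_) (trans (∑-1 n) order) (class-sum-∣ (λ _ → refl) (λ x → ∣m⇒∣m*n 1 (connected spread pv x)))
    where
    spread : ∀ {u w} → u ~ w → p ∣ size u → p ∣ size w
    spread {u} {w} a pu with euclidsLemma (size w) (q w u) pr (subst (p ∣_) (size-q u w) (∣m⇒∣m*n (q u w) pu))
    ... | inj₁ pw = pw
    ... | inj₂ pq = ⊥-elim (<⇒≱ {4} {5} ≤-refl (≤-trans (≤-trans 5≤p
            (∣⇒≤ ⦃ >-nonZero (~⇒q≥1 (~-sym a) ≈-refl) ⦄ pq)) (q≤4 w u)))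

  module Family {m : ℕ} (r : Fin m → Fin n) (r-inj : ∀ {i j} → r i ≈ r j → i ≡ j) where

    In : Fin n → Set
    In w = ∃ λ j → w ≈ r j

    in? : ∀ w → Dec (In w)
    in? w = F.any? (λ j → w ≈? r j)

    opaque
      out : Fin n → ℕ
      out w = if does (in? w) then 0 else 1

      out≡0 : ∀ {w} → In w → out w ≡ 0
      out≡0 {w} p = cong (if_then 0 else 1) (dec-true (in? w) p)

      out≡1 : ∀ {w} → ¬ In w → out w ≡ 1
      out≡1 {w} p = cong (if_then 0 else 1) (dec-false (in? w) p)

    split : ∀ {h} → Inv h → ∀ w → h w ≡ ∑ (λ j → χ w (r j) * h (r j)) + out w * h w
    split {h} inv w with in? w
    ... | yes (j₀ , p) = trans (inv p) (sym (trans (cong₂ _+_ (trans (∑-cong only) (∑-δˡ j₀ (λ j → h (r j)))) (cong (_* h w) (out≡0 (j₀ , p)))) (+-identityʳ _)))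
      where
      only : ∀ j → χ w (r j) * h (r j) ≡ δ j₀ j * h (r j)
      only j with j₀ F.≟ j
      ... | yes refl = cong (_* h (r j)) (trans (χ≡1 p) (sym (δ-refl j)))
      ... | no ne    = cong (_* h (r j)) (trans (χ≡0 (λ p' → ne (r-inj (≈-trans (≈-sym p) p')))) (sym (δ-≢ ne)))
    ... | no np = sym (trans (cong₂ _+_ (∑-0 (λ j → cong (_* h (r j)) (χ≡0 (λ p → np (j , p))))) (trans (cong (_* h w) (out≡1 np)) (*-identityˡ (h w)))) refl)

    A-expand : ∀ {h} → Inv h → ∀ v → (A ⊛ h) v ≡ ∑ (λ j → q v (r j) * h (r j)) + (A ⊛ (λ w → out w * h w)) v
    A-expand {h} inv v = begin
      (A ⊛ h) v
        ≡⟨ ⊛-cong A (split inv) v ⟩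
      (A ⊛ (λ w → ∑ (λ j → χ w (r j) * h (r j)) + out w * h w)) v
        ≡⟨ ⊛-+ A (λ w → ∑ (λ j → χ w (r j) * h (r j))) (λ w → out w * h w) v ⟩
      (A ⊛ (λ w → ∑ (λ j → χ w (r j) * h (r j)))) v + (A ⊛ (λ w → out w * h w)) v
        ≡⟨ cong (_+ (A ⊛ (λ w → out w * h w)) v) inner ⟩
      ∑ (λ j → q v (r j) * h (r j)) + (A ⊛ (λ w → out w * h w)) v ∎
      where
      open ≡-Reasoning
      inner : (A ⊛ (λ w → ∑ (λ j → χ w (r j) * h (r j)))) v ≡ ∑ (λ j → q v (r j) * h (r j))
      inner = begin
        ∑ (λ w → A v w * ∑ (λ j → χ w (r j) * h (r j)))
          ≡⟨ ∑-cong (λ w → trans (sym (∑-*ˡ (A v w) (λ j → χ w (r j) * h (r j)))) (∑-cong (λ j → sym (*-assoc (A v w) (χ w (r j)) (h (r j)))))) ⟩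
        ∑ (λ w → ∑ (λ j → A v w * χ w (r j) * h (r j)))
          ≡⟨ ∑-swap (λ w j → A v w * χ w (r j) * h (r j)) ⟩
        ∑ (λ j → ∑ (λ w → A v w * χ w (r j) * h (r j)))
          ≡⟨ ∑-cong (λ j → trans (∑-*ʳ (h (r j)) (λ w → A v w * χ w (r j))) (cong (_* h (r j)) (sym (q-def v (r j))))) ⟩
        ∑ (λ j → q v (r j) * h (r j)) ∎

    ∑-expand : ∀ {h} → Inv h → ∑ h ≡ ∑ (λ j → size (r j) * h (r j)) + ∑ (λ w → out w * h w)
    ∑-expand {h} inv = begin
      ∑ h
        ≡⟨ ∑-cong (split inv) ⟩
      ∑ (λ w → ∑ (λ j → χ w (r j) * h (r j)) + out w * h w)
        ≡⟨ ∑-+ (λ w → ∑ (λ j → χ w (r j) * h (r j))) (λ w → out w * h w) ⟩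
      ∑ (λ w → ∑ (λ j → χ w (r j) * h (r j))) + ∑ (λ w → out w * h w)
        ≡⟨ cong (_+ ∑ (λ w → out w * h w)) (trans (∑-swap (λ w j → χ w (r j) * h (r j)))
             (∑-cong (λ j → trans (∑-*ʳ (h (r j)) (λ w → χ w (r j))) (cong (_* h (r j)) (sym (size-def (r j))))))) ⟩
      ∑ (λ j → size (r j) * h (r j)) + ∑ (λ w → out w * h w) ∎
      where open ≡-Reasoning

  B-neighbour : ∀ v → ∃ λ w → 1 ≤ B v w
  B-neighbour v = ∑≥1 (B v) (subst (1 ≤_) (sym (∑-B v)) (s≤s z≤n))

  size≥2 : ∀ v → 2 ≤ size v
  size≥2 v = let (w , b) = B-neighbour v in subst (2 ≤_) (sym (size-def v)) (≤-trans
    (≤-reflexive (sym (cong₂ _+_ (χ≡1 ≈-refl) (χ≡1 (≈-sym (B⇒≈ b)))))) (∑-≥₂ (λ u → χ u v) (B≥1⇒≢ b)))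

  far : ∀ {v w} → v ≢ w → ¬ (v ~ w) → 2 ≤ A² v w + A³ v w → 1 ≤ B v w
  far ne na p = +-cancelˡ-≤ 1 _ _ (subst (2 ≤_) (B-far-eq ne na) p)

  -- Class sizes

  -- Here B is a triangle on the three vertices. Their neighbourhoods turn out to be disjoint and
  -- independent, and B links each vertex of one to a unique vertex of each other. AB = BA then
  -- moves edges between neighbourhoods along B, until a triangle or a forbidden entry of B appears.
  module Size3 (K : Fin 3 → Fin n) (K-mem : ∀ {i w} → w ≈ K i → ∃ λ j → w ≡ K j)
    (K-B : ∀ {i j} → i ≢ j → B (K i) (K j) ≡ 1) where

    K-far : ∀ {i j} → ¬ (K i ~ K j)
    K-far {i} {j} p with i F.≟ j
    ... | yes refl = ~-irrefl p refl
    ... | no ne    = B≥1⇒≁ (≤-reflexive (sym (K-B ne))) p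

    K-≢ : ∀ {i j} → i ≢ j → K i ≢ K j
    K-≢ ne = B≥1⇒≢ (≤-reflexive (sym (K-B ne)))

    K-count : ∀ {i j} → i ≢ j → A² (K i) (K j) + A³ (K i) (K j) ≡ 2
    K-count ne = trans (B-far-eq (K-≢ ne) K-far) (cong suc (K-B ne))

    -- A common neighbour would put K i and K j on a pentagon, whose B-class has five elements.
    disjoint : ∀ {i j c} → K i ~ c → K j ~ c → i ≡ j
    disjoint {i} {j} {c} p p' = by (i F.≟ j)
      where
      by : Dec (i ≡ j) → i ≡ j
      by (yes e) = e
      by (no ne) =
        let path = +-cancelˡ-≤ 1 _ _ (≤-trans (≤-reflexive (sym (K-count ne))) (+-monoˡ-≤ (A³ (K i) (K j)) (A²≤1 (K-≢ ne))))
            (e , p₁ , two) = ⊛≥1 A (λ u → A² u (K j)) (K i) path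
            (d , p₂ , p₃) = ⊛≥1 A (λ u → A u (K j)) e two
            (l , d≡Kl) = K-mem (≈-sym (B⇒≈ (far (λ Ki≡d → K-far (subst (_~ K j) (sym Ki≡d) p₃)) (no-triangle p₁ p₂)
                           (+-mono-≤ (A²≥1 p₁ p₂) (A³≥1 p (~-sym p') (~-sym p₃))))))
        in ⊥-elim (K-far (subst (_~ K j) d≡Kl p₃))

    independent : ∀ {i x y} → K i ~ x → K i ~ y → ¬ (x ~ y)
    independent p p' a = no-triangle p a p'

    -- A step of B from K i to K j followed by the edge to v counts in BA; in AB it becomes an edge
    -- from K i followed by a step of B to v.
    next : ∀ {i j v} → i ≢ j → K j ~ v → ∃ λ w → K i ~ w × 1 ≤ B v w
    next {i} {j} {v} ne p =
      let (w , a , b) = ⊛≥1 A (λ u → B u v) (K i) (subst (1 ≤_) (sym (AB≡BA (K i) v))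
                          (≤-trans (*-mono-≤ (≤-reflexive (sym (K-B ne))) p) (⊛-≥ B (λ u → A u v) (K i) (K j))))
      in w , a , B≥1-sym b

    ≤two : ∀ {v a b c} → 1 ≤ B v a → 1 ≤ B v b → 1 ≤ B v c → a ≢ b → a ≢ c → b ≢ c → ⊥
    ≤two {v} p q r ab ac bc = <⇒≱ {2} {3} ≤-refl (≤-trans (+-mono-≤ p (+-mono-≤ q r)) (≤-trans (∑-≥₃ (B v) ab ac bc) (≤-reflexive (∑-B v))))

    apart : ∀ {i j x y} → i ≢ j → K i ~ x → K j ~ y → x ≢ y
    apart ne p q refl = ne (disjoint p q)

    -- `next` finds one B-neighbour of v beside each of the other two vertices of K, and the row sum
    -- 2 leaves no room for a third.
    row : ∀ {i j v u} → i ≢ j → K j ~ v → 1 ≤ B v u → K i ~ u ⊎ (Σ[ k ∈ Fin 3 ] (k ≢ i × k ≢ j × K k ~ u))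
    row {i} {j} {v} {u} ne p b = by (u F.≟ w) (u F.≟ w')
      where
      k : Fin 3
      k = proj₁ (third ne)
      ki : k ≢ i
      ki = proj₁ (proj₂ (third ne))
      kj : k ≢ j
      kj = proj₂ (proj₂ (third ne))
      w w' : Fin n
      w = proj₁ (next ne p)
      w' = proj₁ (next kj p)
      pw : K i ~ w
      pw = proj₁ (proj₂ (next ne p))
      pw' : K k ~ w'
      pw' = proj₁ (proj₂ (next kj p))
      by : Dec (u ≡ w) → Dec (u ≡ w') → K i ~ u ⊎ (Σ[ k ∈ Fin 3 ] (k ≢ i × k ≢ j × K k ~ u))
      by (yes e) _ = inj₁ (subst (K i ~_) (sym e) pw)
      by (no _) (yes e) = inj₂ (k , ki , kj , subst (K k ~_) (sym e) pw')
      by (no uw) (no uw') = ⊥-elim (≤two b (proj₂ (proj₂ (next ne p))) (proj₂ (proj₂ (next kj p))) uw uw' (apart (ki ∘ sym) pw pw'))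

    leaves : ∀ {j v u} → K j ~ v → 1 ≤ B v u → ¬ (K j ~ u)
    leaves {j} {v} {u} p b p' = by (other j)
      where
      other : ∀ j → Σ[ i ∈ Fin 3 ] (i ≢ j)
      other 0F = 1F , λ ()
      other 1F = 0F , λ ()
      other 2F = 0F , λ ()
      choose : ∀ {i} → i ≢ j → K i ~ u ⊎ (Σ[ k ∈ Fin 3 ] (k ≢ i × k ≢ j × K k ~ u)) → ⊥
      choose ne (inj₁ a) = ne (disjoint a p')
      choose ne (inj₂ (k , _ , kj , a)) = kj (disjoint a p')
      by : Σ[ i ∈ Fin 3 ] (i ≢ j) → ⊥
      by (i , ne) = choose ne (row ne p b)

    unique : ∀ {i j v w u} → i ≢ j → K j ~ v → K i ~ w → 1 ≤ B v w → K i ~ u → 1 ≤ B v u → u ≡ w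
    unique {i} {j} {v} {w} {u} ne p pw bw pu bu = by (u F.≟ w)
      where
      by : Dec (u ≡ w) → u ≡ w
      by (yes e) = e
      by (no u≢w) =
        let (k , ki , kj) = third ne
            (w' , pw' , bw') = next kj p
        in ⊥-elim (≤two bu bw bw' u≢w (apart (ki ∘ sym) pu pw') (apart (ki ∘ sym) pw pw'))

    -- The passage x, y, y′ counts in AB, so in BA some B-neighbour u of x is adjacent to y′. It
    -- cannot lie beside K k, where y′ lies, by independence; hence it is x′.
    shift : ∀ {i j k x y x' y'} → i ≢ j → k ≢ i → k ≢ j → K i ~ x → K j ~ y → x ~ y →
      K j ~ x' → 1 ≤ B x x' → K k ~ y' → 1 ≤ B y y' → x' ~ y'
    shift {i} {j} {k} {x} {y} {x'} {y'} ij ki kj px py xy px' bx py' by =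
      let (u , bu , uy') = ⊛≥1 B (λ u → A u y') x (subst (1 ≤_) (AB≡BA x y') (≤-trans (*-mono-≤ xy by) (⊛-≥ A (λ u → B u y') x y)))
      in choose bu uy' (row (ij ∘ sym) px bu)
      where
      choose : ∀ {u} → 1 ≤ B x u → u ~ y' → K j ~ u ⊎ (Σ[ l ∈ Fin 3 ] (l ≢ j × l ≢ i × K l ~ u)) → x' ~ y'
      choose bu uy' (inj₁ pu) = subst (_~ y') (unique (ij ∘ sym) px px' bx pu bu) uy'
      choose {u} bu uy' (inj₂ (l , lj , li , pu)) =
        ⊥-elim (independent (subst (λ l → K l ~ u) (fourth i j k l li lj ki kj ij) pu) py' uy')

    -- There are two walks of length 3 from a to y: through K 0F and x, and through b and K 1F.
    opposite : ∀ {a b x y} → a ≢ x → K 0F ~ a → K 1F ~ b → a ~ b → K 0F ~ x → K 1F ~ y → x ~ y → 1 ≤ B a y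
    opposite {a} {b} {x} {y} ax pa pb ab px py xy = far a≢y a≁y
      (≤-trans (A³≥2 K0≢b (~-sym pa) px xy ab (~-sym pb) py) (m≤n+m _ (A² a y)))
      where
      K0≢b : K 0F ≢ b
      K0≢b refl = K-far pb
      b≢y : b ≢ y
      b≢y refl = no-quad K0≢b ax pa ab px xy
      a≢y : a ≢ y
      a≢y = apart {0F} {1F} (λ ()) pa py
      a≁y : ¬ (a ~ y)
      a≁y ay = no-quad (λ { refl → K-far pa }) b≢y ab (~-sym pb) ay (~-sym py)

    edge-between : ∀ {i x} → A (K i) x * A² x (K 1F) ≥ 1 → K i ~ x × ∃ λ y → x ~ y × K 1F ~ y
    edge-between {i} {x} t =
      let (y , p , p') = ⊛≥1 A (λ u → A u (K 1F)) x (≥1-*ʳ {A (K i) x} t) in ≥1-*ˡ t , y , p , ~-sym p'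

    -- Disjoint neighbourhoods leave no walk of length 2, so `K-count` gives two walks of length 3.
    -- They begin differently, because a neighbour of K 0F has at most one walk of length 2 to K 1F.
    two-edges : ∃₂ λ x y → x ≢ y × 1 ≤ A (K 0F) x * A² x (K 1F) × 1 ≤ A (K 0F) y * A² y (K 1F)
    two-edges = two-terms (λ u → A (K 0F) u * A² u (K 1F)) term≤1 (≤-reflexive (sym A³≡2))
      where
      A²≡0 : A² (K 0F) (K 1F) ≡ 0
      A²≡0 with ≥1⊎≡0 (A² (K 0F) (K 1F))
      ... | inj₂ z = z
      ... | inj₁ p = let (c , p₁ , p₂) = ⊛≥1 A (λ u → A u (K 1F)) (K 0F) p in ⊥-elim (apart {0F} {1F} (λ ()) p₁ (~-sym p₂) refl)
      A³≡2 : A³ (K 0F) (K 1F) ≡ 2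
      A³≡2 = subst (λ k → k + A³ (K 0F) (K 1F) ≡ 2) A²≡0 (K-count {0F} {1F} (λ ()))
      term≤1 : ∀ u → A (K 0F) u * A² u (K 1F) ≤ 1
      term≤1 u with ≥1⊎≡0 (A (K 0F) u)
      ... | inj₂ z = ≤-trans (≤-reflexive (cong (_* A² u (K 1F)) z)) z≤n
      ... | inj₁ p = *-mono-≤ (A≤1 (K 0F) u) (A²≤1 (λ e → K-far (subst (K 0F ~_) e p)))

    -- The index modulo 3 names the vertex of K beside which a vertex lies, and consecutive x, like
    -- consecutive y, are linked by B. `shift` moves the edge x₀ y₁ to x₁ y₂, x₂ y₃ and x₃ y₄, and
    -- the edge y₀ x₁ to y₁ x₂ and y₂ x₃.
    contradictory : ∀ {x₀ y₁ y₀ x₁ x₂ y₂ x₃ y₃ y₄} → x₀ ≢ y₀ → K 0F ~ x₀ → x₀ ~ y₁ → K 1F ~ y₁ → K 0F ~ y₀ → y₀ ~ x₁ → K 1F ~ x₁ →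
      K 2F ~ x₂ → 1 ≤ B x₁ x₂ → K 2F ~ y₂ → 1 ≤ B y₁ y₂ → K 0F ~ x₃ → 1 ≤ B x₂ x₃ → K 0F ~ y₃ → 1 ≤ B y₂ y₃ → K 1F ~ y₄ → 1 ≤ B y₃ y₄ → ⊥
    contradictory {x₀} {y₁} {y₀} {x₁} {x₂} {y₂} {x₃} {y₃} {y₄} x₀≢y₀ px₀ x₀y₁ py₁ py₀ y₀x₁ px₁ px₂ x₁₂ py₂ y₁₂ px₃ x₂₃ py₃ y₂₃ py₄ y₃₄ = by (x₃ F.≟ x₀)
      where
      x₀₁ : 1 ≤ B x₀ x₁
      x₀₁ = opposite x₀≢y₀ px₀ py₁ x₀y₁ py₀ px₁ y₀x₁
      y₀₁ : 1 ≤ B y₀ y₁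
      y₀₁ = opposite (x₀≢y₀ ∘ sym) py₀ px₁ y₀x₁ px₀ py₁ x₀y₁
      x₁y₂ : x₁ ~ y₂
      x₁y₂ = shift {0F} {1F} {2F} (λ ()) (λ ()) (λ ()) px₀ py₁ x₀y₁ px₁ x₀₁ py₂ y₁₂
      x₂y₃ : x₂ ~ y₃
      x₂y₃ = shift {1F} {2F} {0F} (λ ()) (λ ()) (λ ()) px₁ py₂ x₁y₂ px₂ x₁₂ py₃ y₂₃
      x₃y₄ : x₃ ~ y₄
      x₃y₄ = shift {2F} {0F} {1F} (λ ()) (λ ()) (λ ()) px₂ py₃ x₂y₃ px₃ x₂₃ py₄ y₃₄
      y₁x₂ : y₁ ~ x₂
      y₁x₂ = shift {0F} {1F} {2F} (λ ()) (λ ()) (λ ()) py₀ px₁ y₀x₁ py₁ y₀₁ px₂ x₁₂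
      by : Dec (x₃ ≡ x₀) → ⊥
      -- Once y₃ = y₀, the walks x₀, y₁, x₂, y₀ and x₀, y₂, x₁, y₀ force a B-entry between two
      -- neighbours of K 0F.
      by (yes refl) = leaves px₀ (far x₀≢y₀ (independent px₀ py₀)
          (≤-trans (A³≥2 y₁≢y₂ x₀y₁ y₁x₂ (subst (x₂ ~_) y₃≡y₀ x₂y₃) (~-sym y₂x₃) (~-sym x₁y₂) (~-sym y₀x₁)) (m≤n+m _ (A² x₀ y₀)))) py₀
        where
        y₂x₃ : y₂ ~ x₃
        y₂x₃ = shift {1F} {2F} {0F} (λ ()) (λ ()) (λ ()) py₁ px₂ y₁x₂ py₂ y₁₂ px₃ x₂₃
        y₁≢y₂ : y₁ ≢ y₂
        y₁≢y₂ = apart {1F} {2F} (λ ()) py₁ py₂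
        y₄≡y₁ : y₄ ≡ y₁
        y₄≡y₁ = decidable-stable (y₄ F.≟ y₁) (λ ne → no-quad (λ e → K-far (subst (K 0F ~_) e px₀)) ne x₃y₄ (~-sym py₄) x₀y₁ (~-sym py₁))
        y₃≡y₀ : y₃ ≡ y₀
        y₃≡y₀ = unique {0F} {1F} (λ ()) py₁ py₀ (B≥1-sym y₀₁) py₃ (subst (λ u → 1 ≤ B u y₃) y₄≡y₁ (B≥1-sym y₃₄))
      -- Here uniqueness of B-neighbours gives y₄ = x₁ and then y₃ = x₀, which closes the triangle
      -- x₂, x₀, y₁.
      by (no ne) = no-triangle (subst (x₂ ~_) y₃≡x₀ x₂y₃) x₀y₁ (~-sym y₁x₂)
        where
        y₄≡x₁ : y₄ ≡ x₁
        y₄≡x₁ = unique {1F} {0F} (λ ()) px₀ px₁ x₀₁ py₄ (opposite (ne ∘ sym) px₀ py₁ x₀y₁ px₃ py₄ x₃y₄)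
        y₃≡x₀ : y₃ ≡ x₀
        y₃≡x₀ = unique {0F} {1F} (λ ()) px₁ px₀ (B≥1-sym x₀₁) py₃ (subst (λ u → 1 ≤ B u y₃) y₄≡x₁ (B≥1-sym y₃₄))

    impossible : ⊥
    impossible =
      let (x₀ , y₀ , x₀≢y₀ , t , t') = two-edges
          (px₀ , y₁ , x₀y₁ , py₁) = edge-between {0F} t
          (py₀ , x₁ , y₀x₁ , px₁) = edge-between {0F} t'
          (x₂ , px₂ , x₁₂) = next {2F} {1F} (λ ()) px₁
          (y₂ , py₂ , y₁₂) = next {2F} {1F} (λ ()) py₁
          (x₃ , px₃ , x₂₃) = next {0F} {2F} (λ ()) px₂
          (y₃ , py₃ , y₂₃) = next {0F} {2F} (λ ()) py₂
          (y₄ , py₄ , y₃₄) = next {1F} {0F} (λ ()) py₃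
      in contradictory x₀≢y₀ px₀ x₀y₁ py₁ py₀ y₀x₁ px₁ px₂ x₁₂ py₂ y₁₂ px₃ x₂₃ py₃ y₂₃ py₄ y₃₄

  class-of-three : ∀ {k₀ k₁ k₂} → size k₀ ≡ 3 → k₀ ≢ k₁ → k₀ ≢ k₂ → k₁ ≢ k₂ → k₁ ≈ k₀ → k₂ ≈ k₀ → ⊥
  class-of-three {k₀} {k₁} {k₂} e k₀≢k₁ k₀≢k₂ k₁≢k₂ c₁ c₂ = Size3.impossible K K-mem (λ {i} {j} → K-B {i} {j})
    where
    f : Fin n → ℕ
    f w = χ w k₀
    K : Fin 3 → Fin n
    K 0F = k₀
    K 1F = k₁
    K 2F = k₂
    K≈ : ∀ i → K i ≈ k₀
    K≈ 0F = ≈-refl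
    K≈ 1F = c₁
    K≈ 2F = c₂
    left : ∑ (without (without (without f k₀) k₁) k₂) ≡ 0
    left = +-cancelˡ-≡ 3 _ _ (trans (cong₂ _+_ (sym (χ≡1 {k₀} ≈-refl)) (cong₂ _+_ (sym (χ≡1 (K≈ 1F))) (cong (_+ ∑ (without (without (without f k₀) k₁) k₂)) (sym (χ≡1 (K≈ 2F))))))
      (trans (sym (∑-without₃ f k₀≢k₁ k₀≢k₂ k₁≢k₂)) (trans (sym (size-def k₀)) e)))
    mem : ∀ {w} → w ≈ k₀ → w ≡ k₀ ⊎ w ≡ k₁ ⊎ w ≡ k₂
    mem {w} p = by (k₀ F.≟ w) (k₁ F.≟ w) (k₂ F.≟ w)
      where
      by : Dec (k₀ ≡ w) → Dec (k₁ ≡ w) → Dec (k₂ ≡ w) → w ≡ k₀ ⊎ w ≡ k₁ ⊎ w ≡ k₂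
      by (yes e₀) _ _ = inj₁ (sym e₀)
      by (no _) (yes e₁) _ = inj₂ (inj₁ (sym e₁))
      by (no _) (no _) (yes e₂) = inj₂ (inj₂ (sym e₂))
      by (no n₀) (no n₁) (no n₂) with () ← trans (sym (χ≡1 p)) (trans (sym (without-≢ f n₀)) (trans (sym (without-≢ (without f k₀) n₁))
            (trans (sym (without-≢ (without (without f k₀) k₁) n₂)) (∑-term≡0 _ left w))))
    K-mem : ∀ {i w} → w ≈ K i → ∃ λ j → w ≡ K j
    K-mem {i} p with mem (≈-trans p (K≈ i))
    ... | inj₁ e = 0F , e
    ... | inj₂ (inj₁ e) = 1F , e
    ... | inj₂ (inj₂ e) = 2F , e
    row : ∀ i → B (K i) k₀ + (B (K i) k₁ + B (K i) k₂) ≡ 2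
    row i = trans (sym (∑-three (B (K i)) k₀≢k₁ k₀≢k₂ k₁≢k₂ (λ w b → mem (≈-trans (≈-sym (B⇒≈ b)) (K≈ i))))) (∑-B (K i))
    ones : B k₀ k₁ ≡ 1 × B k₀ k₂ ≡ 1 × B k₁ k₂ ≡ 1
    ones = pairwise-sums-2 (B k₀ k₁) (B k₀ k₂) (B k₁ k₂)
      (trans (cong (_+ (B k₀ k₁ + B k₀ k₂)) (sym (B-diag k₀))) (row 0F))
      (trans (cong₂ (λ x y → x + (y + B k₁ k₂)) (B-sym k₀ k₁) (sym (B-diag k₁))) (row 1F))
      (trans (cong₂ _+_ (B-sym k₀ k₂) (trans (sym (+-identityʳ _)) (cong₂ _+_ (B-sym k₁ k₂) (sym (B-diag k₂))))) (row 2F))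
    K-B : ∀ {i j} → i ≢ j → B (K i) (K j) ≡ 1
    K-B {0F} {0F} ne = ⊥-elim (ne refl)
    K-B {0F} {1F} _ = proj₁ ones
    K-B {0F} {2F} _ = proj₁ (proj₂ ones)
    K-B {1F} {0F} _ = trans (B-sym k₁ k₀) (proj₁ ones)
    K-B {1F} {1F} ne = ⊥-elim (ne refl)
    K-B {1F} {2F} _ = proj₂ (proj₂ ones)
    K-B {2F} {0F} _ = trans (B-sym k₂ k₀) (proj₁ (proj₂ ones))
    K-B {2F} {1F} _ = trans (B-sym k₂ k₁) (proj₂ (proj₂ ones))
    K-B {2F} {2F} ne = ⊥-elim (ne refl)

  size≢3 : ∀ v → size v ≢ 3
  size≢3 v e =
    let (k₁ , k₂ , k₁≢k₂ , t₁ , t₂) = two-terms (without f v) rest≤1 (≤-reflexive (sym rest))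
        (v≢k₁ , c₁) = without≥1 f t₁
        (v≢k₂ , c₂) = without≥1 f t₂
    in class-of-three e v≢k₁ v≢k₂ k₁≢k₂ (χ≥1⇒≈ c₁) (χ≥1⇒≈ c₂)
    where
    f : Fin n → ℕ
    f w = χ w v
    rest≤1 : ∀ w → without f v w ≤ 1
    rest≤1 w with ≥1⊎≡0 (without f v w)
    ... | inj₂ z = subst (_≤ 1) (sym z) z≤n
    ... | inj₁ p = let (ne , c) = without≥1 f p in ≤-reflexive (trans (without-≢ f ne) (χ≡1 (χ≥1⇒≈ c)))
    rest : ∑ (without f v) ≡ 2
    rest = +-cancelˡ-≡ 1 _ _ (trans (cong (_+ ∑ (without f v)) (sym (χ≡1 {v} ≈-refl))) (trans (sym (∑-without f v)) (trans (sym (size-def v)) e)))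

  size≤51 : ∀ v → size v ≤ 51
  size≤51 v = begin
    size v              ≡⟨ size-def v ⟩
    ∑ (λ w → χ w v)     ≤⟨ ∑-mono (λ w → χ≤1 w v) ⟩
    ∑ {n} (λ _ → 1)     ≡⟨ trans (∑-1 n) order ⟩
    51                  ∎
    where open ≤-Reasoning

  odd-size : ∀ v → odd (size v) ≡ true → size v ≡ 9 ⊎ size v ≡ 17 ⊎ size v ≡ 27 ⊎ size v ≡ 51
  odd-size v o = choose (subst (λ s → Any (_∣ s) large-primes ⊎ s ≡ 1 ⊎ s ≡ 3 ⊎ s ≡ 9 ⊎ s ≡ 17 ⊎ s ≡ 27 ⊎ s ≡ 51) eq
    (odd-sizes i (trans (cong odd eq) o)))
    where
    i : Fin 52
    i = fromℕ< (s≤s (size≤51 v))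
    eq : toℕ i ≡ size v
    eq = F.toℕ-fromℕ< (s≤s (size≤51 v))
    excluded : ∀ {ps} → All (λ p → Prime p × 5 ≤ p × ¬ (p ∣ 51)) ps → Any (_∣ size v) ps → ⊥
    excluded ((pr , p≥5 , p∤51) All.∷ _) (Any.here d) = p∤51 (prime∣size pr p≥5 d)
    excluded (_ All.∷ ps) (Any.there d) = excluded ps d
    choose : Any (_∣ size v) large-primes ⊎ size v ≡ 1 ⊎ size v ≡ 3 ⊎ size v ≡ 9 ⊎ size v ≡ 17 ⊎ size v ≡ 27 ⊎ size v ≡ 51 →
      size v ≡ 9 ⊎ size v ≡ 17 ⊎ size v ≡ 27 ⊎ size v ≡ 51
    choose (inj₁ d) = ⊥-elim (excluded large-primes-ok d)
    choose (inj₂ (inj₁ e)) = ⊥-elim (<⇒≱ {1} {2} ≤-refl (subst (2 ≤_) e (size≥2 v)))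
    choose (inj₂ (inj₂ (inj₁ e))) = ⊥-elim (size≢3 v e)
    choose (inj₂ (inj₂ (inj₂ s))) = s

  odd-size≥9 : ∀ v → odd (size v) ≡ true → 9 ≤ size v
  odd-size≥9 v o = choose (odd-size v o)
    where
    choose : size v ≡ 9 ⊎ size v ≡ 17 ⊎ size v ≡ 27 ⊎ size v ≡ 51 → 9 ≤ size v
    choose (inj₁ e) = ≤-reflexive (sym e)
    choose (inj₂ (inj₁ e)) = ≤-trans (m≤m+n 9 8) (≤-reflexive (sym e))
    choose (inj₂ (inj₂ (inj₁ e))) = ≤-trans (m≤m+n 9 18) (≤-reflexive (sym e))
    choose (inj₂ (inj₂ (inj₂ e))) = ≤-trans (m≤m+n 9 42) (≤-reflexive (sym e))

  -- The product of size v and q v v counts each edge inside the class twice.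
  q-diag-even : ∀ v → odd (size v) ≡ true → odd (q v v) ≡ false
  q-diag-even v o = even-factor (size v) (q v v) o (trans (cong odd count)
    (handshake (λ w u → χ w v * (A w u * χ u v)) symmetric (λ w → trans (cong (λ a → χ w v * (a * χ w v)) (A-diag w)) (*-zeroʳ (χ w v)))))
    where
    open ≡-Reasoning
    count : size v * q v v ≡ ∑ (λ w → ∑ (λ u → χ w v * (A w u * χ u v)))
    count = begin
      size v * q v v                                       ≡⟨ cong (size v *_) (q-def v v) ⟩
      size v * (A ⊛ (λ w → χ w v)) v                       ≡⟨ double-count (χ-Inv v) v ⟩
      ∑ (λ w → q w v * χ w v)                              ≡⟨ ∑-cong (λ w → trans (*-comm (q w v) (χ w v)) (cong (χ w v *_) (q-def w v))) ⟩
      ∑ (λ w → χ w v * ∑ (λ u → A w u * χ u v))            ≡⟨ ∑-cong (λ w → sym (∑-*ˡ (χ w v) (λ u → A w u * χ u v))) ⟩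
      ∑ (λ w → ∑ (λ u → χ w v * (A w u * χ u v)))          ∎
    symmetric : ∀ w u → χ w v * (A w u * χ u v) ≡ χ u v * (A u w * χ w v)
    symmetric w u = begin
      χ w v * (A w u * χ u v)   ≡⟨ *-comm (χ w v) _ ⟩
      A w u * χ u v * χ w v     ≡⟨ cong (_* χ w v) (trans (*-comm (A w u) (χ u v)) (cong (χ u v *_) (A-sym w u))) ⟩
      χ u v * A u w * χ w v     ≡⟨ *-assoc (χ u v) (A u w) (χ w v) ⟩
      χ u v * (A u w * χ w v)   ∎

  -- The odd classes modulo 2

  module OddFamily {m : ℕ} (r : Fin m → Fin n) (r-inj : ∀ {i j} → r i ≈ r j → i ≡ j) (r-odd : ∀ j → odd (size (r j)) ≡ true) where
    open Family r r-inj

    sizes : ∑ (λ j → size (r j)) + ∑ out ≡ 51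
    sizes = trans (sym (trans (∑-expand {λ _ → 1} (λ _ → refl))
      (cong₂ _+_ (∑-cong (λ j → *-identityʳ (size (r j)))) (∑-cong (λ w → *-identityʳ (out w)))))) (trans (∑-1 n) order)

    few : m ≤ 5
    few = ≮⇒≥ (λ m>5 → <⇒≱ {51} {54} (m≤m+n 52 2) (begin
      54                           ≤⟨ *-monoˡ-≤ 9 {6} {m} m>5 ⟩
      m * 9                        ≡⟨ sym (∑-const {m} 9) ⟩
      ∑ {m} (λ _ → 9)              ≤⟨ ∑-mono (λ j → odd-size≥9 (r j) (r-odd j)) ⟩
      ∑ (λ j → size (r j))         ≤⟨ m≤m+n _ (∑ out) ⟩
      ∑ (λ j → size (r j)) + ∑ out ≡⟨ sizes ⟩
      51                           ∎))
      where open ≤-Reasoning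

    module Full (full : ∀ v → odd (size v) ≡ true → In v) where

      outside-even : ∀ w → out w ≡ 0 ⊎ odd (size w) ≡ false
      outside-even w with in? w
      ... | yes p = inj₁ (out≡0 p)
      ... | no np = inj₂ (Bool.¬-not (np ∘ full w))

      out-Inv : ∀ {h} → Inv h → Inv (λ w → out w * h w)
      out-Inv inv {u} {w} p = cong₂ _*_ (out-≈ (in? u)) (inv p)
        where
        out-≈ : Dec (In u) → out u ≡ out w
        out-≈ (yes (j , e)) = trans (out≡0 (j , e)) (sym (out≡0 (j , ≈-trans (≈-sym p) e)))
        out-≈ (no np) = trans (out≡1 np) (sym (out≡1 (λ { (j , e) → np (j , ≈-trans p e) })))

      out-div : ∀ k w → 2 ∣ size w * (k * out w)
      out-div k w with outside-even w
      ... | inj₁ z = subst (2 ∣_) (sym (trans (cong (size w *_) (trans (cong (k *_) z) (*-zeroʳ k))) (*-zeroʳ (size w)))) (2 ∣0)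
      ... | inj₂ e = ∣m⇒∣m*n (k * out w) (even⇒2∣ (size w) e)

      odd-count : odd m ≡ true
      odd-count = begin
        odd m                            ≡⟨ cong odd (sym (∑-1 m)) ⟩
        odd (∑ {m} (λ _ → 1))            ≡⟨ odd-∑ {m} (λ _ → 1) ⟩
        ⨁ {m} (λ _ → true)               ≡⟨ ⨁-cong (λ j → sym (r-odd j)) ⟩
        ⨁ (λ j → odd (size (r j)))       ≡⟨ sym (odd-∑ (λ j → size (r j))) ⟩
        odd s                            ≡⟨ sym (Bool.xor-identityʳ (odd s)) ⟩
        odd s xor false                  ≡⟨ cong (odd s xor_) (sym (2∣⇒even rest)) ⟩
        odd s xor odd (∑ out)            ≡⟨ sym (odd-+ s (∑ out)) ⟩
        odd (s + ∑ out)                  ≡⟨ cong odd sizes ⟩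
        true                             ∎
        where
        open ≡-Reasoning
        s : ℕ
        s = ∑ (λ j → size (r j))
        rest : 2 ∣ ∑ out
        rest = subst (2 ∣_) (∑-cong (λ w → *-identityʳ (out w)))
          (class-sum-∣ (out-Inv {λ _ → 1} (λ _ → refl)) (λ w → subst (λ k → 2 ∣ size w * k) (*-comm 1 (out w)) (out-div 1 w)))

      M : Fin m → Fin m → Bool
      M i j = odd (q (r i) (r j))

      -- Each even class contributes an even amount, as size v * q v w = size w * q w v with size v odd.
      reduce : ∀ {h} → Inv h → ∀ i → odd ((A ⊛ h) (r i)) ≡ ⨁ (λ j → M i j ∧ odd (h (r j)))
      reduce {h} inv i = begin
        odd ((A ⊛ h) v)                                  ≡⟨ cong odd (A-expand inv v) ⟩
        odd (∑ (λ j → q v (r j) * h (r j)) + rest)       ≡⟨ odd-+ (∑ (λ j → q v (r j) * h (r j))) rest ⟩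
        odd (∑ (λ j → q v (r j) * h (r j))) xor odd rest ≡⟨ cong₂ _xor_ (trans (odd-∑ _) (⨁-cong (λ j → odd-* (q v (r j)) (h (r j))))) even ⟩
        ⨁ (λ j → M i j ∧ odd (h (r j))) xor false        ≡⟨ Bool.xor-identityʳ _ ⟩
        ⨁ (λ j → M i j ∧ odd (h (r j)))                  ∎
        where
        open ≡-Reasoning
        v : Fin n
        v = r i
        rest : ℕ
        rest = (A ⊛ (λ w → out w * h w)) v
        even : odd rest ≡ false
        even = even-factor (size v) rest (r-odd i) (trans (cong odd (double-count (out-Inv inv) v)) (2∣⇒even
          (class-sum-∣ (λ p → cong₂ _*_ (q-Inv v p) (out-Inv inv p)) (λ w → subst (λ k → 2 ∣ size w * k) (arrange w) (out-div (q w v * h w) w)))))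
          where
          arrange : ∀ w → q w v * h w * out w ≡ q w v * (out w * h w)
          arrange w = trans (*-assoc (q w v) (h w) (out w)) (cong (q w v *_) (*-comm (h w) (out w)))

      M-sym : ∀ i j → M i j ≡ M j i
      M-sym i j = trans (lemma i j) (trans (cong odd (size-q (r i) (r j))) (sym (lemma j i)))
        where
        lemma : ∀ i j → M i j ≡ odd (size (r i) * q (r i) (r j))
        lemma i j = sym (trans (odd-* (size (r i)) _) (cong (_∧ M i j) (r-odd i)))

      M-row : ∀ i → ⨁ (M i) ≡ false
      M-row i = trans (⨁-cong (λ j → sym (Bool.∧-identityʳ (M i j)))) (trans (sym (reduce {λ _ → 1} (λ _ → refl) i)) (cong odd (A⊛-const 1 (r i))))

      M-cubic : ∀ i j → i ≢ j → cubic M i j ≡ true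
      M-cubic i j ne = begin
        cubic M i j
          ≡⟨ cong₂ _xor_ (sym (once i)) (trans (⨁-cong (λ k → cong (M i k ∧_) (sym (once k)))) (sym (reduce (Inv-A (q-Inv (r j))) i))) ⟩
        odd ((A ⊛ (λ w → q w (r j))) (r i)) xor odd ((A ⊛ A ⊛ (λ w → q w (r j))) (r i))
          ≡⟨ sym (odd-+ ((A ⊛ (λ w → q w (r j))) (r i)) _) ⟩
        odd ((A ⊛ (λ w → q w (r j))) (r i) + (A ⊛ A ⊛ (λ w → q w (r j))) (r i))
          ≡⟨ cong odd (class-eq (r i) (r j)) ⟩
        odd (size (r j) + (6 * q (r i) (r j) + 5 * χ (r i) (r j)))
          ≡⟨ cong (λ c → odd (size (r j) + (6 * q (r i) (r j) + 5 * c))) (χ≡0 (ne ∘ r-inj)) ⟩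
        odd (size (r j) + (6 * q (r i) (r j) + 0))
          ≡⟨ trans (odd-+ (size (r j)) _) (cong₂ _xor_ (r-odd j) (trans (cong odd (+-identityʳ (6 * q (r i) (r j)))) (odd-* 6 (q (r i) (r j))))) ⟩
        true ∎
        where
        open ≡-Reasoning
        once : ∀ i → odd ((A ⊛ (λ w → q w (r j))) (r i)) ≡ square M i j
        once i = reduce (q-Inv (r j)) i

      single : m ≡ 1
      single = by m refl few
        where
        M-diag : ∀ i → M i i ≡ false
        M-diag i = q-diag-even (r i) (r-odd i)
        even-impossible : ∀ {k} → k ≡ m → odd k ≡ false → ⊥
        even-impossible refl e with () ← trans (sym odd-count) e
        by : ∀ k → k ≡ m → m ≤ 5 → m ≡ 1
        by 0 e _ = ⊥-elim (even-impossible e refl)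
        by 1 e _ = sym e
        by 2 e _ = ⊥-elim (even-impossible e refl)
        by 3 e _ = ⊥-elim (order≢3 M M-sym M-diag M-row M-cubic (sym e))
        by 4 e _ = ⊥-elim (even-impossible e refl)
        by 5 e _ = ⊥-elim (order≢5 M M-sym M-diag M-row M-cubic (sym e))
        by (suc (suc (suc (suc (suc (suc k)))))) refl (s≤s (s≤s (s≤s (s≤s (s≤s ())))))

  record OddClasses (m : ℕ) : Set where
    field
      r     : Fin m → Fin n
      r-inj : ∀ {i j} → r i ≈ r j → i ≡ j
      r-odd : ∀ j → odd (size (r j)) ≡ true

  Exhaustive : ∀ {m} → OddClasses m → Set
  Exhaustive F = ∀ v → odd (size v) ≡ true → ∃ λ j → v ≈ OddClasses.r F j

  extend : ∀ {m} (F : OddClasses m) → Exhaustive F ⊎ OddClasses (suc m)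
  extend {m} F = by (F.all? (λ v → (odd (size v) Bool.≟ true) →-dec F.any? (λ j → v ≈? r j)))
    where
    open OddClasses F
    by : Dec (Exhaustive F) → Exhaustive F ⊎ OddClasses (suc m)
    by (yes full) = inj₁ full
    by (no ¬full) = inj₂ (record { r = r' ; r-inj = r'-inj ; r-odd = r'-odd })
      where
      missing : ∃ λ v → ¬ (odd (size v) ≡ true → ∃ λ j → v ≈ r j)
      missing = F.¬∀⟶∃¬ n _ (λ v → (odd (size v) Bool.≟ true) →-dec F.any? (λ j → v ≈? r j)) ¬full
      v : Fin n
      v = proj₁ missing
      new : ∀ j → ¬ (v ≈ r j)
      new j p = proj₂ missing (λ _ → j , p)
      r' : Fin (suc m) → Fin n
      r' zero    = v
      r' (suc j) = r j
      r'-inj : ∀ {i j} → r' i ≈ r' j → i ≡ j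
      r'-inj {zero}  {zero}  _ = refl
      r'-inj {zero}  {suc j} p = ⊥-elim (new j p)
      r'-inj {suc i} {zero}  p = ⊥-elim (new i (≈-sym p))
      r'-inj {suc i} {suc j} p = cong suc (r-inj p)
      r'-odd : ∀ j → odd (size (r' j)) ≡ true
      r'-odd zero    = decidable-stable (odd (size v) Bool.≟ true) (λ no → proj₂ missing (λ o → ⊥-elim (no o)))
      r'-odd (suc j) = r-odd j

  UniqueOddClass : Set
  UniqueOddClass = ∃ λ κ → odd (size κ) ≡ true × (∀ v → odd (size v) ≡ true → v ≈ κ)

  unique-odd-class : UniqueOddClass
  -- Missing odd classes are added one at a time; fuel 6 is enough because `few` rules out a family
  -- of six.
  unique-odd-class = search 6 none refl
    where
    none : OddClasses 0
    none = record { r = λ () ; r-inj = λ { {()} } ; r-odd = λ () }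
    finish : ∀ {m} (F : OddClasses m) → Exhaustive F → m ≡ 1 → UniqueOddClass
    finish F full refl = r 0F , r-odd 0F , λ v o → to (full v o)
      where
      open OddClasses F
      to : ∀ {v} → (∃ λ j → v ≈ r j) → v ≈ r 0F
      to (0F , p) = p
    search : ∀ fuel {m} → OddClasses m → fuel + m ≡ 6 → UniqueOddClass
    search zero F refl = ⊥-elim (<⇒≱ {5} {6} ≤-refl (OddFamily.few r r-inj r-odd))
      where open OddClasses F
    search (suc fuel) {m} F e = next-class (extend F)
      where
      open OddClasses F
      next-class : Exhaustive F ⊎ OddClasses (suc m) → UniqueOddClass
      next-class (inj₁ full) = finish F full (OddFamily.Full.single r r-inj r-odd full)
      next-class (inj₂ F')   = search fuel F' (trans (+-suc fuel m) e)

  -- Walks along the cycles of B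

  other : ∀ {v u} → 1 ≤ B v u → ∃ λ w → ∀ x → B v x ≡ δ u x + δ w x
  other {v} {u} b = w , λ x → trans (sym (m+[n∸m]≡n (le x))) (cong (δ u x +_) (sym (rest≡ x)))
    where
    le : ∀ x → δ u x ≤ B v x
    le = δ≤ (B v) b
    f : Fin n → ℕ
    f x = B v x ∸ δ u x
    -- Removing one unit at u leaves a single point mass in the row; it sits at u again when B v u =
    -- 2.
    ∑f : ∑ f ≡ 1
    ∑f = +-cancelˡ-≡ 1 _ _ (trans (cong (_+ ∑ f) (sym (∑-δ u))) (trans (sym (∑-+ (δ u) f)) (trans (∑-cong (λ x → m+[n∸m]≡n (le x))) (∑-B v))))
    some : ∃ λ w → 1 ≤ f w
    some = ∑≥1 f (≤-reflexive (sym ∑f))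
    w : Fin n
    w = proj₁ some
    rest≡ : ∀ x → δ w x ≡ f x
    rest≡ = ∑-≡ (δ≤ f (proj₂ some)) (trans (∑-δ w) (sym ∑f))

  opaque
    -- The state is the last step together with its entry of B, so that the walk always continues to
    -- the other end. On a class of two vertices it alternates.
    B-walk : Fin n → ∃ λ (κ : ℕ → Fin n) → ∀ i x → B (κ (suc i)) x ≡ δ (κ i) x + δ (κ (suc (suc i))) x
    B-walk v = (λ i → proj₁ (darts i)) , λ i x → proj₂ (other (B≥1-sym (proj₂ (proj₂ (darts i))))) x
      where
      Dart : Set
      Dart = Σ[ u ∈ Fin n ] Σ[ w ∈ Fin n ] (1 ≤ B u w)
      turn : Dart → Dart
      turn (u , w , b) = let (x , row) = other (B≥1-sym b)
        in w , x , subst (1 ≤_) (sym (row x)) (≤-trans (≤-reflexive (sym (δ-refl x))) (m≤n+m _ (δ u x)))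
      darts : ℕ → Dart
      darts zero    = v , B-neighbour v
      darts (suc i) = turn (darts i)

  module Walk (κ : ℕ → Fin n) (κ-row : ∀ i x → B (κ (suc i)) x ≡ δ (κ i) x + δ (κ (suc (suc i))) x) where

    ends : ∀ {i j} → κ (suc i) ≡ κ (suc j) →
      (κ i ≡ κ j × κ (suc (suc i)) ≡ κ (suc (suc j))) ⊎ (κ i ≡ κ (suc (suc j)) × κ (suc (suc i)) ≡ κ j)
    ends {i} {j} e = δ-pair (λ x → trans (sym (κ-row i x)) (trans (cong (λ u → B u x) e) (κ-row j x)))

    forward : ∀ {i j} → κ i ≡ κ j → κ (suc i) ≡ κ (suc j) → κ (suc (suc i)) ≡ κ (suc (suc j))
    forward {i} {j} e e' = δ-≡ (λ x → +-cancelˡ-≡ (δ (κ i) x) _ _ (trans (sym (κ-row i x))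
      (trans (cong (λ u → B u x) e') (trans (κ-row j x) (cong (λ u → δ u x + δ (κ (suc (suc j))) x) (sym e))))))

    backward : ∀ {i j} → κ (suc i) ≡ κ (suc j) → κ (suc (suc i)) ≡ κ (suc (suc j)) → κ i ≡ κ j
    backward {i} {j} e e' = δ-≡ (λ x → +-cancelʳ-≡ (δ (κ (suc (suc i))) x) _ _ (trans (sym (κ-row i x))
      (trans (cong (λ u → B u x) e) (trans (κ-row j x) (cong (λ u → δ (κ j) x + δ u x) (sym e'))))))

    step-B : ∀ i → 1 ≤ B (κ (suc i)) (κ i)
    step-B i = subst (1 ≤_) (sym (κ-row i (κ i))) (≤-trans (≤-reflexive (sym (δ-refl (κ i)))) (m≤m+n _ _))

    Period : ℕ → Set
    Period p = ∀ t → κ t ≡ κ (p + t)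

    forward-all : ∀ {i j} → κ i ≡ κ j → κ (suc i) ≡ κ (suc j) → ∀ t → κ (t + i) ≡ κ (t + j)
    forward-all e e' zero          = e
    forward-all e e' (suc zero)    = e'
    forward-all e e' (suc (suc t)) = forward (forward-all e e' t) (forward-all e e' (suc t))

    backward-all : ∀ p i → κ i ≡ κ (i + p) → κ (suc i) ≡ κ (suc i + p) → Period p
    backward-all p zero    e e' t = subst₂ (λ x y → κ x ≡ κ y) (+-identityʳ t) (+-comm t p) (forward-all e e' t)
    backward-all p (suc i) e e' = backward-all p i (backward e e') e

    opaque
      -- Two consecutive vertices determine the walk in both directions, and among n² + 1 indices
      -- some consecutive pair repeats. Running back to index 0 makes the walk purely periodic.
      -- Afterwards p + j serves as the index before j.
      periodic : ∃ λ p → Period (suc p)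
      periodic =
        let (i , j , i<j , e) = F.pigeonhole {n * n} {suc (n * n)} ≤-refl (λ i → combine (κ (toℕ i)) (κ (suc (toℕ i))))
            (e₀ , e₁) = F.combine-injective _ _ _ _ e
            (p , eq) = gap i<j
        in p , backward-all (suc p) (toℕ i) (trans e₀ (cong κ (sym eq))) (trans e₁ (cong (λ k → κ (suc k)) (sym eq)))
        where
        gap : ∀ {i j} → i < j → ∃ λ p → i + suc p ≡ j
        gap {i} {j} lt = j ∸ suc i , trans (+-suc i (j ∸ suc i)) (m+[n∸m]≡n lt)

    p : ℕ
    p = proj₁ periodic
    p-period : Period (suc p)
    p-period = proj₂ periodic

    period-* : ∀ {q} → Period q → ∀ k → Period (k * q)
    period-* per zero    t = refl
    period-* {q} per (suc k) t = trans (period-* per k t) (trans (per (k * q + t)) (cong κ (sym (+-assoc q (k * q) t))))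

    -- Two occurrences of a vertex at odd distance cannot be traversed in opposite directions.
    no-reversal : ∀ m i → κ i ≡ κ (suc (double m) + i) → κ (suc i) ≡ κ (double m + i) → ⊥
    no-reversal zero    i e e' = B≥1⇒≢ (step-B i) (sym e)
    no-reversal (suc m) i e e' = no-reversal m (suc i) (trans e' (cong κ (cong suc (sym (+-suc (double m) i))))) (swap (ends e'))
      where
      swap : (κ i ≡ κ (suc (double m + i)) × κ (suc (suc i)) ≡ κ (suc (suc (suc (double m + i))))) ⊎
             (κ i ≡ κ (suc (suc (suc (double m + i)))) × κ (suc (suc i)) ≡ κ (suc (double m + i))) →
             κ (suc (suc i)) ≡ κ (double m + suc i)
      swap (inj₁ (a , b)) = trans b (trans (sym e) (trans a (cong κ (sym (+-suc (double m) i)))))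
      swap (inj₂ (_ , b)) = trans b (cong κ (sym (+-suc (double m) i)))

    -- The second visit goes through the vertex in the same direction, which gives a period, or in
    -- the opposite one, which `no-reversal` excludes at odd distance.
    odd-return : ∀ m i → κ (suc i) ≡ κ (suc (double m) + suc i) → Period (suc (double m))
    odd-return m i e = by (ends {i} {double m + suc i} e)
      where
      by : (κ i ≡ κ (double m + suc i) × κ (suc (suc i)) ≡ κ (suc (suc (double m + suc i)))) ⊎
           (κ i ≡ κ (suc (suc (double m + suc i))) × κ (suc (suc i)) ≡ κ (double m + suc i)) → Period (suc (double m))
      by (inj₂ (_ , b)) = ⊥-elim (no-reversal m (suc i) e b)
      by (inj₁ (_ , b)) = backward-all (suc (double m)) (suc i) (trans e (cong κ (+-comm (suc (double m)) (suc i)))) (trans b (cong κ (cong suc (+-comm (suc (double m)) (suc i)))))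

    opaque
      reached : (∀ v w → v ≈ w) → ∀ v → ∃ λ i → κ i ≡ v
      reached single v =
        let (j , e) = ≈-induct (λ u → F.any? (λ j → κ (toℕ j) F.≟ u)) spread (single (κ 0) v) (zero , refl) in toℕ j , e
        where
        reduce-mod : ∀ i → ∃ λ (j : Fin (suc p)) → κ (toℕ j) ≡ κ i
        reduce-mod i = fromℕ< (m%n<n i (suc p)) , trans (cong κ (F.toℕ-fromℕ< (m%n<n i (suc p))))
          (trans (period-* p-period (i / suc p) (i % suc p)) (cong κ (trans (+-comm _ (i % suc p)) (sym (m≡m%n+[m/n]*n i (suc p))))))
        spread : ∀ {u w} → 1 ≤ B u w → (∃ λ (j : Fin (suc p)) → κ (toℕ j) ≡ u) → ∃ λ (j : Fin (suc p)) → κ (toℕ j) ≡ w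
        spread {u} {w} b (j , refl) = choose (≥1⊎≡0 (δ (κ i) w))
          where
          i : ℕ
          i = p + toℕ j
          two : 1 ≤ δ (κ i) w + δ (κ (suc (suc i))) w
          two = subst (1 ≤_) (κ-row i w) (subst (λ x → 1 ≤ B x w) (p-period (toℕ j)) b)
          choose : 1 ≤ δ (κ i) w ⊎ δ (κ i) w ≡ 0 → ∃ λ (j : Fin (suc p)) → κ (toℕ j) ≡ w
          choose (inj₁ d) = let (k , e) = reduce-mod i in k , trans e (δ≥1 d)
          choose (inj₂ z) = let (k , e) = reduce-mod (suc (suc i)) in k , trans e (δ≥1 (subst (λ k → 1 ≤ k + δ (κ (suc (suc i))) w) z two))

    module OddPeriod (single : ∀ v w → v ≈ w) (m : ℕ) (per : Period (suc (double m))) where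

      q′ : ℕ
      q′ = suc (double m)

      f : ℕ → ℕ → ℕ
      f i j = A (κ i) (κ j)

      -- AB = BA at two vertices of the walk, where multiplication by B adds the values at the
      -- preceding and the following index.
      wave : ∀ i j → f i (suc j) + f (suc (suc i)) (suc j) ≡ f (suc i) j + f (suc i) (suc (suc j))
      wave i j = begin
        f i (suc j) + f (suc (suc i)) (suc j)   ≡⟨ sym (pair (λ u → A u (κ (suc j))) i) ⟩
        (B ⊗ A) (κ (suc i)) (κ (suc j))         ≡⟨ sym (AB≡BA (κ (suc i)) (κ (suc j))) ⟩
        (A ⊗ B) (κ (suc i)) (κ (suc j))         ≡⟨ ∑-cong (λ u → trans (*-comm (A (κ (suc i)) u) _) (cong (_* A (κ (suc i)) u) (B-sym u (κ (suc j))))) ⟩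
        (B ⊛ (A (κ (suc i)))) (κ (suc j))       ≡⟨ pair (A (κ (suc i))) j ⟩
        f (suc i) j + f (suc i) (suc (suc j))   ∎
        where
        open ≡-Reasoning
        pair : ∀ (h : Fin n → ℕ) i → (B ⊛ h) (κ (suc i)) ≡ h (κ i) + h (κ (suc (suc i)))
        pair h i = trans (∑-cong (λ u → trans (cong (_* h u) (κ-row i u)) (*-distribʳ-+ (h u) (δ (κ i) u) (δ (κ (suc (suc i))) u))))
          (trans (∑-+ (λ u → δ (κ i) u * h u) (λ u → δ (κ (suc (suc i))) u * h u)) (cong₂ _+_ (∑-δˡ (κ i) h) (∑-δˡ (κ (suc (suc i))) h)))

      Shift : ℕ → ℕ → Set
      Shift i j = f (suc i) (suc j) ≡ f i j

      -- By the wave equation, f (i+1) (j+1) - f i j depends only on i + j; it vanishes for i = j.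
      transfer : ∀ s i j → Shift i (s + j) → Shift (s + i) j
      transfer zero    i j e = e
      transfer (suc s) i j e = transfer′ (transfer s i (suc j) (subst (Shift i) (sym (+-suc s j)) e))
        where
        transfer′ : ∀ {i j} → Shift i (suc j) → Shift (suc i) j
        transfer′ {i} {j} e = +-cancelˡ-≡ (f i (suc j)) _ _ (trans (wave i j) (trans (+-comm (f (suc i) j) _) (cong (_+ f (suc i) j) e)))

      shift-even : ∀ t a → Shift (double t + a) a
      shift-even t a = subst (λ k → Shift k a) (trans (sym (+-assoc t t a)) (cong (_+ a) (sym (double-+ t))))
        (transfer t (t + a) a (trans (A-diag _) (sym (A-diag _))))

      -- Transfer from the diagonal reaches only even differences of indices; adding the odd period
      -- makes an odd difference even.
      shift≥ : ∀ d a → Shift (d + a) a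
      shift≥ d a with halve d
      ... | evenly t = shift-even t a
      ... | oddly t = trans (cong (λ u → A u (κ (suc a))) (per _))
                       (trans (cong (λ k → f k (suc a)) fix) (trans (shift-even (suc m + t) a) (cong (λ u → A u (κ a)) (trans (cong κ (sym fix′)) (sym (per _))))))
        where
        fix′ : q′ + (suc (double t) + a) ≡ double (suc m + t) + a
        fix′ = trans (cong suc (+-suc (double m) (double t + a))) (trans (cong (2 +_) (sym (+-assoc (double m) (double t) a)))
          (cong (λ k → suc (suc (k + a))) (sym (double-distrib m t))))
        fix : q′ + suc (suc (double t) + a) ≡ suc (double (suc m + t) + a)
        fix = trans (+-suc q′ (suc (double t) + a)) (cong suc fix′)

      shift-sym : ∀ {i j} → Shift i j → Shift j i
      shift-sym {i} {j} e = trans (A-sym _ _) (trans e (A-sym _ _))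

      shift : ∀ i j → Shift i j
      shift i j with ≤-total i j
      ... | inj₁ le = shift-sym (subst (λ k → Shift k i) (m∸n+n≡m le) (shift≥ (j ∸ i) i))
      ... | inj₂ le = subst (λ k → Shift k j) (m∸n+n≡m le) (shift≥ (i ∸ j) j)

      shift-all : ∀ t i j → f (t + i) (t + j) ≡ f i j
      shift-all zero    i j = refl
      shift-all (suc t) i j = trans (shift (t + i) (t + j)) (shift-all t i j)

      -- An odd x is an odd return. An even one becomes odd when the period q′ is added, and q′ is
      -- dropped again afterwards.
      return⇒period : ∀ x → κ 0 ≡ κ x → Period x
      return⇒period x e with halve x
      ... | oddly k = odd-return k (double m) (trans (cong κ (sym (+-identityʳ q′))) (trans (sym (per 0)) (trans e (trans (per x) (cong κ (+-comm q′ x))))))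
      ... | evenly k = λ t → trans (odd-period t) (trans (cong κ (trans (cong (_+ t) sum) (+-assoc q′ x t))) (sym (per (x + t))))
        where
        sum : suc (double (m + k)) ≡ q′ + double k
        sum = cong suc (double-distrib m k)
        odd-period : Period (suc (double (m + k)))
        odd-period = odd-return (m + k) (double m) (trans (cong κ (sym (+-identityʳ q′))) (trans (sym (per 0)) (trans e
          (trans (per x) (trans (per (q′ + x)) (cong κ (trans (cong (q′ +_) (sym sum)) (+-comm q′ _))))))))

      -- For distinct neighbours i and j of 0 in a circulant graph, the vertices 0, i, i + j, j form
      -- a quadrangle unless i + j is 0. So two further neighbours would both be the inverse of the
      -- first one, although they differ.
      contradiction : ⊥
      contradiction =
        let (a , pa) = ∑≥1 (A (κ 0)) (subst (1 ≤_) (sym (regular (κ 0))) (s≤s z≤n))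
            (b , c , b≢c , tb , tc) = two-terms (without (A (κ 0)) a) (rest≤1 a) (rest≥2 a)
            (a≢b , pb) = without≥1 (A (κ 0)) tb
            (a≢c , pc) = without≥1 (A (κ 0)) tc
            (i , ei) = reached single a
            (j , ej) = reached single b
            (k , ek) = reached single c
            pi = subst (κ 0 ~_) (sym ei) pa
            pj = subst (κ 0 ~_) (sym ej) pb
            pk = subst (κ 0 ~_) (sym ek) pc
            per-ij = return⇒period (i + j) (meet i j pi pj (λ e → a≢b (trans (sym ei) (trans e ej))))
            per-ik = return⇒period (i + k) (meet i k pi pk (λ e → a≢c (trans (sym ei) (trans e ek))))
        in b≢c (trans (sym ej) (trans (trans (per-ik j) (trans (cong κ (arrange i k j)) (sym (per-ij k)))) ek))
        where
        arrange : ∀ i k j → i + k + j ≡ i + j + k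
        arrange = solve 3 (λ i k j → i :+ k :+ j := i :+ j :+ k) refl
          where open +-*-Solver
        rest≤1 : ∀ a w → without (A (κ 0)) a w ≤ 1
        rest≤1 a w with ≥1⊎≡0 (without (A (κ 0)) a w)
        ... | inj₂ z = subst (_≤ 1) (sym z) z≤n
        ... | inj₁ p = let (ne , _) = without≥1 (A (κ 0)) p in subst (_≤ 1) (sym (without-≢ (A (κ 0)) ne)) (A≤1 (κ 0) w)
        rest≥2 : ∀ a → 2 ≤ ∑ (without (A (κ 0)) a)
        rest≥2 a = +-cancelˡ-≤ 1 _ _ (≤-trans (m≤m+n 3 1) (≤-trans (≤-reflexive (sym (regular (κ 0))))
          (≤-trans (≤-reflexive (∑-without (A (κ 0)) a)) (+-monoˡ-≤ _ (A≤1 (κ 0) a)))))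
        hop : ∀ i j → κ 0 ~ κ j → κ i ~ κ (i + j)
        hop i j p = subst (1 ≤_) (trans (sym (shift-all i 0 j)) (cong (λ k → f k (i + j)) (+-identityʳ i))) p
        meet : ∀ i j → κ 0 ~ κ i → κ 0 ~ κ j → κ i ≢ κ j → κ 0 ≡ κ (i + j)
        meet i j pi pj ne = decidable-stable (κ 0 F.≟ κ (i + j)) (λ far →
          no-quad far ne pi (hop i j pj) pj (subst (λ k → κ j ~ κ k) (+-comm j i) (hop j i pi)))

    no-collision : (∀ v w → v ≈ w) → ∀ a b → κ (double a) ≢ κ (suc (double b))
    no-collision single a b e with a ≤? b
    -- `odd-return` starts at a successor, and the successor of p + `double a` is the same vertex as
    -- `double a`.
    ... | yes le = OddPeriod.contradiction single (b ∸ a) (odd-return (b ∸ a) (p + double a)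
        (trans (sym (p-period (double a))) (trans e (trans (cong (λ k → κ (suc k)) half) (trans (p-period _) (cong κ (arrange (suc p) (double (b ∸ a)) (double a))))))))
      where
      half : double b ≡ double (b ∸ a) + double a
      half = trans (cong double (sym (m∸n+n≡m le))) (double-distrib (b ∸ a) a)
      arrange : ∀ x y z → x + suc (y + z) ≡ suc y + (x + z)
      arrange = solve 3 (λ x y z → x :+ (con 1 :+ (y :+ z)) := con 1 :+ y :+ (x :+ z)) refl
        where open +-*-Solver
    ... | no nle = OddPeriod.contradiction single d (odd-return d (double b) (trans (sym e) (cong κ half)))
      where
      d : ℕ
      d = a ∸ suc b
      half : double a ≡ suc (double d) + suc (double b)
      half = trans (cong double (sym (m∸n+n≡m (≰⇒> nle)))) (trans (double-distrib d (suc b)) (+-suc (double d) (suc (double b))))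

  -- Otherwise the vertices of even and odd index along a B-walk form a proper 2-colouring of B, and 51 is even.
  not-single : ¬ (∀ v w → v ≈ w)
  not-single single = true≢false (trans (sym (cong odd halves)) (odd-* 2 (∑ c)))
    where
    v₀ : Fin n
    v₀ = subst Fin (sym order) zero
    κ : ℕ → Fin n
    κ = proj₁ (B-walk v₀)
    κ-row : ∀ i x → B (κ (suc i)) x ≡ δ (κ i) x + δ (κ (suc (suc i))) x
    κ-row = proj₂ (B-walk v₀)
    open Walk κ κ-row
    even? : ∀ v → Dec (∃ λ (j : Fin (suc p)) → κ (double (toℕ j)) ≡ v)
    even? v = F.any? (λ j → κ (double (toℕ j)) F.≟ v)
    c : Fin n → ℕ
    c v = if does (even? v) then 1 else 0
    c-even : ∀ i → c (κ (double i)) ≡ 1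
    -- Reducing i modulo the period changes the index `double i` by an even multiple of the period,
    -- so the bounded search finds a witness.
    c-even i = cong (if_then 1 else 0) (dec-true (even? (κ (double i))) (fromℕ< lt , trans (cong (κ ∘ double) (F.toℕ-fromℕ< lt))
      (trans (period-* p-period (double (i / suc p)) (double (i % suc p))) (cong κ split))))
      where
      lt : i % suc p < suc p
      lt = m%n<n i (suc p)
      split : double (i / suc p) * suc p + double (i % suc p) ≡ double i
      split = begin
        double (i / suc p) * suc p + double (i % suc p)
          ≡⟨ cong₂ (λ x y → x * suc p + y) (double-+ (i / suc p)) (double-+ (i % suc p)) ⟩
        (i / suc p + i / suc p) * suc p + (i % suc p + i % suc p)
          ≡⟨ solve 3 (λ x y z → (x :+ x) :* z :+ (y :+ y) := (y :+ x :* z) :+ (y :+ x :* z)) refl (i / suc p) (i % suc p) (suc p) ⟩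
        (i % suc p + i / suc p * suc p) + (i % suc p + i / suc p * suc p)
          ≡⟨ cong (λ k → k + k) (sym (m≡m%n+[m/n]*n i (suc p))) ⟩
        i + i
          ≡⟨ sym (double-+ i) ⟩
        double i ∎
        where
        open ≡-Reasoning
        open +-*-Solver
    c-odd : ∀ i → c (κ (suc (double i))) ≡ 0
    c-odd i = cong (if_then 1 else 0) (dec-false (even? (κ (suc (double i)))) (λ { (j , e) → no-collision single (toℕ j) i e }))
    alternate : ∀ i → c (κ i) + c (κ (suc i)) ≡ 1
    alternate i with halve i
    ... | evenly k = cong₂ _+_ (c-even k) (c-odd k)
    ... | oddly k = cong₂ _+_ (c-odd k) (c-even (suc k))
    proper : ∀ u w → 1 ≤ B u w → c u + c w ≡ 1
    proper u w b = choose (≥1⊎≡0 (δ (κ i) w))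
      where
      j : ℕ
      j = proj₁ (reached single u)
      i : ℕ
      i = p + j
      u≡ : u ≡ κ (suc i)
      u≡ = trans (sym (proj₂ (reached single u))) (p-period j)
      two : 1 ≤ δ (κ i) w + δ (κ (suc (suc i))) w
      two = subst (1 ≤_) (κ-row i w) (subst (λ x → 1 ≤ B x w) u≡ b)
      choose : 1 ≤ δ (κ i) w ⊎ δ (κ i) w ≡ 0 → c u + c w ≡ 1
      choose (inj₁ d) = trans (cong₂ _+_ (cong c u≡) (cong c (sym (δ≥1 d)))) (trans (+-comm _ (c (κ i))) (alternate i))
      choose (inj₂ z) = trans (cong₂ _+_ (cong c u≡) (cong c (sym (δ≥1 (subst (λ k → 1 ≤ k + δ (κ (suc (suc i))) w) z two))))) (alternate (suc i))
    -- The total of B u w (c u + c w) is four times ∑ c by the row sums, and 2 · 51 because the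
    -- colouring is proper.
    halves : 2 * ∑ c ≡ 51
    halves = *-cancelˡ-≡ (2 * ∑ c) 51 2 (begin
      2 * (2 * ∑ c)                                                ≡⟨ solve 1 (λ x → con 2 :* (con 2 :* x) := con 2 :* x :+ con 2 :* x) refl (∑ c) ⟩
      2 * ∑ c + 2 * ∑ c                                            ≡⟨ cong₂ _+_ (sym (weighted c)) (sym (trans (∑-swap (λ u w → B u w * c w)) (trans (∑-cong (λ w → ∑-cong (λ u → cong (_* c w) (B-sym u w)))) (weighted c)))) ⟩
      ∑ (λ u → ∑ (λ w → B u w * c u)) + ∑ (λ u → ∑ (λ w → B u w * c w))
                                                                   ≡⟨ sym (trans (∑-cong (λ u → trans (∑-cong (λ w → *-distribˡ-+ (B u w) (c u) (c w))) (∑-+ (λ w → B u w * c u) (λ w → B u w * c w))))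
                                                                             (∑-+ (λ u → ∑ (λ w → B u w * c u)) (λ u → ∑ (λ w → B u w * c w)))) ⟩
      ∑ (λ u → (B ⊛ (λ w → c u + c w)) u)                          ≡⟨ ∑-cong (λ u → ⊛-cong-supp B {f = λ w → c u + c w} {g = λ _ → 1} u (proper u)) ⟩
      ∑ (λ u → (B ⊛ (λ _ → 1)) u)                                  ≡⟨ weighted (λ _ → 1) ⟩
      2 * ∑ {n} (λ _ → 1)                                          ≡⟨ cong (2 *_) (trans (∑-1 n) order) ⟩
      2 * 51                                                       ∎)
      where
      open ≡-Reasoning
      open +-*-Solver
      weighted : ∀ (h : Fin n → ℕ) → ∑ (λ u → ∑ (λ w → B u w * h u)) ≡ 2 * ∑ h
      weighted h = trans (∑-cong (λ u → trans (∑-*ʳ (h u) (B u)) (cong (_* h u) (∑-B u)))) (∑-*ˡ 2 h)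

  -- Class equations restricted to a family

  module Rows {m : ℕ} (r : Fin m → Fin n) (r-inj : ∀ {i j} → r i ≈ r j → i ≡ j) where
    open Family r r-inj public

    -- T is the block of q on the family, and R is the part of q² that passes through a class
    -- outside it.
    T R : Fin m → Fin m → ℕ
    T i j = q (r i) (r j)
    R i j = (A ⊛ (λ w → out w * q w (r j))) (r i)

    outside : Fin m → ℕ
    outside i = (A ⊛ out) (r i)

    row-sum : ∀ i → ∑ (T i) + outside i ≡ 4
    row-sum i = trans (cong₂ _+_ (∑-cong (λ j → sym (*-identityʳ (T i j)))) (⊛-cong A (λ w → sym (*-identityʳ (out w))) (r i)))
      (trans (sym (A-expand {λ _ → 1} (λ _ → refl) (r i))) (A⊛-const 1 (r i)))

    out≥1⇒∉ : ∀ {w} → 1 ≤ out w → ¬ In w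
    out≥1⇒∉ {w} p i with () ← subst (1 ≤_) (out≡0 i) p

    leave : ∀ i → 1 ≤ outside i → ∃ λ w → r i ~ w × ¬ In w
    leave i p = let (w , a , o) = ⊛≥1 A out (r i) p in w , a , out≥1⇒∉ o

    full⇒In : ∀ {i w} → outside i ≡ 0 → r i ~ w → In w
    full⇒In {i} {w} z a = by (in? w)
      where
      by : Dec (In w) → In w
      by (yes p) = p
      by (no np) with () ← subst (1 ≤_) (∑-term≡0 (λ w → A (r i) w * out w) z w) (*-mono-≤ a (≤-reflexive (sym (out≡1 np))))

    -- By equitability a vertex adjacent to any member of the class of r i is equivalent to a
    -- neighbour of r i itself. Hence R vanishes in column i as well as in row i.
    adjacent⇒In : ∀ {i w} → outside i ≡ 0 → 1 ≤ q w (r i) → In w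
    adjacent⇒In {i} {w} z p =
      let (u , wu , u≈) = q≥1⇒~ p
          (w' , a , w'≈w) = q≥1⇒~ (subst (1 ≤_) (q-Inv w u≈) (~⇒q≥1 (~-sym wu) ≈-refl))
          (j , e) = full⇒In z a
      in j , ≈-trans (≈-sym w'≈w) e

    full⇒rest≡0 : ∀ {i} (h : Fin n → ℕ) → outside i ≡ 0 → (A ⊛ (λ w → out w * h w)) (r i) ≡ 0
    full⇒rest≡0 {i} h z = ∑-0 (λ w → trans (sym (*-assoc (A (r i) w) (out w) (h w))) (cong (_* h w) (∑-term≡0 (λ w → A (r i) w * out w) z w)))

    R≡0-row : ∀ {i} j → outside i ≡ 0 → R i j ≡ 0
    R≡0-row j z = full⇒rest≡0 (λ w → q w (r j)) z

    R≡0-col : ∀ i {j} → outside j ≡ 0 → R i j ≡ 0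
    R≡0-col i {j} z = ∑-0 (λ w → trans (cong (A (r i) w *_) (none w)) (*-zeroʳ (A (r i) w)))
      where
      none : ∀ w → out w * q w (r j) ≡ 0
      none w with ≥1⊎≡0 (q w (r j))
      ... | inj₁ p = cong (_* q w (r j)) (out≡0 (adjacent⇒In z p))
      ... | inj₂ e = trans (cong (out w *_) e) (*-zeroʳ (out w))

    S : Fin m → Fin m → ℕ
    S i j = ∑ (λ k → T i k * T k j) + R i j

    -- As no neighbour of r i lies outside, the first step of every walk stays in the family; later
    -- excursions are accounted for by R within S.
    equation : ∀ {i} j → outside i ≡ 0 → S i j + ∑ (λ k → T i k * S k j) ≡ size (r j) + (6 * T i j + 5 * χ (r i) (r j))
    equation {i} j z = begin
      S i j + ∑ (λ k → T i k * S k j)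
        ≡⟨ cong₂ _+_ (sym (twice i)) (∑-cong (λ k → cong (T i k *_) (sym (twice k)))) ⟩
      (A ⊛ (λ w → q w (r j))) (r i) + ∑ (λ k → T i k * (A ⊛ (λ w → q w (r j))) (r k))
        ≡⟨ cong ((A ⊛ (λ w → q w (r j))) (r i) +_) (sym (trans (A-expand (Inv-A (q-Inv (r j))) (r i))
             (trans (cong (∑ (λ k → T i k * (A ⊛ (λ w → q w (r j))) (r k)) +_) (full⇒rest≡0 (A ⊛ (λ w → q w (r j))) z)) (+-identityʳ _)))) ⟩
      (A ⊛ (λ w → q w (r j))) (r i) + (A ⊛ A ⊛ (λ w → q w (r j))) (r i)
        ≡⟨ class-eq (r i) (r j) ⟩
      size (r j) + (6 * T i j + 5 * χ (r i) (r j)) ∎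
      where
      open ≡-Reasoning
      twice : ∀ k → (A ⊛ (λ w → q w (r j))) (r k) ≡ S k j
      twice k = A-expand (q-Inv (r j)) (r k)

    -- The unique neighbour w outside the family has q (r i) w = 1 and R i i = q w (r i).
    single-exit : ∀ i → outside i ≡ 1 → R i i ∣ size (r i)
    single-exit i e = divides (size w) (trans (sym (*-identityʳ (size (r i)))) (trans (cong (size (r i) *_) (sym q≡1)) (trans (size-q (r i) w) (cong (size w *_) (sym R≡)))))
      where
      f : Fin n → ℕ
      f u = A (r i) u * out u
      exit : ∃ λ w → 1 ≤ f w
      exit = ∑≥1 f (≤-reflexive (sym e))
      w : Fin n
      w = proj₁ exit
      f≡δ : ∀ u → δ w u ≡ f u
      f≡δ = ∑-≡ (δ≤ f (proj₂ exit)) (trans (∑-δ w) (sym e))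
      R≡ : R i i ≡ q w (r i)
      R≡ = trans (∑-cong (λ u → trans (sym (*-assoc (A (r i) u) (out u) (q u (r i)))) (cong (_* q u (r i)) (sym (f≡δ u))))) (∑-δˡ w (λ u → q u (r i)))
      χ≤out : ∀ u → χ u w ≤ out u
      χ≤out u with ≥1⊎≡0 (χ u w)
      ... | inj₂ z = subst (_≤ out u) (sym z) z≤n
      ... | inj₁ p = ≤-reflexive (trans (χ≡1 (χ≥1⇒≈ p)) (sym (out≡1 (λ { (j , u≈) →
              out≥1⇒∉ (≥1-*ʳ {A (r i) w} (proj₂ exit)) (j , ≈-trans (≈-sym (χ≥1⇒≈ p)) u≈) }))))
      q≡1 : q (r i) w ≡ 1
      q≡1 = ≤-antisym (≤-trans (≤-reflexive (q-def (r i) w)) (≤-trans (⊛-mono A (r i) (λ u _ → χ≤out u)) (≤-reflexive e)))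
                      (~⇒q≥1 (≥1-*ˡ (proj₂ exit)) ≈-refl)

  -- The neighbours of the unique odd class

  module OneOddClass (κ : Fin n) (κ-odd : odd (size κ) ≡ true) (κ-only : ∀ v → odd (size v) ≡ true → v ≈ κ) where

    even-size : ∀ {x} → ¬ x ≈ κ → odd (size x) ≡ false
    even-size {x} ne = Bool.¬-not (ne ∘ κ-only x)

    even-q : ∀ {x} → ¬ x ≈ κ → odd (q κ x) ≡ false
    even-q {x} ne = even-factor (size κ) (q κ x) κ-odd (trans (cong odd (size-q κ x)) (trans (odd-* (size x) (q x κ)) (cong (_∧ odd (q x κ)) (even-size ne))))

    q-back : ∀ {x} → κ ~ x → 1 ≤ q x κ
    q-back p = ~⇒q≥1 (~-sym p) ≈-refl

    size∈ : size κ ∈ class-sizes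
    size∈ = choose (odd-size κ κ-odd)
      where
      choose : size κ ≡ 9 ⊎ size κ ≡ 17 ⊎ size κ ≡ 27 ⊎ size κ ≡ 51 → size κ ∈ class-sizes
      choose (inj₁ e) = here e
      choose (inj₂ (inj₁ e)) = there (here e)
      choose (inj₂ (inj₂ (inj₁ e))) = there (there (here e))
      choose (inj₂ (inj₂ (inj₂ e))) = there (there (there (here e)))

    -- Otherwise no edge leaves the class of κ, and by connectivity it is the only class.
    not-closed : q κ κ ≢ 4
    not-closed e = not-single (λ v w → ≈-trans (connected spread ≈-refl v) (≈-sym (connected spread ≈-refl w)))
      where
      r : Fin 1 → Fin n
      r _ = κ
      r-inj : ∀ {i j : Fin 1} → r i ≈ r j → i ≡ j
      r-inj {0F} {0F} _ = refl
      open Rows r r-inj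
      full : outside 0F ≡ 0
      full = +-cancelˡ-≡ 4 _ _ (trans (cong (_+ outside 0F) (sym (trans (∑₁ (T 0F)) e))) (row-sum 0F))
      spread : ∀ {u w} → u ~ w → u ≈ κ → w ≈ κ
      spread {u} {w} a p = proj₂ (adjacent⇒In {0F} full (subst (1 ≤_) (q-congʳ w p) (~⇒q≥1 (~-sym a) ≈-refl)))

    module Pair {x : Fin n} (x≉κ : ¬ x ≈ κ) (κ~x : κ ~ x) where
      r : Fin 2 → Fin n
      r 0F = κ
      r 1F = x

      r-inj : ∀ {i j} → r i ≈ r j → i ≡ j
      r-inj {0F} {0F} _ = refl
      r-inj {0F} {1F} p = ⊥-elim (x≉κ (≈-sym p))
      r-inj {1F} {0F} p = ⊥-elim (x≉κ p)
      r-inj {1F} {1F} _ = refl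

      open Rows r r-inj public

      row : ∀ i → (T i 0F + T i 1F) + outside i ≡ 4
      row i = trans (cong (_+ outside i) (sym (∑₂ (T i)))) (row-sum i)

      module _ (split : (T 0F 0F ≡ 0 × T 0F 1F ≡ 4) ⊎ (T 0F 0F ≡ 2 × T 0F 1F ≡ 2)) where

        full : outside 0F ≡ 0
        full = +-cancelˡ-≡ 4 _ _ (trans (cong (_+ outside 0F) (sym (total split))) (row 0F))
          where
          total : (T 0F 0F ≡ 0 × T 0F 1F ≡ 4) ⊎ (T 0F 0F ≡ 2 × T 0F 1F ≡ 2) → T 0F 0F + T 0F 1F ≡ 4
          total (inj₁ (a , b)) = cong₂ _+_ a b
          total (inj₂ (a , b)) = cong₂ _+_ a b

        S-col₀ : ∀ i → S i 0F ≡ T i 0F * T 0F 0F + T i 1F * T 1F 0F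
        S-col₀ i = trans (cong₂ _+_ (∑₂ (λ k → T i k * T k 0F)) (R≡0-col i full)) (+-identityʳ _)

        equation₀ : (T 0F 0F * T 0F 0F + T 0F 1F * T 1F 0F) + (T 0F 0F * (T 0F 0F * T 0F 0F + T 0F 1F * T 1F 0F) +
          T 0F 1F * (T 1F 0F * T 0F 0F + T 1F 1F * T 1F 0F)) ≡ size κ + (6 * T 0F 0F + 5)
        equation₀ = begin
          _ ≡⟨ cong₂ _+_ (sym (S-col₀ 0F)) (trans (cong₂ (λ x y → T 0F 0F * x + T 0F 1F * y) (sym (S-col₀ 0F)) (sym (S-col₀ 1F))) (sym (∑₂ (λ k → T 0F k * S k 0F)))) ⟩
          S 0F 0F + ∑ (λ k → T 0F k * S k 0F) ≡⟨ equation 0F full ⟩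
          size κ + (6 * T 0F 0F + 5 * χ κ κ) ≡⟨ cong (λ c → size κ + (6 * T 0F 0F + 5 * c)) (χ≡1 ≈-refl) ⟩
          size κ + (6 * T 0F 0F + 5) ∎
          where open ≡-Reasoning

        solution : T 0F 0F ≡ 2 × size κ ≡ 9 × T 1F 0F ≡ 1 × T 1F 1F ≡ 2
        solution = All.lookup (pair-arithmetic split) size∈ (s≤s (q≤4 x κ)) (s≤s (q≤4 x x)) (q-back κ~x)
          (≤-trans (m≤m+n _ (outside 1F)) (≤-reflexive (row 1F))) equation₀

        impossible : ⊥
        impossible = by split solution
          where
          open ≡-Reasoning
          by : (T 0F 0F ≡ 0 × T 0F 1F ≡ 4) ⊎ (T 0F 0F ≡ 2 × T 0F 1F ≡ 2) → T 0F 0F ≡ 2 × size κ ≡ 9 × T 1F 0F ≡ 1 × T 1F 1F ≡ 2 → ⊥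
          by (inj₁ (z , _)) (t , _) with () ← trans (sym z) t
          -- Now size x = 18, and the column of x would require 36 + 2R = 18 + 12.
          by (inj₂ (g , c)) (_ , l , k , a) = <⇒≱ {30} {36} (m≤m+n 31 5) (≤-trans (m≤m+n 36 (2 * R 1F 1F)) (≤-reflexive (begin
            36 + 2 * R 1F 1F                        ≡⟨ solve 1 (λ x → con 36 :+ con 2 :* x := con 8 :+ con 0 :+ (con 2 :* (con 8 :+ con 0) :+ con 2 :* (con 6 :+ x))) refl (R 1F 1F) ⟩
            8 + 0 + (2 * (8 + 0) + 2 * (6 + R 1F 1F))
              ≡⟨ sym (cong₂ _+_ s₀ (trans (∑₂ (λ k → T 0F k * S k 1F)) (cong₂ _+_ (cong₂ _*_ g s₀) (cong₂ _*_ c s₁)))) ⟩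
            S 0F 1F + ∑ (λ k → T 0F k * S k 1F)      ≡⟨ equation 1F full ⟩
            size x + (6 * T 0F 1F + 5 * χ κ x)       ≡⟨ cong₂ _+_ sx (cong₂ (λ u v → 6 * u + 5 * v) c (χ≡0 (x≉κ ∘ ≈-sym))) ⟩
            30                                       ∎)))
            where
            open +-*-Solver
            sx : size x ≡ 18
            sx = trans (sym (*-identityʳ (size x))) (trans (cong (size x *_) (sym k)) (trans (sym (size-q κ x)) (cong₂ _*_ l c)))
            s₀ : S 0F 1F ≡ 8 + 0
            s₀ = cong₂ _+_ (trans (∑₂ (λ k → T 0F k * T k 1F)) (cong₂ _+_ (cong₂ _*_ g c) (cong₂ _*_ c a))) (R≡0-row 1F full)
            s₁ : S 1F 1F ≡ 6 + R 1F 1F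
            s₁ = cong (_+ R 1F 1F) (trans (∑₂ (λ k → T 1F k * T k 1F)) (cong₂ _+_ (cong₂ _*_ k c) (cong₂ _*_ a a)))

    module Triple {x y : Fin n} (x≉κ : ¬ x ≈ κ) (y≉κ : ¬ y ≈ κ) (x≉y : ¬ x ≈ y) (κ~x : κ ~ x) (κ~y : κ ~ y)
      (q₀ : q κ κ ≡ 0) (q₁ : q κ x ≡ 2) (q₂ : q κ y ≡ 2) where
      r : Fin 3 → Fin n
      r 0F = κ
      r 1F = x
      r 2F = y

      r-inj : ∀ {i j} → r i ≈ r j → i ≡ j
      r-inj {0F} {0F} _ = refl
      r-inj {0F} {1F} p = ⊥-elim (x≉κ (≈-sym p))
      r-inj {0F} {2F} p = ⊥-elim (y≉κ (≈-sym p))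
      r-inj {1F} {0F} p = ⊥-elim (x≉κ p)
      r-inj {1F} {1F} _ = refl
      r-inj {1F} {2F} p = ⊥-elim (x≉y p)
      r-inj {2F} {0F} p = ⊥-elim (y≉κ p)
      r-inj {2F} {1F} p = ⊥-elim (x≉y (≈-sym p))
      r-inj {2F} {2F} _ = refl

      open Rows r r-inj public

      row : ∀ i → (T i 0F + (T i 1F + T i 2F)) + outside i ≡ 4
      row i = trans (cong (_+ outside i) (sym (∑₃ (T i)))) (row-sum i)

      full : outside 0F ≡ 0
      full = +-cancelˡ-≡ 4 _ _ (trans (cong (_+ outside 0F) (sym (cong₂ _+_ q₀ (cong₂ _+_ q₁ q₂)))) (row 0F))

      S₀ : ∀ j → S 0F j ≡ 2 * T 1F j + 2 * T 2F j
      S₀ j = trans (cong₂ _+_ (trans (∑₃ (λ k → T 0F k * T k j)) (cong₂ _+_ (cong (_* T 0F j) q₀) (cong₂ _+_ (cong (_* T 1F j) q₁) (cong (_* T 2F j) q₂)))) (R≡0-row j full)) (+-identityʳ _)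

      equation′ : ∀ j → S 0F j + (2 * S 1F j + 2 * S 2F j) ≡ size (r j) + (6 * T 0F j + 5 * χ κ (r j))
      equation′ j = trans (cong (S 0F j +_) (sym (trans (∑₃ (λ k → T 0F k * S k j)) (cong₂ _+_ (cong (_* S 0F j) q₀) (cong₂ _+_ (cong (_* S 1F j) q₁) (cong (_* S 2F j) q₂)))))) (equation j full)

      S-split : ∀ i j → S i j ≡ T i 0F * T 0F j + (T i 1F * T 1F j + T i 2F * T 2F j) + R i j
      S-split i j = cong (_+ R i j) (∑₃ (λ k → T i k * T k j))

    module Contradiction {x y : Fin n} (x≉κ : ¬ x ≈ κ) (y≉κ : ¬ y ≈ κ) (x≉y : ¬ x ≈ y) (κ~x : κ ~ x) (κ~y : κ ~ y)
      (q₀ : q κ κ ≡ 0) (q₁ : q κ x ≡ 2) (q₂ : q κ y ≡ 2) where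
      open Triple x≉κ y≉κ x≉y κ~x κ~y q₀ q₁ q₂

      k a b k′ c d : ℕ
      k  = q x κ
      a  = q x x
      b  = q x y
      k′ = q y κ
      c  = q y x
      d  = q y y

      size-k : size x * k ≡ 2 * size κ
      size-k = trans (sym (size-q κ x)) (trans (cong (size κ *_) q₁) (*-comm (size κ) 2))

      eq₁ : lhs₁ k a b k′ c d + 2 * (R 1F 1F + R 2F 1F) ≡ size x + 12
      eq₁ = begin
        lhs₁ k a b k′ c d + 2 * (R 1F 1F + R 2F 1F)
          ≡⟨ solve 8 (λ k a b k′ c d r s → (con 2 :* a :+ con 2 :* c) :+ (con 2 :* (k :* con 2 :+ (a :* a :+ b :* c)) :+ con 2 :* (k′ :* con 2 :+ (c :* a :+ d :* c))) :+ con 2 :* (r :+ s)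
               := (con 2 :* a :+ con 2 :* c) :+ (con 2 :* ((k :* con 2 :+ (a :* a :+ b :* c)) :+ r) :+ con 2 :* ((k′ :* con 2 :+ (c :* a :+ d :* c)) :+ s))) refl k a b k′ c d (R 1F 1F) (R 2F 1F) ⟩
        (2 * a + 2 * c) + (2 * ((k * 2 + (a * a + b * c)) + R 1F 1F) + 2 * ((k′ * 2 + (c * a + d * c)) + R 2F 1F))
          ≡⟨ sym (cong₂ _+_ (S₀ 1F) (cong₂ (λ x y → 2 * x + 2 * y)
               (trans (S-split 1F 1F) (cong (λ t → k * t + (a * a + b * c) + R 1F 1F) q₁))
               (trans (S-split 2F 1F) (cong (λ t → k′ * t + (c * a + d * c) + R 2F 1F) q₁)))) ⟩
        S 0F 1F + (2 * S 1F 1F + 2 * S 2F 1F)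
          ≡⟨ equation′ 1F ⟩
        size x + (6 * q κ x + 5 * χ κ x)
          ≡⟨ cong₂ (λ u v → size x + (6 * u + 5 * v)) q₁ (χ≡0 (x≉κ ∘ ≈-sym)) ⟩
        size x + 12 ∎
        where
        open ≡-Reasoning
        open +-*-Solver

      eq₁-scaled : (lhs₁ k a b k′ c d + 2 * (R 1F 1F + R 2F 1F)) * k ≡ 2 * size κ + 12 * k
      eq₁-scaled = trans (cong (_* k) eq₁) (trans (*-distribʳ-+ k (size x) 12) (cong (_+ 12 * k) size-k))

      -- The terms R can only increase the left side of `eq₁-scaled`, and they vanish when x has no
      -- neighbour outside the family.
      no-misfit : ¬ Misfit (size κ) k a b k′ c d
      no-misfit (inj₁ big) = <⇒≱ big (≤-trans (*-monoˡ-≤ k (m≤m+n (lhs₁ k a b k′ c d) _)) (≤-reflexive eq₁-scaled))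
      no-misfit (inj₂ (inj₁ (sum , ne))) = ne (trans (cong (_* k) (sym (trans (cong (λ t → lhs₁ k a b k′ c d + 2 * t) (cong₂ _+_ (R≡0-row 1F full₁) (R≡0-col 2F full₁))) (+-identityʳ _)))) eq₁-scaled)
        where
        full₁ : outside 1F ≡ 0
        full₁ = +-cancelˡ-≡ 4 _ _ (trans (cong (_+ outside 1F) (trans (sym sum) (+-assoc k a b))) (row 1F))
      no-misfit (inj₂ (inj₂ (l≡9 , k≡1 , ab , sum , lhs≡22))) =
        from-no (4 ∣? 18) (subst₂ _∣_ R≡4 size≡18 (single-exit 1F exit))
        where
        exit : outside 1F ≡ 1
        exit = +-cancelˡ-≡ 3 _ _ (trans (cong (_+ outside 1F) (sym (cong₂ _+_ k≡1 ab))) (row 1F))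
        full₂ : outside 2F ≡ 0
        full₂ = +-cancelˡ-≡ 4 _ _ (trans (cong (_+ outside 2F) (trans (sym sum) (+-assoc k′ c d))) (row 2F))
        size≡18 : size x ≡ 18
        size≡18 = trans (sym (*-identityʳ (size x))) (trans (cong (size x *_) (sym k≡1)) (trans size-k (cong (2 *_) l≡9)))
        R≡4 : R 1F 1F ≡ 4
        R≡4 = *-cancelˡ-≡ (R 1F 1F) 4 2 (+-cancelˡ-≡ 22 _ _ (trans (cong₂ (λ u v → u + 2 * v) (sym lhs≡22) (sym (trans (cong (R 1F 1F +_) (R≡0-row 1F full₂)) (+-identityʳ _))))
          (trans eq₁ (cong (_+ 12) size≡18))))

    module Both {x y : Fin n} (x≉κ : ¬ x ≈ κ) (y≉κ : ¬ y ≈ κ) (x≉y : ¬ x ≈ y) (κ~x : κ ~ x) (κ~y : κ ~ y)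
      (q₀ : q κ κ ≡ 0) (q₁ : q κ x ≡ 2) (q₂ : q κ y ≡ 2) where
      open Triple x≉κ y≉κ x≉y κ~x κ~y q₀ q₁ q₂
      open Contradiction x≉κ y≉κ x≉y κ~x κ~y q₀ q₁ q₂ using (k; a; b; k′; c; d; size-k; no-misfit)
      open Contradiction y≉κ x≉κ (x≉y ∘ ≈-sym) κ~y κ~x q₀ q₂ q₁ using () renaming (size-k to size-k′; no-misfit to no-misfit′)

      eq₀ : lhs₀ k a b k′ c d ≡ size κ + 5
      eq₀ = begin
        lhs₀ k a b k′ c d
          ≡⟨ sym (cong₂ _+_ (S₀ 0F) (cong₂ (λ x y → 2 * x + 2 * y) (S-col₀ 1F) (S-col₀ 2F))) ⟩
        S 0F 0F + (2 * S 1F 0F + 2 * S 2F 0F)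
          ≡⟨ equation′ 0F ⟩
        size κ + (6 * q κ κ + 5 * χ κ κ)
          ≡⟨ cong₂ (λ u v → size κ + (6 * u + 5 * v)) q₀ (χ≡1 ≈-refl) ⟩
        size κ + 5 ∎
        where
        open ≡-Reasoning
        S-col₀ : ∀ i → S i 0F ≡ T i 1F * k + T i 2F * k′
        S-col₀ i = trans (S-split i 0F) (trans (cong₂ (λ u v → T i 0F * u + (T i 1F * k + T i 2F * k′) + v) q₀ (R≡0-col i full))
          (trans (+-identityʳ _) (cong (_+ (T i 1F * k + T i 2F * k′)) (*-zeroʳ (T i 0F)))))

      -- Edges between x and y give size x · b = size y · c, and both size x · k and size y · k′
      -- equal 2 · size κ.
      cross : b * k′ ≡ c * k
      cross = *-cancelˡ-≡ (b * k′) (c * k) (size x * size y) ⦃ >-nonZero (*-mono-≤ (<⇒≤ (size≥2 x)) (<⇒≤ (size≥2 y))) ⦄ (begin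
        size x * size y * (b * k′)      ≡⟨ solve 4 (λ s t b k → s :* t :* (b :* k) := s :* b :* (t :* k)) refl (size x) (size y) b k′ ⟩
        size x * b * (size y * k′)      ≡⟨ cong₂ _*_ (size-q x y) (trans size-k′ (sym size-k)) ⟩
        size y * c * (size x * k)       ≡⟨ solve 4 (λ s t c k → t :* c :* (s :* k) := s :* t :* (c :* k)) refl (size x) (size y) c k ⟩
        size x * size y * (c * k)       ∎)
        where
        open ≡-Reasoning
        open +-*-Solver

      row≤ : ∀ i → T i 0F + T i 1F + T i 2F ≤ 4
      row≤ i = ≤-trans (≤-reflexive (+-assoc (T i 0F) (T i 1F) (T i 2F))) (≤-trans (m≤m+n _ (outside i)) (≤-reflexive (row i)))

      entry<4 : ∀ i → 1 ≤ T i 0F → T i 1F < 4 × T i 2F < 4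
      entry<4 i p = ≤-trans (+-mono-≤ p (m≤m+n (T i 1F) (T i 2F))) (≤-trans (≤-reflexive (sym (+-assoc (T i 0F) (T i 1F) (T i 2F)))) (row≤ i))
                  , ≤-trans (+-mono-≤ p (m≤n+m (T i 2F) (T i 1F))) (≤-trans (≤-reflexive (sym (+-assoc (T i 0F) (T i 1F) (T i 2F)))) (row≤ i))

      impossible : ⊥
      impossible = by (All.lookup (All.lookup (All.lookup triple-arithmetic size∈)
          (odd-or-three {size x} {k} {size κ} size-k κ-odd (even-size x≉κ) (q-back κ~x) (q≤4 x κ)))
          (odd-or-three {size y} {k′} {size κ} size-k′ κ-odd (even-size y≉κ) (q-back κ~y) (q≤4 y κ))
          (proj₁ (entry<4 1F (q-back κ~x))) (proj₂ (entry<4 1F (q-back κ~x)))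
          (proj₁ (entry<4 2F (q-back κ~y))) (proj₂ (entry<4 2F (q-back κ~y)))
          (row≤ 1F) (row≤ 2F) cross eq₀)
        where
        by : Misfit (size κ) k a b k′ c d ⊎ Misfit (size κ) k′ d c k b a → ⊥
        by (inj₁ m) = no-misfit m
        by (inj₂ m) = no-misfit′ m

    exit-class : ∀ {m} (r : Fin m → Fin n) (r-inj : ∀ {i j} → r i ≈ r j → i ≡ j) (i : Fin m) → r i ≡ κ →
      ∀ t → t + 1 ≤ 4 → ∑ (λ j → q (r i) (r j)) ≡ t → ∃ λ w → κ ~ w × (∀ j → ¬ w ≈ r j)
    exit-class r r-inj i refl t t<4 e = let (w , a , new) = leave i some in w , a , λ j p → new (j , p)
      where
      open Rows r r-inj
      some : 1 ≤ outside i
      some = +-cancelˡ-≤ t _ _ (≤-trans t<4 (≤-reflexive (trans (sym (row-sum i)) (cong (_+ outside i) e))))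

    -- The row of κ has even entries and sum 4, its nonzero entries outside κ belonging to
    -- neighbouring classes. That leaves 4 at κ itself, 2 and one further 2, or 0 followed by a
    -- single 4 or by two entries 2.
    contradiction : ⊥
    contradiction = by (even-≤4 (q-diag-even κ κ-odd) (q≤4 κ κ))
      where
      first-exit : ∀ t → t + 1 ≤ 4 → q κ κ ≡ t → ∃ λ x → κ ~ x × ¬ x ≈ κ
      first-exit t lt e = let (x , a , new) = exit-class {1} (λ _ → κ) (λ { {0F} {0F} _ → refl }) 0F refl t lt (trans (∑₁ _) e) in x , a , new 0F
      by : q κ κ ≡ 0 ⊎ q κ κ ≡ 2 ⊎ q κ κ ≡ 4 → ⊥
      by (inj₂ (inj₂ e)) = not-closed e
      by (inj₂ (inj₁ e)) =
        let (x , a , new) = first-exit 2 (m≤m+n 3 1) e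
        in two new a (even-≤4 (even-q new) (q≤4 κ x))
        where
        two : ∀ {x} → ¬ x ≈ κ → κ ~ x → q κ x ≡ 0 ⊎ q κ x ≡ 2 ⊎ q κ x ≡ 4 → ⊥
        two new a (inj₁ z) with () ← subst (1 ≤_) z (~⇒q≥1 a ≈-refl)
        two new a (inj₂ (inj₁ f)) = Pair.impossible new a (inj₂ (e , f))
        two new a (inj₂ (inj₂ f)) = <⇒≱ {4} {6} (m≤m+n 5 1) (≤-trans (≤-reflexive (sym (cong₂ _+_ e f))) (≤-trans (m≤m+n _ _) (≤-reflexive (Pair.row new a 0F))))
      by (inj₁ e) =
        let (x , a , new) = first-exit 0 (m≤m+n 1 3) e
        in zero-case new a (even-≤4 (even-q new) (q≤4 κ x))
        where
        zero-case : ∀ {x} → ¬ x ≈ κ → κ ~ x → q κ x ≡ 0 ⊎ q κ x ≡ 2 ⊎ q κ x ≡ 4 → ⊥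
        zero-case new a (inj₁ z) with () ← subst (1 ≤_) z (~⇒q≥1 a ≈-refl)
        zero-case new a (inj₂ (inj₂ f)) = Pair.impossible new a (inj₁ (e , f))
        zero-case {x} new a (inj₂ (inj₁ f)) =
          let (y , a' , new') = exit-class r r-inj 0F refl 2 (m≤m+n 3 1) (trans (∑₂ _) (cong₂ _+_ e f))
          in second a' (new' 0F) (new' 1F) (even-≤4 (even-q (new' 0F)) (q≤4 κ y))
          where
          open Pair new a
          second : ∀ {y} → κ ~ y → ¬ y ≈ κ → ¬ y ≈ x → q κ y ≡ 0 ⊎ q κ y ≡ 2 ⊎ q κ y ≡ 4 → ⊥
          second a' nκ nx (inj₁ z) with () ← subst (1 ≤_) z (~⇒q≥1 a' ≈-refl)
          second a' nκ nx (inj₂ (inj₁ g)) = Both.impossible new nκ (nx ∘ ≈-sym) a a' e f g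
          second {y} a' nκ nx (inj₂ (inj₂ g)) = <⇒≱ {4} {6} (m≤m+n 5 1) (≤-trans (≤-reflexive (sym (cong₂ _+_ f g)))
            (≤-trans (∑-≥₂′) (≤-reflexive (A⊛-const 1 κ))))
            where
            ∑-≥₂′ : q κ x + q κ y ≤ (A ⊛ (λ _ → 1)) κ
            ∑-≥₂′ = ≤-trans (≤-reflexive (trans (cong₂ _+_ (q-def κ x) (q-def κ y)) (sym (⊛-+ A (λ w → χ w x) (λ w → χ w y) κ)))) (⊛-mono A κ (λ w _ → disjoint w))
              where
              disjoint : ∀ w → χ w x + χ w y ≤ 1
              disjoint w = cases (w ≈? x) (w ≈? y)
                where
                cases : Dec (w ≈ x) → Dec (w ≈ y) → χ w x + χ w y ≤ 1
                cases (yes p) (yes p') = ⊥-elim (nx (≈-trans (≈-sym p') p))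
                cases (yes p) (no np)  = ≤-reflexive (cong₂ _+_ (χ≡1 p) (χ≡0 np))
                cases (no np) (yes p)  = ≤-reflexive (cong₂ _+_ (χ≡0 np) (χ≡1 p))
                cases (no np) (no np') = ≤-trans (≤-reflexive (cong₂ _+_ (χ≡0 np) (χ≡0 np'))) z≤n

  nonexistence : ⊥
  nonexistence = let (κ , κ-odd , κ-only) = unique-odd-class in OneOddClass.contradiction κ κ-odd κ-only

theorem6p4 : (G : Graph (moore 4 3 ∸ 2)) → ¬ IsMooreDefectGraph 4 3 2 G
theorem6p4 G ((degree≤4 , _) , (within , _)) = DefectTwo.nonexistence structure
  where
  open Regularity G degree≤4 within
  structure : QuarticDefect2 (moore 4 3 ∸ 2)
  structure = record
    { A = A ; A≤1 = A≤1 ; A-sym = A-sym ; A-diag = A-diag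
    ; regular = regular (m≤m+n 41 10) ; near = near ; order = refl }
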